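{- Let $k\geq t+2\geq 4$ and $n\geq t+(k-t)\cdot\max\{18(t+2),\,2ek\}$. If $\mathcal{F},\mathcal{G}\subseteq\binom{[n]}{k}$ are cross $t$-intersecting, then $$\min\{\gamma_t(\mathcal{F}),\gamma_t(\mathcal{G})\}\leq\gamma_t(\mathcal{A}(n,k,t)).$$ If equality holds, then $\mathcal{F},\mathcal{G}\subseteq\mathcal{A}(Z)$ for some $Z\in\binom{[n]}{t+2}$.
   Context: $n,k,t$ are positive integers, $[n]=\{1,\dots,n\}$, $\binom{[n]}{k}$ is the family of all $k$-subsets of $[n]$, and $e$ is the base of the natural logarithm. Families $\mathcal{F},\mathcal{G}$ are cross $t$-intersecting if $|F\cap G|\ge t$ for all $F\in\mathcal{F}$, $G\in\mathcal{G}$. For a family $\mathcal{F}$ of subsets of $[n]$, $\Delta_t(\mathcal{F})=\max\{|\{F\in\mathcal{F}:S\subseteq F\}|:S\in\binom{[n]}{t}\}$ and the $t$-diversity is $\gamma_t(\mathcal{F}):=|\mathcal{F}|-\Delta_t(\mathcal{F})$. For $Z\in\binom{[n]}{t+2}$, $\mathcal{A}(Z)=\{F\in\binom{[n]}{k}:|F\cap Z|\geq t+1\}$, and $\mathcal{A}(n,k,t)=\mathcal{A}([t+2])$; one has $\gamma_t(\mathcal{A}(n,k,t))=t\binom{n-t-2}{k-t-1}$. -}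

module Defs where

open import Data.Bool using (Bool; T; _∧_)
open import Data.Fin using (toℕ)
open import Data.Fin.Subset using (Subset; inside; outside; ∣_∣; _∩_)
open import Data.Fin.Subset.Properties using (_⊆?_)
open import Data.Integer using (+_)
open import Data.List using (List; []; _∷_; _++_; map; filterᵇ; length)
open import Data.List.Extrema.Nat using (max)
open import Data.Nat using (ℕ; zero; suc; _+_; _*_; _∸_; _≤_; _≤?_; _≟_; _<ᵇ_; _!)
open import Data.Nat.Properties using (_!≢0)
open import Data.Rational as ℚ using (ℚ; 0ℚ)
open import Data.Vec using ([]; _∷_; tabulate)
open import Relation.Nullary.Decidable using (⌊_⌋; _×-dec_)

-- A family of subsets of an n-element set is given by its indicator function.
-- The ground set [n] = {1, …, n} is Fin n, with i ∈ Fin n standing for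
-- toℕ i + 1.

Family : ℕ → Set
Family n = Subset n → Bool

infix 4 _∈_ _⊆_

_∈_ : ∀ {n} → Subset n → Family n → Set
F ∈ 𝓕 = T (𝓕 F)

_⊆_ : ∀ {n} → Family n → Family n → Set
𝓕 ⊆ 𝓖 = ∀ F → F ∈ 𝓕 → F ∈ 𝓖

allSubsets : ∀ n → List (Subset n)
allSubsets zero    = [] ∷ []
allSubsets (suc n) = map (outside ∷_) (allSubsets n) ++ map (inside ∷_) (allSubsets n)

card : ∀ {n} → Family n → ℕ
card 𝓕 = length (filterᵇ 𝓕 (allSubsets _))

binom[_] : ∀ {n} → ℕ → Family n
binom[ k ] F = ⌊ ∣ F ∣ ≟ k ⌋

CrossIntersecting : ∀ {n} → ℕ → Family n → Family n → Set
CrossIntersecting t 𝓕 𝓖 = ∀ F G → F ∈ 𝓕 → G ∈ 𝓖 → t ≤ ∣ F ∩ G ∣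

containing : ∀ {n} → Subset n → Family n → Family n
containing S 𝓕 F = 𝓕 F ∧ ⌊ S ⊆? F ⌋

-- The default value 0 only matters when there are no t-subsets (t > n).

Δ : ∀ {n} → ℕ → Family n → ℕ
Δ t 𝓕 = max 0 (map (λ S → card (containing S 𝓕)) (filterᵇ binom[ t ] (allSubsets _)))

-- Truncated subtraction is exact here, since Δ t 𝓕 ≤ card 𝓕.

γ : ∀ {n} → ℕ → Family n → ℕ
γ t 𝓕 = card 𝓕 ∸ Δ t 𝓕

𝓐 : ∀ {n} → ℕ → ℕ → Subset n → Family n
𝓐 k t Z F = ⌊ (∣ F ∣ ≟ k) ×-dec (t + 1 ≤? ∣ F ∩ Z ∣) ⌋

-- The subset {1, …, m} of [n].

initial : ∀ n → ℕ → Subset n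
initial n m = tabulate (λ i → toℕ i <ᵇ m)

𝓐₀ : ∀ n → ℕ → ℕ → Family n
𝓐₀ n k t = 𝓐 k t (initial n (t + 2))

fromℕ : ℕ → ℚ
fromℕ m = + m ℚ./ 1

-- e-sum m = 1/0! + 1/1! + ⋯ + 1/m!

1/_! : ℕ → ℚ
1/ m ! = (+ 1 ℚ./ (m !)) {{m !≢0}}

e-sum : ℕ → ℚ
e-sum zero    = 1/ 0 !
e-sum (suc m) = e-sum m ℚ.+ 1/ suc m !

-- threshold k t x = t + (k − t) · max {18 (t + 2), 2 x k}

threshold : ℕ → ℕ → ℚ → ℚ
threshold k t x =
  fromℕ t ℚ.+ fromℕ (k ∸ t) ℚ.* (fromℕ (18 * (t + 2)) ℚ.⊔ (fromℕ 2 ℚ.* x ℚ.* fromℕ k))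

-- n ≥ threshold k t e for the real number e = sup_m e-sum m.  As threshold k t
-- is continuous and nondecreasing, threshold k t e is the supremum of the
-- values threshold k t (e-sum m), so n is at least threshold k t e exactly when
-- it is at least each of those values.

AtLeastThreshold : ℕ → ℕ → ℕ → Set
AtLeastThreshold n k t = ∀ m → threshold k t (e-sum m) ℚ.≤ fromℕ n

{-# OPTIONS --safe #-}

-- Assume both diversities are at least t C(n-t-2, k-t-1). A set T is a cover of
-- a family if it meets all its members in at least t elements, so each of 𝓕, 𝓖
-- consists of covers of the other. Going down from size k, replace the two
-- families by their covers and drop those of the largest size i = t + j that
-- contain no smaller cover. Branching over the elements of a member of the
-- opposite family shows that at most C(s, t) (j + 1)^j of these occur, where s is
-- the size of some member of the opposite family. As n - t ≥ (k - t) Q with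
-- Q = max {18 (t + 2), 5 k}, the number of k-sets above the dropped sets is less
-- than about C(n-t-1, k-t-1), so it cannot account for the diversity.
--
-- What survives is a cross t-intersecting pair of families of (t + 1)-sets, each
-- of which must account for the diversity. If one of them contains two sets
-- meeting in fewer than t elements, the members of the other are a fixed
-- (t - 1)-set joined to edges of a 4-cycle, and in one of the two families all
-- members but one contain a common t-set: too few. Otherwise their union is
-- t-intersecting, hence lies in a (t + 2)-set Z. Finally, a member F of 𝓕 outside
-- 𝓐 (Z) meets Z - z in fewer than t elements for some z ∈ Z, so a member of 𝓖 above
-- Z - z but avoiding z contains one of k sets of size t + 2. These are negligible,
-- and 𝓖 would have too small a diversity.

module Submission where

open import Defs
open import Data.Bool using (Bool; true; false; T; _∧_; _∨_; not; T?)
open import Data.Bool.ListAction using (any)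
open import Data.Bool.Properties using (T-∧; T-∨)
open import Data.Empty using (⊥; ⊥-elim)
open import Data.Fin as Fin using (Fin; zero; suc)
open import Data.Fin.Properties using (suc-injective)
open import Data.Fin.Subset using (Subset; inside; outside; ∣_∣; _∩_; _∪_; _─_; _-_; ⁅_⁆; ⊤; Nonempty) renaming (_∈_ to _∈ˢ_; _∉_ to _∉ˢ_; _⊆_ to _⊆ˢ_; ⊥ to ∅)
open import Data.Fin.Subset.Properties using (_⊆?_; _∈?_; anySubset?; nonempty?; p⊆q⇒∣p∣≤∣q∣; p⊂q⇒∣p∣<∣q∣; x∈p∩q⁺; x∈p∩q⁻; x∈p∪q⁻; p∩q⊆p; p∩q⊆q; p⊆p∪q; q⊆p∪q; p─q⊆p; x∈p∧x∉q⇒x∈p─q; x∈p∧x≢y⇒x∈p-y; x∈⁅x⁆; x∈⁅y⁆⇒x≡y; ∣⁅x⁆∣≡1; ∣⊤∣≡n; ∣⊥∣≡0; ∣p∣≤n; ∉⊥; ⊆-refl; ⊆-trans; drop-∷-⊆; out⊆; in⊆in; ∩-comm; ∣p∩q∣≤∣p∣; ∣p∩q∣≤∣q∣)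
open import Data.List using (List; []; _∷_; _++_; map; filterᵇ; length)
open import Data.List.Membership.Propositional using (find; lose) renaming (_∈_ to _∈ˡ_)
open import Data.List.Membership.Propositional.Properties using (∈-map⁺; ∈-map⁻; ∈-++⁺ˡ; ∈-++⁺ʳ; ∈-++⁻)
open import Data.List.Properties using (length-map; length-++)
open import Data.List.Relation.Unary.All as All using ([]; _∷_)
open import Data.List.Relation.Unary.AllPairs using ([]; _∷_)
open import Data.List.Relation.Unary.Any using (here; there)
open import Data.List.Relation.Unary.Unique.Propositional using (Unique)
import Data.List.Relation.Unary.Unique.Propositional.Properties as Unique
open import Data.Nat using (ℕ; zero; suc; _+_; _*_; _∸_; _^_; _≤_; _<_; _⊓_; _⊔_; z≤n; s≤s; _≤?_; _<?_; _≟_; pred; NonZero; >-nonZero)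
open import Data.Nat.Combinatorics using (_C_; nCk+nC[k+1]≡[n+1]C[k+1]; nC1≡n; nCk≡nC[n∸k]; k>n⇒nCk≡0)
open import Data.Nat.Properties hiding (suc-injective)
open import Data.Product using (_×_; _,_; proj₁; proj₂; ∃; ∃₂; ∃-syntax)
open import Data.Sum using (_⊎_; inj₁; inj₂; [_,_]′; swap)
open import Data.Vec using ([]; _∷_) renaming (here to hereᵛ; there to thereᵛ)
open import Function using (_∘_; case_of_; Equivalence)
open import Relation.Binary.PropositionalEquality using (_≡_; _≢_; refl; sym; trans; cong; cong₂; subst; module ≡-Reasoning)
open import Relation.Nullary using (¬_; Dec; yes; no; contradiction)
open import Relation.Nullary.Decidable using (⌊_⌋; toWitness; fromWitness; _×-dec_; ¬?)
open import Data.Nat.Tactic.RingSolver using (solve-∀)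
import Data.Integer as ℤ
import Data.Integer.Properties as ℤ
open import Data.Rational as ℚ using (ℚ; toℚᵘ)
import Data.Rational.Properties as ℚ
open import Data.Rational.Unnormalised as ℚᵘ using (mkℚᵘ; *≡*; *≤*)
import Data.Rational.Unnormalised.Properties as ℚᵘ
import Data.List.Extrema.Nat as Extrema
import Data.List.Relation.Unary.Any as Any
open import Data.List.Relation.Unary.Any.Properties using (any⁺; any⁻)

-- Counting families

infixr 7 _∩ᶠ_
infixl 5 _∖_

_∩ᶠ_ _∖_ : ∀ {n} → Family n → Family n → Family n
(𝓕 ∩ᶠ 𝓖) F = 𝓕 F ∧ 𝓖 F
(𝓕 ∖ 𝓖) F = 𝓕 F ∧ not (𝓖 F)

module _ {n} (𝓕 𝓖 : Family n) (F : Subset n) where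

  ∩ᶠ⁺ : F ∈ 𝓕 → F ∈ 𝓖 → F ∈ 𝓕 ∩ᶠ 𝓖
  ∩ᶠ⁺ p q = Equivalence.from T-∧ (p , q)

  ∩ᶠ⁻ : F ∈ 𝓕 ∩ᶠ 𝓖 → F ∈ 𝓕 × F ∈ 𝓖
  ∩ᶠ⁻ = Equivalence.to T-∧

  ∖⁺ : F ∈ 𝓕 → ¬ F ∈ 𝓖 → F ∈ 𝓕 ∖ 𝓖
  ∖⁺ p q with 𝓕 F | 𝓖 F
  ... | true | true  = q _
  ... | true | false = _

  ∖⁻ : F ∈ 𝓕 ∖ 𝓖 → F ∈ 𝓕 × ¬ F ∈ 𝓖
  ∖⁻ p with 𝓕 F | 𝓖 F
  ... | true | false = _ , λ ()

∈-allSubsets : ∀ {n} (F : Subset n) → F ∈ˡ allSubsets n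
∈-allSubsets []            = here refl
∈-allSubsets (outside ∷ F) = ∈-++⁺ˡ (∈-map⁺ _ (∈-allSubsets F))
∈-allSubsets (inside ∷ F)  = ∈-++⁺ʳ _ (∈-map⁺ _ (∈-allSubsets F))

module _ {A : Set} where

  ∈-filterᵇ⁺ : ∀ (p : A → Bool) {x xs} → x ∈ˡ xs → T (p x) → x ∈ˡ filterᵇ p xs
  ∈-filterᵇ⁺ p {xs = y ∷ _} (here refl) px with true ← p y = here refl
  ∈-filterᵇ⁺ p {xs = y ∷ _} (there i) px with p y
  ... | true  = there (∈-filterᵇ⁺ p i px)
  ... | false = ∈-filterᵇ⁺ p i px

  ∈-filterᵇ⁻ : ∀ (p : A → Bool) {x} xs → x ∈ˡ filterᵇ p xs → T (p x)
  ∈-filterᵇ⁻ p (y ∷ xs) i with p y in eq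
  ∈-filterᵇ⁻ p (y ∷ xs) (here refl) | true = subst T (sym eq) _
  ∈-filterᵇ⁻ p (y ∷ xs) (there i) | true  = ∈-filterᵇ⁻ p xs i
  ∈-filterᵇ⁻ p (y ∷ xs) i         | false = ∈-filterᵇ⁻ p xs i

  length-filterᵇ-split : ∀ (p q : A → Bool) xs → length (filterᵇ p xs) ≡
    length (filterᵇ (λ x → p x ∧ q x) xs) + length (filterᵇ (λ x → p x ∧ not (q x)) xs)
  length-filterᵇ-split p q [] = refl
  length-filterᵇ-split p q (x ∷ xs) with p x | q x
  ... | true  | true  = cong suc (length-filterᵇ-split p q xs)
  ... | true  | false = trans (cong suc (length-filterᵇ-split p q xs)) (sym (+-suc _ _))
  ... | false | _     = length-filterᵇ-split p q xs

  length-filterᵇ-mono : ∀ (p q : A → Bool) → (∀ x → T (p x) → T (q x)) →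
    ∀ xs → length (filterᵇ p xs) ≤ length (filterᵇ q xs)
  length-filterᵇ-mono p q p⇒q [] = z≤n
  length-filterᵇ-mono p q p⇒q (x ∷ xs) with p x | q x | p⇒q x
  ... | true  | true  | _ = s≤s (length-filterᵇ-mono p q p⇒q xs)
  ... | true  | false | f = ⊥-elim (f _)
  ... | false | true  | _ = m≤n⇒m≤1+n (length-filterᵇ-mono p q p⇒q xs)
  ... | false | false | _ = length-filterᵇ-mono p q p⇒q xs

  length-filterᵇ-++ : ∀ (p : A → Bool) xs {ys} →
    length (filterᵇ p (xs ++ ys)) ≡ length (filterᵇ p xs) + length (filterᵇ p ys)
  length-filterᵇ-++ p [] = refl
  length-filterᵇ-++ p (x ∷ xs) with p x
  ... | true  = cong suc (length-filterᵇ-++ p xs)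
  ... | false = length-filterᵇ-++ p xs

  length-filterᵇ-map : ∀ {B : Set} (p : A → Bool) (f : B → A) xs →
    length (filterᵇ p (map f xs)) ≡ length (filterᵇ (p ∘ f) xs)
  length-filterᵇ-map p f [] = refl
  length-filterᵇ-map p f (x ∷ xs) with p (f x)
  ... | true  = cong suc (length-filterᵇ-map p f xs)
  ... | false = length-filterᵇ-map p f xs

  filterᵇ-none : ∀ (p : A → Bool) → (∀ x → ¬ T (p x)) → ∀ xs → filterᵇ p xs ≡ []
  filterᵇ-none p none [] = refl
  filterᵇ-none p none (x ∷ xs) with p x | none x
  ... | true  | f = ⊥-elim (f _)
  ... | false | _ = filterᵇ-none p none xs

card-suc : ∀ {n} (𝓕 : Family (suc n)) →
  card 𝓕 ≡ card (𝓕 ∘ (outside ∷_)) + card (𝓕 ∘ (inside ∷_))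
card-suc {n} 𝓕 = trans (length-filterᵇ-++ 𝓕 (map (outside ∷_) (allSubsets n)))
  (cong₂ _+_ (length-filterᵇ-map 𝓕 (outside ∷_) (allSubsets n))
             (length-filterᵇ-map 𝓕 (inside ∷_) (allSubsets n)))

module _ {n : ℕ} where

  card-split : ∀ (𝓕 𝓖 : Family n) → card 𝓕 ≡ card (𝓕 ∩ᶠ 𝓖) + card (𝓕 ∖ 𝓖)
  card-split 𝓕 𝓖 = length-filterᵇ-split 𝓕 𝓖 (allSubsets n)

  card-mono : ∀ {𝓕 𝓖 : Family n} → 𝓕 ⊆ 𝓖 → card 𝓕 ≤ card 𝓖
  card-mono {𝓕} {𝓖} 𝓕⊆𝓖 = length-filterᵇ-mono 𝓕 𝓖 𝓕⊆𝓖 (allSubsets n)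

  card-empty : ∀ {𝓕 : Family n} → (∀ F → ¬ F ∈ 𝓕) → card 𝓕 ≡ 0
  card-empty {𝓕} none = cong length (filterᵇ-none 𝓕 none (allSubsets n))

  card-cover : ∀ {A : Set} {b} (xs : List A) (P : A → Family n) (𝓕 : Family n) →
    (∀ {x} → x ∈ˡ xs → card (P x) ≤ b) →
    (∀ F → F ∈ 𝓕 → ∃ λ x → x ∈ˡ xs × F ∈ P x) →
    card 𝓕 ≤ length xs * b
  card-cover [] P 𝓕 small cover =
    ≤-reflexive (card-empty λ F F∈𝓕 → case proj₁ (proj₂ (cover F F∈𝓕)) of λ ())
  card-cover {b = b} (x ∷ xs) P 𝓕 small cover = begin
    card 𝓕                           ≡⟨ card-split 𝓕 (P x) ⟩
    card (𝓕 ∩ᶠ P x) + card (𝓕 ∖ P x) ≤⟨ +-mono-≤ first rest ⟩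
    b + length xs * b                ∎
    where
    open ≤-Reasoning
    first : card (𝓕 ∩ᶠ P x) ≤ b
    first = ≤-trans (card-mono λ F F∈ → proj₂ (∩ᶠ⁻ 𝓕 (P x) F F∈)) (small (here refl))
    cover′ : ∀ F → F ∈ 𝓕 ∖ P x → ∃ λ y → y ∈ˡ xs × F ∈ P y
    cover′ F F∈ with ∖⁻ 𝓕 (P x) F F∈
    ... | F∈𝓕 , F∉ with cover F F∈𝓕
    ... | y , here refl , F∈P = contradiction F∈P F∉
    ... | y , there i , F∈P = y , i , F∈P
    rest : card (𝓕 ∖ P x) ≤ length xs * b
    rest = card-cover xs P (𝓕 ∖ P x) (small ∘ there) cover′

  card-disjoint : ∀ {A : Set} {b} {xs : List A} (P : A → Family n) (𝓕 : Family n) → Unique xs →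
    (∀ {x} → x ∈ˡ xs → b ≤ card (P x)) →
    (∀ {x} → x ∈ˡ xs → P x ⊆ 𝓕) →
    (∀ {x y} F → x ∈ˡ xs → y ∈ˡ xs → F ∈ P x → F ∈ P y → x ≡ y) →
    length xs * b ≤ card 𝓕
  card-disjoint {xs = []} P 𝓕 _ _ _ _ = z≤n
  card-disjoint {b = b} {xs = x ∷ xs} P 𝓕 (x∉xs ∷ uniq) large inside𝓕 disjoint = begin
    b + length xs * b                ≤⟨ +-mono-≤ first rest ⟩
    card (𝓕 ∩ᶠ P x) + card (𝓕 ∖ P x) ≡⟨ card-split 𝓕 (P x) ⟨
    card 𝓕                           ∎
    where
    open ≤-Reasoning
    first : b ≤ card (𝓕 ∩ᶠ P x)
    first = ≤-trans (large (here refl))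
      (card-mono λ F F∈ → ∩ᶠ⁺ 𝓕 (P x) F (inside𝓕 (here refl) F F∈) F∈)
    rest : length xs * b ≤ card (𝓕 ∖ P x)
    rest = card-disjoint P (𝓕 ∖ P x) uniq (large ∘ there)
      (λ i F F∈ → ∖⁺ 𝓕 (P x) F (inside𝓕 (there i) F F∈)
        λ F∈P → All.lookup x∉xs i (disjoint F (here refl) (there i) F∈P F∈))
      (λ F i j → disjoint F (there i) (there j))

-- The number of k-subsets of an n-set containing a given s-subset: it is
-- C(n - s, k - s) for s ≤ k and 0 otherwise, without truncated subtraction.

stars : ℕ → ℕ → ℕ → ℕ
stars n       k       zero    = n C k
stars zero    k       (suc s) = 0
stars (suc n) zero    (suc s) = 0
stars (suc n) (suc k) (suc s) = stars n k s

star : ∀ {n} → ℕ → Subset n → Family n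
star k X = containing X binom[ k ]

module _ {n} (k : ℕ) (X F : Subset n) where

  star⁺ : ∣ F ∣ ≡ k → X ⊆ˢ F → F ∈ star k X
  star⁺ p q = ∩ᶠ⁺ binom[ k ] (λ G → ⌊ X ⊆? G ⌋) F (fromWitness p) (fromWitness {a? = X ⊆? F} q)

  star⁻ : F ∈ star k X → ∣ F ∣ ≡ k × X ⊆ˢ F
  star⁻ F∈ with ∩ᶠ⁻ binom[ k ] (λ G → ⌊ X ⊆? G ⌋) F F∈
  ... | p , q = toWitness p , toWitness {a? = X ⊆? F} q

card-cong : ∀ {n} {𝓕 𝓖 : Family n} → 𝓕 ⊆ 𝓖 → 𝓖 ⊆ 𝓕 → card 𝓕 ≡ card 𝓖
card-cong p q = ≤-antisym (card-mono p) (card-mono q)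

-- Pascal's rule after the fixed elements are stripped off: the summands count the sets that leave
-- out or take a new element outside the fixed `s`-set. At `s = n + 1` the identity fails, for
-- instance when `k = n`.
stars-pascal : ∀ n k s → s ≤ n → stars n (suc k) s + stars n k s ≡ stars (suc n) (suc k) s
stars-pascal n k zero _ = trans (+-comm (n C suc k) (n C k)) (nCk+nC[k+1]≡[n+1]C[k+1] n k)
stars-pascal (suc n) zero    (suc zero)    _ = refl
stars-pascal (suc n) zero    (suc (suc s)) (s≤s s≤n) with n
... | zero  = refl
... | suc n = refl
stars-pascal (suc n) (suc k) (suc s) (s≤s s≤n) = stars-pascal n k s s≤n

stars-zero : ∀ n s → s ≤ n → stars (suc n) zero s ≡ stars n zero s
stars-zero n zero _ = refl
stars-zero (suc n) (suc s) _ = refl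

-- Induction on the ground set. If the first element lies in `X`, every counted set contains it and
-- all three parameters drop by one; otherwise the sets with and without it add up by
-- `stars-pascal`.
card-star : ∀ {n} k (X : Subset n) → card (star k X) ≡ stars n k ∣ X ∣
card-star zero    [] = refl
card-star (suc k) [] = sym (k>n⇒nCk≡0 {0} {suc k} (s≤s z≤n))
card-star {suc n} zero (inside ∷ X) =
  card-empty {𝓕 = star zero (inside ∷ X)} none
  where
  none : ∀ F → ¬ F ∈ star zero (inside ∷ X)
  none (outside ∷ F) F∈ = case proj₂ (star⁻ zero (inside ∷ X) (outside ∷ F) F∈) hereᵛ of λ ()
  none (inside ∷ F) F∈ = case proj₁ (star⁻ zero (inside ∷ X) (inside ∷ F) F∈) of λ ()
card-star {suc n} (suc k) (inside ∷ X) =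
  trans (card-suc (star (suc k) (inside ∷ X)))
    (trans (cong₂ _+_ (card-empty none) (card-cong {𝓖 = star k X} to from)) (card-star k X))
  where
  none : ∀ F → ¬ (outside ∷ F) ∈ star (suc k) (inside ∷ X)
  none F F∈ = case proj₂ (star⁻ (suc k) (inside ∷ X) (outside ∷ F) F∈) hereᵛ of λ ()
  to : ∀ F → (inside ∷ F) ∈ star (suc k) (inside ∷ X) → F ∈ star k X
  to F F∈ with star⁻ (suc k) (inside ∷ X) (inside ∷ F) F∈
  ... | p , q = star⁺ k X F (cong pred p) (drop-∷-⊆ q)
  from : ∀ F → F ∈ star k X → (inside ∷ F) ∈ star (suc k) (inside ∷ X)
  from F F∈ with star⁻ k X F F∈
  ... | p , q = star⁺ (suc k) (inside ∷ X) (inside ∷ F) (cong suc p) (in⊆in q)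
card-star {suc n} zero (outside ∷ X) =
  trans (card-suc (star zero (outside ∷ X)))
    (trans (cong₂ _+_ (card-cong {𝓖 = star zero X} to from) (card-empty none))
      (trans (+-identityʳ _) (trans (card-star zero X) (sym (stars-zero n ∣ X ∣ (∣p∣≤n X))))))
  where
  none : ∀ F → ¬ (inside ∷ F) ∈ star zero (outside ∷ X)
  none F F∈ = case proj₁ (star⁻ zero (outside ∷ X) (inside ∷ F) F∈) of λ ()
  to : ∀ F → (outside ∷ F) ∈ star zero (outside ∷ X) → F ∈ star zero X
  to F F∈ with star⁻ zero (outside ∷ X) (outside ∷ F) F∈
  ... | p , q = star⁺ zero X F p (drop-∷-⊆ q)
  from : ∀ F → F ∈ star zero X → (outside ∷ F) ∈ star zero (outside ∷ X)
  from F F∈ with star⁻ zero X F F∈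
  ... | p , q = star⁺ zero (outside ∷ X) (outside ∷ F) p (out⊆ q)
card-star {suc n} (suc k) (outside ∷ X) =
  trans (card-suc (star (suc k) (outside ∷ X)))
    (trans (cong₂ _+_ (card-cong {𝓖 = star (suc k) X} to from) (card-cong {𝓖 = star k X} to′ from′))
      (trans (cong₂ _+_ (card-star (suc k) X) (card-star k X)) (stars-pascal n k ∣ X ∣ (∣p∣≤n X))))
  where
  to : ∀ F → (outside ∷ F) ∈ star (suc k) (outside ∷ X) → F ∈ star (suc k) X
  to F F∈ with star⁻ (suc k) (outside ∷ X) (outside ∷ F) F∈
  ... | p , q = star⁺ (suc k) X F p (drop-∷-⊆ q)
  from : ∀ F → F ∈ star (suc k) X → (outside ∷ F) ∈ star (suc k) (outside ∷ X)
  from F F∈ with star⁻ (suc k) X F F∈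
  ... | p , q = star⁺ (suc k) (outside ∷ X) (outside ∷ F) p (out⊆ q)
  to′ : ∀ F → (inside ∷ F) ∈ star (suc k) (outside ∷ X) → F ∈ star k X
  to′ F F∈ with star⁻ (suc k) (outside ∷ X) (inside ∷ F) F∈
  ... | p , q = star⁺ k X F (cong pred p) (drop-∷-⊆ q)
  from′ : ∀ F → F ∈ star k X → (inside ∷ F) ∈ star (suc k) (outside ∷ X)
  from′ F F∈ with star⁻ k X F F∈
  ... | p , q = star⁺ (suc k) (outside ∷ X) (inside ∷ F) (cong suc p) (out⊆ q)

-- Finite subsets

∣p∪q∣+∣p∩q∣≡∣p∣+∣q∣ : ∀ {n} (p q : Subset n) → ∣ p ∪ q ∣ + ∣ p ∩ q ∣ ≡ ∣ p ∣ + ∣ q ∣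
∣p∪q∣+∣p∩q∣≡∣p∣+∣q∣ [] [] = refl
∣p∪q∣+∣p∩q∣≡∣p∣+∣q∣ (outside ∷ p) (outside ∷ q) = ∣p∪q∣+∣p∩q∣≡∣p∣+∣q∣ p q
∣p∪q∣+∣p∩q∣≡∣p∣+∣q∣ (outside ∷ p) (inside ∷ q)  =
  trans (cong suc (∣p∪q∣+∣p∩q∣≡∣p∣+∣q∣ p q)) (sym (+-suc _ _))
∣p∪q∣+∣p∩q∣≡∣p∣+∣q∣ (inside ∷ p) (outside ∷ q)  = cong suc (∣p∪q∣+∣p∩q∣≡∣p∣+∣q∣ p q)
∣p∪q∣+∣p∩q∣≡∣p∣+∣q∣ (inside ∷ p) (inside ∷ q)   =
  cong suc (trans (+-suc _ _) (trans (cong suc (∣p∪q∣+∣p∩q∣≡∣p∣+∣q∣ p q)) (sym (+-suc _ _))))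

∣p─q∣+∣p∩q∣≡∣p∣ : ∀ {n} (p q : Subset n) → ∣ p ─ q ∣ + ∣ p ∩ q ∣ ≡ ∣ p ∣
∣p─q∣+∣p∩q∣≡∣p∣ [] [] = refl
∣p─q∣+∣p∩q∣≡∣p∣ (outside ∷ p) (outside ∷ q) = ∣p─q∣+∣p∩q∣≡∣p∣ p q
∣p─q∣+∣p∩q∣≡∣p∣ (outside ∷ p) (inside ∷ q)  = ∣p─q∣+∣p∩q∣≡∣p∣ p q
∣p─q∣+∣p∩q∣≡∣p∣ (inside ∷ p) (outside ∷ q)  = cong suc (∣p─q∣+∣p∩q∣≡∣p∣ p q)
∣p─q∣+∣p∩q∣≡∣p∣ (inside ∷ p) (inside ∷ q)   = trans (+-suc _ _) (cong suc (∣p─q∣+∣p∩q∣≡∣p∣ p q))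

x∉p─q : ∀ {n} (p q : Subset n) {x} → x ∈ˢ p ─ q → x ∉ˢ q
x∉p─q (s ∷ p) (outside ∷ q) (thereᵛ x∈) (thereᵛ x∈q) = x∉p─q p q x∈ x∈q
x∉p─q (s ∷ p) (inside ∷ q) (thereᵛ x∈) (thereᵛ x∈q) = x∉p─q p q x∈ x∈q

∩-mono : ∀ {n} {p q r s : Subset n} → p ⊆ˢ r → q ⊆ˢ s → p ∩ q ⊆ˢ r ∩ s
∩-mono {p = p} {q} p⊆r q⊆s x∈ = x∈p∩q⁺ (p⊆r (p∩q⊆p p q x∈) , q⊆s (p∩q⊆q p q x∈))

∪-lub : ∀ {n} {p q r : Subset n} → p ⊆ˢ r → q ⊆ˢ r → p ∪ q ⊆ˢ r
∪-lub {p = p} {q} p⊆r q⊆r x∈ = [ p⊆r , q⊆r ]′ (x∈p∪q⁻ p q x∈)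

∩-glb : ∀ {n} {p q r : Subset n} → r ⊆ˢ p → r ⊆ˢ q → r ⊆ˢ p ∩ q
∩-glb r⊆p r⊆q x∈ = x∈p∩q⁺ (r⊆p x∈ , r⊆q x∈)

∣p∩q∣≡∣q∩p∣ : ∀ {n} (p q : Subset n) → ∣ p ∩ q ∣ ≡ ∣ q ∩ p ∣
∣p∩q∣≡∣q∩p∣ p q = cong ∣_∣ (∩-comm p q)

singleton⊆ : ∀ {n} {x} {p : Subset n} → x ∈ˢ p → ⁅ x ⁆ ⊆ˢ p
singleton⊆ {x = x} {p} x∈p y∈ = subst (_∈ˢ p) (sym (x∈⁅y⁆⇒x≡y x y∈)) x∈p

0<∣p∣⇒Nonempty : ∀ {n} (p : Subset n) → 0 < ∣ p ∣ → Nonempty p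
0<∣p∣⇒Nonempty (inside ∷ p) _ = zero , hereᵛ
0<∣p∣⇒Nonempty (outside ∷ p) 0<p with 0<∣p∣⇒Nonempty p 0<p
... | x , x∈p = suc x , thereᵛ x∈p

∣p∩q∣<∣p∣⇒∃ : ∀ {n} (p q : Subset n) → ∣ p ∩ q ∣ < ∣ p ∣ → ∃ λ x → x ∈ˢ p × x ∉ˢ q
∣p∩q∣<∣p∣⇒∃ p q lt with 0<∣p∣⇒Nonempty (p ─ q) (+-cancelʳ-< ∣ p ∩ q ∣ 0 _ (subst (∣ p ∩ q ∣ <_) (sym (∣p─q∣+∣p∩q∣≡∣p∣ p q)) lt))
... | x , x∈ = x , p─q⊆p p q x∈ , x∉p─q p q x∈

⊈⇒∃ : ∀ {n} (p q : Subset n) → ¬ p ⊆ˢ q → ∃ λ x → x ∈ˢ p × x ∉ˢ q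
⊈⇒∃ p q p⊈q with nonempty? (p ─ q)
... | yes (x , x∈) = x , p─q⊆p p q x∈ , x∉p─q p q x∈
... | no empty = ⊥-elim (p⊈q λ {x} x∈p → case x ∈? q of λ where
  (yes x∈q) → x∈q
  (no x∉q) → ⊥-elim (empty (x , x∈p∧x∉q⇒x∈p─q x∈p x∉q)))

⊆∧∣≥∣⇒⊇ : ∀ {n} {p q : Subset n} → p ⊆ˢ q → ∣ q ∣ ≤ ∣ p ∣ → q ⊆ˢ p
⊆∧∣≥∣⇒⊇ {p = p} {q} p⊆q q≤p {x} x∈q with x ∈? p
... | yes x∈p = x∈p
... | no x∉p = contradiction q≤p (<⇒≱ (p⊂q⇒∣p∣<∣q∣ (p⊆q , x , x∈q , x∉p)))

∣p∪⁅x⁆∣≡1+∣p∣ : ∀ {n} (p : Subset n) {x} → x ∉ˢ p → ∣ p ∪ ⁅ x ⁆ ∣ ≡ suc ∣ p ∣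
∣p∪⁅x⁆∣≡1+∣p∣ p {x} x∉p = begin
  ∣ p ∪ ⁅ x ⁆ ∣                   ≡⟨ +-identityʳ _ ⟨
  ∣ p ∪ ⁅ x ⁆ ∣ + 0               ≡⟨ cong (∣ p ∪ ⁅ x ⁆ ∣ +_) disjoint ⟨
  ∣ p ∪ ⁅ x ⁆ ∣ + ∣ p ∩ ⁅ x ⁆ ∣   ≡⟨ ∣p∪q∣+∣p∩q∣≡∣p∣+∣q∣ p ⁅ x ⁆ ⟩
  ∣ p ∣ + ∣ ⁅ x ⁆ ∣               ≡⟨ cong (∣ p ∣ +_) (∣⁅x⁆∣≡1 x) ⟩
  ∣ p ∣ + 1                       ≡⟨ +-comm ∣ p ∣ 1 ⟩
  suc ∣ p ∣                       ∎
  where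
  open ≡-Reasoning
  disjoint : ∣ p ∩ ⁅ x ⁆ ∣ ≡ 0
  disjoint = n<1⇒n≡0 (≰⇒> λ 0<∣∣ → case 0<∣p∣⇒Nonempty (p ∩ ⁅ x ⁆) 0<∣∣ of λ (y , y∈) →
    x∉p (subst (_∈ˢ p) (x∈⁅y⁆⇒x≡y x (p∩q⊆q p ⁅ x ⁆ y∈)) (p∩q⊆p p ⁅ x ⁆ y∈)))

1+∣p-x∣≡∣p∣ : ∀ {n} (p : Subset n) {x} → x ∈ˢ p → suc ∣ p - x ∣ ≡ ∣ p ∣
1+∣p-x∣≡∣p∣ p {x} x∈p = trans (trans (+-comm 1 _) (cong (∣ p - x ∣ +_) (sym single))) (∣p─q∣+∣p∩q∣≡∣p∣ p ⁅ x ⁆)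
  where
  single : ∣ p ∩ ⁅ x ⁆ ∣ ≡ 1
  single = trans (≤-antisym (p⊆q⇒∣p∣≤∣q∣ (p∩q⊆q p ⁅ x ⁆))
    (p⊆q⇒∣p∣≤∣q∣ (∩-glb (singleton⊆ x∈p) ⊆-refl))) (∣⁅x⁆∣≡1 x)

x∉p-x : ∀ {n} (p : Subset n) x → x ∉ˢ p - x
x∉p-x p x x∈ = x∉p─q p ⁅ x ⁆ x∈ (x∈⁅x⁆ x)

-- Enumerating the elements and the subsets of a given size

elements : ∀ {n} → Subset n → List (Fin n)
elements []            = []
elements (outside ∷ p) = map suc (elements p)
elements (inside ∷ p)  = zero ∷ map suc (elements p)

length-elements : ∀ {n} (p : Subset n) → length (elements p) ≡ ∣ p ∣
length-elements []            = refl
length-elements (outside ∷ p) = trans (length-map suc (elements p)) (length-elements p)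
length-elements (inside ∷ p)  = cong suc (trans (length-map suc (elements p)) (length-elements p))

∈-elements⁺ : ∀ {n} {p : Subset n} {x} → x ∈ˢ p → x ∈ˡ elements p
∈-elements⁺ {p = inside ∷ p}  hereᵛ        = here refl
∈-elements⁺ {p = inside ∷ p}  (thereᵛ x∈p) = there (∈-map⁺ suc (∈-elements⁺ x∈p))
∈-elements⁺ {p = outside ∷ p} (thereᵛ x∈p) = ∈-map⁺ suc (∈-elements⁺ x∈p)

∈-elements⁻ : ∀ {n} (p : Subset n) {x} → x ∈ˡ elements p → x ∈ˢ p
∈-elements⁻ (inside ∷ p) (here refl) = hereᵛ
∈-elements⁻ (inside ∷ p) (there i) with ∈-map⁻ suc i
... | y , j , refl = thereᵛ (∈-elements⁻ p j)
∈-elements⁻ (outside ∷ p) i with ∈-map⁻ suc i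
... | y , j , refl = thereᵛ (∈-elements⁻ p j)

elements-unique : ∀ {n} (p : Subset n) → Unique (elements p)
elements-unique []            = []
elements-unique (outside ∷ p) = Unique.map⁺ suc-injective (elements-unique p)
elements-unique (inside ∷ p)  =
  All.tabulate (λ i 0≡x → case ∈-map⁻ suc (subst (_∈ˡ _) (sym 0≡x) i) of λ ())
  ∷ Unique.map⁺ suc-injective (elements-unique p)

choose : ∀ {n} → Subset n → ℕ → List (Subset n)
choose p             zero    = ∅ ∷ []
choose []            (suc s) = []
choose (outside ∷ p) (suc s) = map (outside ∷_) (choose p (suc s))
choose (inside ∷ p)  (suc s) = map (inside ∷_) (choose p s) ++ map (outside ∷_) (choose p (suc s))

length-choose : ∀ {n} (p : Subset n) s → length (choose p s) ≡ ∣ p ∣ C s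
length-choose p             zero    = refl
length-choose []            (suc s) = sym (k>n⇒nCk≡0 {0} {suc s} (s≤s z≤n))
length-choose (outside ∷ p) (suc s) = trans (length-map (outside ∷_) (choose p (suc s))) (length-choose p (suc s))
length-choose (inside ∷ p)  (suc s) = begin
  length (map (inside ∷_) (choose p s) ++ map (outside ∷_) (choose p (suc s)))
    ≡⟨ length-++ (map (inside ∷_) (choose p s)) ⟩
  length (map (inside ∷_) (choose p s)) + length (map (outside ∷_) (choose p (suc s)))
    ≡⟨ cong₂ _+_ (length-map (inside ∷_) (choose p s)) (length-map (outside ∷_) (choose p (suc s))) ⟩
  length (choose p s) + length (choose p (suc s))
    ≡⟨ cong₂ _+_ (length-choose p s) (length-choose p (suc s)) ⟩
  ∣ p ∣ C s + ∣ p ∣ C suc s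
    ≡⟨ nCk+nC[k+1]≡[n+1]C[k+1] ∣ p ∣ s ⟩
  suc ∣ p ∣ C suc s ∎
  where open ≡-Reasoning

∈-choose⇒∣∣≡ : ∀ {n} (p : Subset n) s {S} → S ∈ˡ choose p s → ∣ S ∣ ≡ s
∈-choose⇒∣∣≡ {n} p zero (here refl) = ∣⊥∣≡0 n
∈-choose⇒∣∣≡ (outside ∷ p) (suc s) i with ∈-map⁻ (outside ∷_) i
... | S , j , refl = ∈-choose⇒∣∣≡ p (suc s) j
∈-choose⇒∣∣≡ (inside ∷ p) (suc s) i with ∈-++⁻ (map (inside ∷_) (choose p s)) i
∈-choose⇒∣∣≡ (inside ∷ p) (suc s) _ | inj₁ i with ∈-map⁻ (inside ∷_) i
... | S , j , refl = cong suc (∈-choose⇒∣∣≡ p s j)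
∈-choose⇒∣∣≡ (inside ∷ p) (suc s) _ | inj₂ i with ∈-map⁻ (outside ∷_) i
... | S , j , refl = ∈-choose⇒∣∣≡ p (suc s) j

-- The recursion takes for `S` the first `s` elements of `X ∩ p`.
choose-complete : ∀ {n} (p X : Subset n) s → s ≤ ∣ X ∩ p ∣ → ∃ λ S → S ∈ˡ choose p s × S ⊆ˢ X
choose-complete p X zero _ = ∅ , here refl , λ x∈∅ → contradiction x∈∅ ∉⊥
choose-complete [] [] (suc s) ()
choose-complete (outside ∷ p) (outside ∷ X) (suc s) le with choose-complete p X (suc s) le
... | S , i , S⊆X = outside ∷ S , ∈-map⁺ (outside ∷_) i , out⊆ S⊆X
choose-complete (outside ∷ p) (inside ∷ X) (suc s) le with choose-complete p X (suc s) le
... | S , i , S⊆X = outside ∷ S , ∈-map⁺ (outside ∷_) i , out⊆ S⊆X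
choose-complete (inside ∷ p) (outside ∷ X) (suc s) le with choose-complete p X (suc s) le
... | S , i , S⊆X = outside ∷ S , ∈-++⁺ʳ _ (∈-map⁺ (outside ∷_) i) , out⊆ S⊆X
choose-complete (inside ∷ p) (inside ∷ X) (suc s) (s≤s le) with choose-complete p X s le
... | S , i , S⊆X = inside ∷ S , ∈-++⁺ˡ (∈-map⁺ (inside ∷_) i) , in⊆in S⊆X

∃-⊆-of-size : ∀ {n} (p : Subset n) {s} → s ≤ ∣ p ∣ → ∃ λ S → S ⊆ˢ p × ∣ S ∣ ≡ s
∃-⊆-of-size p {s} s≤ with choose-complete p p s (≤-trans s≤ (p⊆q⇒∣p∣≤∣q∣ (∩-glb {p = p} {p} ⊆-refl ⊆-refl)))
... | S , i , S⊆p = S , S⊆p , ∈-choose⇒∣∣≡ p s i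

-- Binomial estimates

-- Pascal's rule splits the left side, and the hypotheses at `k` and `k + 1` absorb the two
-- summands. The identity serves to compare consecutive values of `stars` and of `c`.
C-absorb : ∀ n k → suc k * (suc n C suc k) ≡ suc n * (n C k)
C-absorb n       zero    = trans (+-identityʳ _) (trans (nC1≡n (suc n)) (sym (*-identityʳ (suc n))))
C-absorb zero    (suc k) = trans (cong (suc (suc k) *_) (k>n⇒nCk≡0 {1} {suc (suc k)} (s≤s (s≤s z≤n))))
  (trans (*-zeroʳ (suc (suc k))) (sym (trans (*-identityˡ _) (k>n⇒nCk≡0 {0} {suc k} (s≤s z≤n)))))
C-absorb (suc n) (suc k) = begin
  suc (suc k) * (suc (suc n) C suc (suc k))
    ≡⟨ cong (suc (suc k) *_) (nCk+nC[k+1]≡[n+1]C[k+1] (suc n) (suc k)) ⟨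
  suc (suc k) * (suc n C suc k + suc n C suc (suc k))
    ≡⟨ *-distribˡ-+ (suc (suc k)) (suc n C suc k) (suc n C suc (suc k)) ⟩
  (suc n C suc k + suc k * (suc n C suc k)) + suc (suc k) * (suc n C suc (suc k))
    ≡⟨ cong₂ (λ x y → (suc n C suc k + x) + y) (C-absorb n k) (C-absorb n (suc k)) ⟩
  (suc n C suc k + suc n * (n C k)) + suc n * (n C suc k)
    ≡⟨ +-assoc (suc n C suc k) (suc n * (n C k)) (suc n * (n C suc k)) ⟩
  suc n C suc k + (suc n * (n C k) + suc n * (n C suc k))
    ≡⟨ cong (suc n C suc k +_) (*-distribˡ-+ (suc n) (n C k) (n C suc k)) ⟨
  suc n C suc k + suc n * (n C k + n C suc k)
    ≡⟨ cong (λ x → suc n C suc k + suc n * x) (nCk+nC[k+1]≡[n+1]C[k+1] n k) ⟩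
  suc (suc n) * (suc n C suc k) ∎
  where open ≡-Reasoning

0<C : ∀ {n k} → k ≤ n → 0 < n C k
0<C {n}     {zero}  _ = s≤s z≤n
0<C {suc n} {suc k} (s≤s k≤n) =
  subst (0 <_) (nCk+nC[k+1]≡[n+1]C[k+1] n k) (≤-trans (0<C k≤n) (m≤m+n _ _))

C-monoˡ : ∀ {m n} k → m ≤ n → m C k ≤ n C k
C-monoˡ {m} {n} zero _ = ≤-refl
C-monoˡ {zero} {n} (suc k) _ = subst (_≤ n C suc k) (sym (k>n⇒nCk≡0 {0} {suc k} (s≤s z≤n))) z≤n
C-monoˡ {suc m} {suc n} (suc k) (s≤s m≤n) = begin
  suc m C suc k       ≡⟨ nCk+nC[k+1]≡[n+1]C[k+1] m k ⟨
  m C k + m C suc k   ≤⟨ +-mono-≤ (C-monoˡ k m≤n) (C-monoˡ (suc k) m≤n) ⟩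
  n C k + n C suc k   ≡⟨ nCk+nC[k+1]≡[n+1]C[k+1] n k ⟩
  suc n C suc k       ∎
  where open ≤-Reasoning

stars-positive : ∀ {n k s} → s ≤ k → k ≤ n → 0 < stars n k s
stars-positive {n}     {k}     {zero}  _ k≤n = 0<C k≤n
stars-positive {suc n} {suc k} {suc s} (s≤s s≤k) (s≤s k≤n) = stars-positive s≤k k≤n

stars-vanish : ∀ n {k s} → k < s → stars n k s ≡ 0
stars-vanish zero    {s = suc s} _ = refl
stars-vanish (suc n) {zero}  {suc s} _ = refl
stars-vanish (suc n) {suc k} {suc s} (s≤s k<s) = stars-vanish n k<s

stars-self : ∀ n k → stars n k k ≤ 1
stars-self n       zero    = ≤-refl
stars-self zero    (suc k) = z≤n
stars-self (suc n) (suc k) = stars-self n k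

-- Stripping `s` common elements leaves C(n - s, k - s) against C(n - s - 1, k - s - 1), whose
-- quotient is (n - s) / (k - s) by `C-absorb`.
stars-ratio : ∀ Q n k s → Q * (k ∸ s) ≤ n ∸ s → Q * stars n k (suc s) ≤ stars n k s
stars-ratio Q zero k zero _ = subst (_≤ 0 C k) (sym (*-zeroʳ Q)) z≤n
stars-ratio Q (suc n) zero zero _ = subst (_≤ 1) (sym (*-zeroʳ Q)) z≤n
stars-ratio Q (suc n) (suc k) zero h = *-cancelˡ-≤ (suc k) (begin
  suc k * (Q * (n C k))        ≡⟨ *-assoc (suc k) Q (n C k) ⟨
  suc k * Q * (n C k)          ≡⟨ cong (_* (n C k)) (*-comm (suc k) Q) ⟩
  Q * suc k * (n C k)          ≤⟨ *-monoˡ-≤ (n C k) h ⟩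
  suc n * (n C k)              ≡⟨ C-absorb n k ⟨
  suc k * (suc n C suc k)      ∎)
  where open ≤-Reasoning
stars-ratio Q zero    k       (suc s) h = ≤-reflexive (*-zeroʳ Q)
stars-ratio Q (suc n) zero    (suc s) h = ≤-reflexive (*-zeroʳ Q)
stars-ratio Q (suc n) (suc k) (suc s) h = stars-ratio Q n k s h

-- (1 + 1/m)^r ≤ 1 + r/m + (r/m)^2 for r ≤ m, cleared of denominators.
[1+m]^r-bound : ∀ m r → r ≤ m → suc m ^ r * (m * m) ≤ m ^ r * (m * m + r * m + r * r)
[1+m]^r-bound m zero _ = ≤-reflexive (lemma m)
  where
  lemma : ∀ m → 1 * (m * m) ≡ 1 * (m * m + 0 * m + 0 * 0)
  lemma = solve-∀
[1+m]^r-bound m (suc r) r<m = begin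
  suc m ^ suc r * (m * m)                          ≡⟨ *-assoc (suc m) (suc m ^ r) (m * m) ⟩
  suc m * (suc m ^ r * (m * m))                    ≤⟨ *-monoʳ-≤ (suc m) ([1+m]^r-bound m r (<⇒≤ r<m)) ⟩
  suc m * (m ^ r * (m * m + r * m + r * r))        ≡⟨ lemma₁ m r (m ^ r) ⟩
  m ^ r * (m * (m * m + r * m + r * r + m + r) + r * r)
    ≤⟨ *-monoʳ-≤ (m ^ r) (+-monoʳ-≤ _ (≤-trans (*-monoˡ-≤ r (<⇒≤ r<m)) (m≤m+n _ m))) ⟩
  m ^ r * (m * (m * m + r * m + r * r + m + r) + (m * r + m))
    ≡⟨ lemma₂ m r (m ^ r) ⟩
  m ^ suc r * (m * m + suc r * m + suc r * suc r)  ∎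
  where
  open ≤-Reasoning
  lemma₁ : ∀ m r p → suc m * (p * (m * m + r * m + r * r)) ≡ p * (m * (m * m + r * m + r * r + m + r) + r * r)
  lemma₁ = solve-∀
  lemma₂ : ∀ m r p → p * (m * (m * m + r * m + r * r + m + r) + (m * r + m)) ≡ m * p * (m * m + suc r * m + suc r * suc r)
  lemma₂ = solve-∀

-- The case `r = m` of the preceding bound; 3 stands in for `e`.
[1+m]^m≤3m^m : ∀ m → suc m ^ m ≤ 3 * m ^ m
[1+m]^m≤3m^m zero = s≤s z≤n
[1+m]^m≤3m^m m@(suc _) = *-cancelʳ-≤ (suc m ^ m) (3 * m ^ m) (m * m) (begin
  suc m ^ m * (m * m)                ≤⟨ [1+m]^r-bound m m ≤-refl ⟩
  m ^ m * (m * m + m * m + m * m)    ≡⟨ lemma (m ^ m) (m * m) ⟩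
  3 * m ^ m * (m * m)                ∎)
  where
  open ≤-Reasoning
  lemma : ∀ p q → p * (q + q + q) ≡ 3 * p * q
  lemma = solve-∀

-- Numerical estimates for the peeling errors

module Bounds (n k t Q : ℕ) (2≤t : 2 ≤ t) (t+2≤k : t + 2 ≤ k)
  (18[t+2]≤Q : 18 * (t + 2) ≤ Q) (5k≤Q : 5 * k ≤ Q) (large : t + (k ∸ t) * Q ≤ n) where

  open ≤-Reasoning

  M : ℕ → ℕ
  M = stars n k

  1≤Q : 1 ≤ Q
  1≤Q = ≤-trans (≤-trans (s≤s z≤n) (*-monoʳ-≤ 18 (≤-trans (s≤s z≤n) (m≤n+m 2 t)))) 18[t+2]≤Q

  t≤k : t ≤ k
  t≤k = ≤-trans (m≤m+n t 2) t+2≤k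

  k≤n : k ≤ n
  k≤n = begin
    k                 ≡⟨ m+[n∸m]≡n t≤k ⟨
    t + (k ∸ t)       ≡⟨ cong (t +_) (*-identityʳ (k ∸ t)) ⟨
    t + (k ∸ t) * 1   ≤⟨ +-monoʳ-≤ t (*-monoʳ-≤ (k ∸ t) 1≤Q) ⟩
    t + (k ∸ t) * Q   ≤⟨ large ⟩
    n                 ∎

  -- The hypothesis of `stars-ratio` at `t + d` follows from `large`: passing from `t` to `t + d`
  -- lowers `Q * (k ∸ t)` by `Q * d` and `n ∸ t` only by `d`, while `Q ≥ 1`.
  M-ratio : ∀ d → Q * M (suc (t + d)) ≤ M (t + d)
  M-ratio d = stars-ratio Q n k (t + d) (begin
    Q * (k ∸ (t + d))      ≡⟨ cong (Q *_) (∸-+-assoc k t d) ⟨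
    Q * (k ∸ t ∸ d)        ≡⟨ *-distribˡ-∸ Q (k ∸ t) d ⟩
    Q * (k ∸ t) ∸ Q * d    ≤⟨ ∸-monoʳ-≤ (Q * (k ∸ t)) (subst (_≤ Q * d) (*-identityˡ d) (*-monoˡ-≤ d 1≤Q)) ⟩
    Q * (k ∸ t) ∸ d        ≡⟨ cong (_∸ d) (*-comm Q (k ∸ t)) ⟩
    (k ∸ t) * Q ∸ d        ≤⟨ ∸-monoˡ-≤ d (m+n≤o⇒m≤o∸n ((k ∸ t) * Q) (subst (_≤ n) (+-comm t _) large)) ⟩
    n ∸ t ∸ d              ≡⟨ ∸-+-assoc n t d ⟩
    n ∸ (t + d)            ∎)

  opaque

    -- `c i` is the number of `t`-subsets of a `(t + i)`-set. `w i` bounds the `k`-sets above those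
    -- minimal covers of size `t + j`, `j = 1 + i`, that contain a fixed `t`-set: at most (j + 1)^j
    -- covers, each contained in `M (t + j)` sets.
    c w : ℕ → ℕ
    c i = (t + i) C i
    w i = (2 + i) ^ (1 + i) * M (t + (1 + i))

    c-suc : ∀ i → suc i * c (suc i) ≡ (t + suc i) * c i
    c-suc i = subst (λ x → suc i * (x C suc i) ≡ x * ((t + i) C i)) (sym (+-suc t i)) (C-absorb (t + i) i)

    c-1 : c 1 ≡ t + 1
    c-1 = nC1≡n (t + 1)

    w-1 : w 1 ≡ 9 * M (t + 2)
    w-1 = refl

    -- Sharper than `w-ratio`, which would give the factor 9 in place of 64/9: here (4/3)^3 = 64/27
    -- is kept instead of being rounded up to 3.
    w-2 : 9 * (Q * w 2) ≤ 64 * w 1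
    w-2 = begin
      9 * (Q * (64 * M (t + 3)))   ≡⟨ lemma₁ Q (M (t + 3)) ⟩
      64 * (9 * (Q * M (t + 3)))   ≤⟨ *-monoʳ-≤ 64 (*-monoʳ-≤ 9 ratio) ⟩
      64 * (9 * M (t + 2))         ∎
      where
      ratio : Q * M (t + 3) ≤ M (t + 2)
      ratio = subst (λ x → Q * M x ≤ M (t + 2)) (sym (+-suc t 2)) (M-ratio 2)
      lemma₁ : ∀ q m → 9 * (q * (64 * m)) ≡ 64 * (9 * (q * m))
      lemma₁ = solve-∀

    w-ratio : ∀ i → Q * w (suc i) ≤ 3 * (2 + i) * w i
    w-ratio i = begin
      Q * ((3 + i) ^ (2 + i) * M (t + (2 + i)))                ≡⟨ lemma₁ Q ((3 + i) ^ (2 + i)) (M (t + (2 + i))) ⟩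
      (3 + i) ^ (2 + i) * (Q * M (t + (2 + i)))                ≤⟨ *-mono-≤ ([1+m]^m≤3m^m (2 + i)) ratio ⟩
      3 * ((2 + i) * (2 + i) ^ (1 + i)) * M (t + (1 + i))      ≡⟨ lemma₂ (2 + i) ((2 + i) ^ (1 + i)) (M (t + (1 + i))) ⟩
      3 * (2 + i) * ((2 + i) ^ (1 + i) * M (t + (1 + i)))      ∎
      where
      ratio : Q * M (t + (2 + i)) ≤ M (t + (1 + i))
      ratio = subst (λ x → Q * M x ≤ M (t + (1 + i))) (sym (+-suc t (1 + i))) (M-ratio (1 + i))
      lemma₁ : ∀ q p m → q * (p * m) ≡ p * (q * m)
      lemma₁ = solve-∀
      lemma₂ : ∀ i p m → 3 * (i * p) * m ≡ 3 * i * (p * m)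
      lemma₂ = solve-∀

    -- Levels above `k` carry no `k`-sets, so the ratio estimates may assume that the size of the
    -- covers is at most `k`, which is where `5 * k ≤ Q` becomes useful.
    w-vanish : ∀ {i} → ¬ t + (1 + i) ≤ k → w i ≡ 0
    w-vanish {i} ≰ = trans (cong ((2 + i) ^ (1 + i) *_) (stars-vanish n (≰⇒> ≰))) (*-zeroʳ ((2 + i) ^ (1 + i)))

  -- At level t + 1 + i of the peeling, the k-sets above minimal covers number
  -- at most coarse i, or fine i if the other family has a member of size ≤ t + i.
  coarse fine : ℕ → ℕ
  coarse i = c (suc i) * w i
  fine i   = c i * w i

  coarseSum fineSum : ℕ → ℕ
  coarseSum zero    = 0
  coarseSum (suc m) = coarseSum m + coarse (suc m)
  fineSum zero      = 0
  fineSum (suc m)   = fineSum m + fine (suc m)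

  instance
    Q≢0 : NonZero Q
    Q≢0 = >-nonZero 1≤Q

  -- The factor (t + i + 2) / (i + 2) from `c` times 3 (i + 2) / Q from `w` is 3 (t + i + 2) / Q, at
  -- most 3/5 because `t + (2 + i) ≤ k` and `5 * k ≤ Q`.
  coarse-ratio : ∀ i → 5 * coarse (suc i) ≤ 3 * coarse i
  coarse-ratio i with t + (2 + i) ≤? k
  ... | no ≰ = begin
    5 * (c (2 + i) * w (suc i))  ≡⟨ cong (λ x → 5 * (c (2 + i) * x)) (w-vanish ≰) ⟩
    5 * (c (2 + i) * 0)          ≡⟨ cong (5 *_) (*-zeroʳ (c (2 + i))) ⟩
    0                                                  ≤⟨ z≤n ⟩
    3 * coarse i                                       ∎
  ... | yes le = *-cancelˡ-≤ (suc (suc i)) (*-cancelˡ-≤ Q (begin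
    Q * (suc (suc i) * (5 * (C₂ * w (suc i))))         ≡⟨ lemma₁ Q (suc (suc i)) C₂ (w (suc i)) ⟩
    5 * (suc (suc i) * C₂) * (Q * w (suc i))           ≡⟨ cong (λ x → 5 * x * (Q * w (suc i))) (c-suc (suc i)) ⟩
    5 * ((t + suc (suc i)) * C₁) * (Q * w (suc i))     ≤⟨ *-monoʳ-≤ (5 * ((t + suc (suc i)) * C₁)) (w-ratio i) ⟩
    5 * ((t + suc (suc i)) * C₁) * (3 * (2 + i) * w i) ≡⟨ lemma₂ (t + suc (suc i)) C₁ (2 + i) (w i) ⟩
    5 * (t + suc (suc i)) * ((2 + i) * (3 * (C₁ * w i))) ≤⟨ *-monoˡ-≤ ((2 + i) * (3 * (C₁ * w i))) (≤-trans (*-monoʳ-≤ 5 le) 5k≤Q) ⟩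
    Q * ((2 + i) * (3 * (C₁ * w i)))                   ∎))
    where
    C₁ C₂ : ℕ
    C₁ = c (1 + i)
    C₂ = c (2 + i)
    lemma₁ : ∀ q i c w → q * (i * (5 * (c * w))) ≡ 5 * (i * c) * (q * w)
    lemma₁ = solve-∀
    lemma₂ : ∀ a c i w → 5 * (a * c) * (3 * i * w) ≡ 5 * a * (i * (3 * (c * w)))
    lemma₂ = solve-∀

  fine-step : ∀ i → Q * (suc i * fine (suc i)) ≤ 3 * ((t + suc i) * ((2 + i) * fine i))
  fine-step i = begin
    Q * (suc i * (C₂ * w (suc i)))                     ≡⟨ lemma₁ Q (suc i) C₂ (w (suc i)) ⟩
    suc i * C₂ * (Q * w (suc i))                       ≡⟨ cong (_* (Q * w (suc i))) (c-suc i) ⟩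
    (t + suc i) * C₁ * (Q * w (suc i))                 ≤⟨ *-monoʳ-≤ ((t + suc i) * C₁) (w-ratio i) ⟩
    (t + suc i) * C₁ * (3 * (2 + i) * w i)             ≡⟨ lemma₂ (t + suc i) C₁ (2 + i) (w i) ⟩
    3 * ((t + suc i) * ((2 + i) * (C₁ * w i)))         ∎
    where
    C₁ C₂ : ℕ
    C₁ = c i
    C₂ = c (1 + i)
    lemma₁ : ∀ q i c w → q * (i * (c * w)) ≡ i * c * (q * w)
    lemma₁ = solve-∀
    lemma₂ : ∀ a c i w → a * c * (3 * i * w) ≡ 3 * (a * (i * (c * w)))
    lemma₂ = solve-∀

  -- The index of `c` is one lower than in `coarse`, so `fine-step` leaves an extra factor (5 + i) /
  -- (4 + i) ≤ 5/4. With `5 * k ≤ Q` this gives (5/4) (3/5) = 3/4; starting at 3 is what makes 5/4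
  -- available.
  fine-ratio : ∀ i → 4 * fine (4 + i) ≤ 3 * fine (3 + i)
  fine-ratio i with t + (5 + i) ≤? k
  ... | no ≰ = begin
    4 * (c (4 + i) * w (4 + i))  ≡⟨ cong (λ x → 4 * (c (4 + i) * x)) (w-vanish ≰) ⟩
    4 * (c (4 + i) * 0)          ≡⟨ cong (4 *_) (*-zeroʳ (c (4 + i))) ⟩
    0                                          ≤⟨ z≤n ⟩
    3 * fine (3 + i)                           ∎
  ... | yes le = *-cancelˡ-≤ (4 + i) (*-cancelˡ-≤ Q (begin
    Q * ((4 + i) * (4 * fine (4 + i)))              ≡⟨ lemma₁ Q (4 + i) (fine (4 + i)) ⟩
    4 * (Q * ((4 + i) * fine (4 + i)))              ≤⟨ *-monoʳ-≤ 4 (fine-step (3 + i)) ⟩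
    4 * (3 * ((t + (4 + i)) * ((5 + i) * fine (3 + i)))) ≡⟨ lemma₂ (t + (4 + i)) (5 + i) (fine (3 + i)) ⟩
    (t + (4 + i)) * (4 * (5 + i)) * (3 * fine (3 + i))
      ≤⟨ *-monoˡ-≤ (3 * fine (3 + i)) (*-monoʳ-≤ (t + (4 + i)) (subst (4 * (5 + i) ≤_) (lemma₃ i) (m≤m+n (4 * (5 + i)) i))) ⟩
    (t + (4 + i)) * (5 * (4 + i)) * (3 * fine (3 + i))  ≡⟨ lemma₄ (t + (4 + i)) (4 + i) (3 * fine (3 + i)) ⟩
    5 * (t + (4 + i)) * ((4 + i) * (3 * fine (3 + i)))
      ≤⟨ *-monoˡ-≤ ((4 + i) * (3 * fine (3 + i))) (≤-trans (*-monoʳ-≤ 5 (≤-trans (+-monoʳ-≤ t (n≤1+n (4 + i))) le)) 5k≤Q) ⟩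
    Q * ((4 + i) * (3 * fine (3 + i)))              ∎))
    where
    lemma₁ : ∀ q i f → q * (i * (4 * f)) ≡ 4 * (q * (i * f))
    lemma₁ = solve-∀
    lemma₂ : ∀ a b f → 4 * (3 * (a * (b * f))) ≡ a * (4 * b) * (3 * f)
    lemma₂ = solve-∀
    lemma₃ : ∀ i → 4 * (5 + i) + i ≡ 5 * (4 + i)
    lemma₃ = solve-∀
    lemma₄ : ∀ a b f → a * (5 * b) * f ≡ 5 * a * (b * f)
    lemma₄ = solve-∀

  -- The ratio is at most 4 (t + 3) / Q ≤ (2/9) (t + 3) / (t + 2), and (t + 3) / (t + 2) ≤ 5/4 as
  -- `2 ≤ t`.
  fine₃ : 18 * fine 3 ≤ 5 * fine 2
  fine₃ = *-cancelˡ-≤ 3 (*-cancelˡ-≤ Q (begin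
    Q * (3 * (18 * fine 3))              ≡⟨ lemma₁ Q (fine 3) ⟩
    18 * (Q * (3 * fine 3))              ≤⟨ *-monoʳ-≤ 18 (fine-step 2) ⟩
    18 * (3 * ((t + 3) * (4 * fine 2)))  ≡⟨ lemma₂ t (fine 2) ⟩
    (4 * t + 12) * (54 * fine 2)         ≤⟨ *-monoˡ-≤ (54 * fine 2) (≤-trans (+-monoʳ-≤ (4 * t) (+-monoˡ-≤ 10 2≤t)) (≤-reflexive (lemma₃ t))) ⟩
    5 * (t + 2) * (54 * fine 2)          ≡⟨ lemma₄ (t + 2) (fine 2) ⟩
    18 * (t + 2) * (3 * (5 * fine 2))    ≤⟨ *-monoˡ-≤ (3 * (5 * fine 2)) 18[t+2]≤Q ⟩
    Q * (3 * (5 * fine 2))               ∎))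
    where
    lemma₁ : ∀ q f → q * (3 * (18 * f)) ≡ 18 * (q * (3 * f))
    lemma₁ = solve-∀
    lemma₂ : ∀ t f → 18 * (3 * ((t + 3) * (4 * f))) ≡ (4 * t + 12) * (54 * f)
    lemma₂ = solve-∀
    lemma₃ : ∀ t → 4 * t + (t + 10) ≡ 5 * (t + 2)
    lemma₃ = solve-∀
    lemma₄ : ∀ a f → 5 * a * (54 * f) ≡ 18 * a * (3 * (5 * f))
    lemma₄ = solve-∀

  -- The factor (t + 2) / 2 from `c` and 64 / (9 Q) from `w-2` multiply to at most 64 / (9 * 36) =
  -- 16/81.
  fine₂ : 81 * fine 2 ≤ 16 * fine 1
  fine₂ = *-cancelˡ-≤ 4 (*-cancelˡ-≤ Q (begin
    Q * (4 * (81 * (c 2 * w 2)))            ≡⟨ lemma₁ Q (c 2) (w 2) ⟩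
    2 * c 2 * (18 * (9 * (Q * w 2)))        ≡⟨ cong (_* (18 * (9 * (Q * w 2)))) (c-suc 1) ⟩
    (t + 2) * c 1 * (18 * (9 * (Q * w 2)))  ≤⟨ *-monoʳ-≤ ((t + 2) * c 1) (*-monoʳ-≤ 18 w-2) ⟩
    (t + 2) * c 1 * (18 * (64 * w 1))       ≡⟨ lemma₂ (t + 2) (c 1) (w 1) ⟩
    18 * (t + 2) * (4 * (16 * (c 1 * w 1))) ≤⟨ *-monoˡ-≤ (4 * (16 * (c 1 * w 1))) 18[t+2]≤Q ⟩
    Q * (4 * (16 * (c 1 * w 1)))            ∎))
    where
    lemma₁ : ∀ q c m → q * (4 * (81 * (c * m))) ≡ 2 * c * (18 * (9 * (q * m)))
    lemma₁ = solve-∀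
    lemma₂ : ∀ a c m → a * c * (18 * (64 * m)) ≡ 18 * a * (4 * (16 * (c * m)))
    lemma₂ = solve-∀

  -- A geometric series of ratio 3/5 sums to at most 5/2 times its first term.
  coarseSum-bound : ∀ m → 2 * coarseSum m ≤ 5 * coarse 1
  coarseSum-bound zero = z≤n
  coarseSum-bound (suc m) = ≤-trans (m≤m+n _ (3 * coarse (suc m))) (strong m)
    where
    lemma₁ : ∀ c → 2 * (0 + c) + 3 * c ≡ 5 * c
    lemma₁ = solve-∀
    lemma₂ : ∀ s c → 2 * (s + c) + 3 * c ≡ 2 * s + 5 * c
    lemma₂ = solve-∀
    -- The summand with coefficient 3 is twice the bound 3/2 on the tail after the last term;
    -- carrying it along makes the induction go through.
    strong : ∀ m → 2 * coarseSum (suc m) + 3 * coarse (suc m) ≤ 5 * coarse 1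
    strong zero = ≤-reflexive (lemma₁ (coarse 1))
    strong (suc m) = begin
      2 * (coarseSum (suc m) + coarse (2 + m)) + 3 * coarse (2 + m) ≡⟨ lemma₂ (coarseSum (suc m)) (coarse (2 + m)) ⟩
      2 * coarseSum (suc m) + 5 * coarse (2 + m)                    ≤⟨ +-monoʳ-≤ (2 * coarseSum (suc m)) (coarse-ratio (suc m)) ⟩
      2 * coarseSum (suc m) + 3 * coarse (suc m)                    ≤⟨ strong m ⟩
      5 * coarse 1                                                  ∎

  -- From the third term on the ratio is at most 3/4, so these terms add up to at most 4 times the
  -- first of them. In `strong`, `3 * fine (3 + m)` again accounts for the remaining tail.
  fineSum-head : ∀ m → fineSum m ≤ fine 1 + fine 2 + 4 * fine 3
  fineSum-head 0 = z≤n
  fineSum-head 1 = ≤-trans (m≤m+n (fine 1) (fine 2)) (m≤m+n (fine 1 + fine 2) (4 * fine 3))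
  fineSum-head 2 = m≤m+n (fine 1 + fine 2) (4 * fine 3)
  fineSum-head (suc (suc (suc m))) = ≤-trans (m≤m+n _ (3 * fine (3 + m))) (strong m)
    where
    lemma₁ : ∀ a b c → a + b + c + 3 * c ≡ a + b + 4 * c
    lemma₁ = solve-∀
    lemma₂ : ∀ s c → s + c + 3 * c ≡ s + 4 * c
    lemma₂ = solve-∀
    strong : ∀ m → fineSum (3 + m) + 3 * fine (3 + m) ≤ fine 1 + fine 2 + 4 * fine 3
    strong zero = ≤-reflexive (lemma₁ (fine 1) (fine 2) (fine 3))
    strong (suc m) = begin
      fineSum (3 + m) + fine (4 + m) + 3 * fine (4 + m) ≡⟨ lemma₂ (fineSum (3 + m)) (fine (4 + m)) ⟩
      fineSum (3 + m) + 4 * fine (4 + m)                ≤⟨ +-monoʳ-≤ (fineSum (3 + m)) (fine-ratio m) ⟩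
      fineSum (3 + m) + 3 * fine (3 + m)                ≤⟨ strong m ⟩
      fine 1 + fine 2 + 4 * fine 3                      ∎

  M₁ M₂ : ℕ
  M₁ = M (t + 1)
  M₂ = M (t + 2)

  QM₂≤M₁ : Q * M₂ ≤ M₁
  QM₂≤M₁ = subst (λ x → Q * M x ≤ M₁) (sym (+-suc t 1)) (M-ratio 1)

  18[t+2]M₂≤M₁ : 18 * (t + 2) * M₂ ≤ M₁
  18[t+2]M₂≤M₁ = ≤-trans (*-monoˡ-≤ M₂ 18[t+2]≤Q) QM₂≤M₁

  0<M₁ : 0 < M₁
  0<M₁ = stars-positive (≤-trans (+-monoʳ-≤ t (s≤s z≤n)) t+2≤k) k≤n

  -- Since `t * M₁ ∸ t * M₂` is the diversity to be reached, a family counted by `coarseSum` falls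
  -- short of it. The estimate comes down to (45 t + 49) / 72 < t, that is 49 < 27 t, which holds
  -- from t = 2 on.
  coarseSum-small : ∀ m → coarseSum m + t * M₂ < t * M₁
  coarseSum-small m = *-cancelˡ-< 72 _ _ (begin-strict
    72 * (coarseSum m + t * M₂)                              ≡⟨ lemma₁ (coarseSum m) (t * M₂) ⟩
    36 * (2 * coarseSum m) + 72 * (t * M₂)                   ≤⟨ +-monoˡ-≤ (72 * (t * M₂)) (*-monoʳ-≤ 36 (coarseSum-bound m)) ⟩
    36 * (5 * (c 2 * w 1)) + 72 * (t * M₂)                   ≡⟨ cong (λ x → 36 * (5 * (c 2 * x)) + 72 * (t * M₂)) w-1 ⟩
    36 * (5 * (c 2 * (9 * M₂))) + 72 * (t * M₂)              ≡⟨ lemma₂ (c 2) t M₂ ⟩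
    2 * c 2 * (810 * M₂) + 72 * (t * M₂)                     ≡⟨ cong (λ x → x * (810 * M₂) + 72 * (t * M₂)) (c-suc 1) ⟩
    (t + 2) * c 1 * (810 * M₂) + 72 * (t * M₂)               ≡⟨ cong (λ x → (t + 2) * x * (810 * M₂) + 72 * (t * M₂)) c-1 ⟩
    (t + 2) * (t + 1) * (810 * M₂) + 72 * (t * M₂)           ≤⟨ m≤m+n _ (144 * M₂) ⟩
    (t + 2) * (t + 1) * (810 * M₂) + 72 * (t * M₂) + 144 * M₂ ≡⟨ lemma₃ t M₂ ⟩
    (45 * t + 49) * (18 * (t + 2) * M₂)                      ≤⟨ *-monoʳ-≤ (45 * t + 49) 18[t+2]M₂≤M₁ ⟩
    (45 * t + 49) * M₁                                       <⟨ *-monoˡ-< M₁ {{>-nonZero 0<M₁}} (+-monoʳ-< (45 * t) (<-≤-trans (m<m+n 49 {5} (s≤s z≤n)) (*-monoʳ-≤ 27 2≤t))) ⟩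
    (45 * t + 27 * t) * M₁                                   ≡⟨ lemma₄ t M₁ ⟩
    72 * (t * M₁)                                            ∎)
    where
    lemma₁ : ∀ e x → 72 * (e + x) ≡ 36 * (2 * e) + 72 * x
    lemma₁ = solve-∀
    lemma₂ : ∀ c t m → 36 * (5 * (c * (9 * m))) + 72 * (t * m) ≡ 2 * c * (810 * m) + 72 * (t * m)
    lemma₂ = solve-∀
    lemma₃ : ∀ t m → (t + 2) * (t + 1) * (810 * m) + 72 * (t * m) + 144 * m ≡ (45 * t + 49) * (18 * (t + 2) * m)
    lemma₃ = solve-∀
    lemma₄ : ∀ t m → (45 * t + 27 * t) * m ≡ 72 * (t * m)
    lemma₄ = solve-∀

  -- The estimates on `fine` give the factor 1 + (16/81) (1 + 4 * 5/18) = 1033/729, slightly below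
  -- 10/7.
  fineSum-bound : ∀ m → 7 * fineSum m ≤ 10 * fine 1
  fineSum-bound m = *-cancelˡ-≤ 729 (begin
    729 * (7 * fineSum m)                                 ≤⟨ *-monoʳ-≤ 729 (*-monoʳ-≤ 7 (fineSum-head m)) ⟩
    729 * (7 * (fine 1 + fine 2 + 4 * fine 3))            ≡⟨ lemma₁ (fine 1) (fine 2) (fine 3) ⟩
    5103 * fine 1 + 5103 * fine 2 + 1134 * (18 * fine 3)  ≤⟨ +-monoʳ-≤ (5103 * fine 1 + 5103 * fine 2) (*-monoʳ-≤ 1134 fine₃) ⟩
    5103 * fine 1 + 5103 * fine 2 + 1134 * (5 * fine 2)   ≡⟨ lemma₂ (fine 1) (fine 2) ⟩
    5103 * fine 1 + 133 * (81 * fine 2)                   ≤⟨ +-monoʳ-≤ (5103 * fine 1) (*-monoʳ-≤ 133 fine₂) ⟩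
    5103 * fine 1 + 133 * (16 * fine 1)                   ≤⟨ m≤m+n _ (59 * fine 1) ⟩
    5103 * fine 1 + 133 * (16 * fine 1) + 59 * fine 1     ≡⟨ lemma₃ (fine 1) ⟩
    729 * (10 * fine 1)                                   ∎)
    where
    lemma₁ : ∀ a b c → 729 * (7 * (a + b + 4 * c)) ≡ 5103 * a + 5103 * b + 1134 * (18 * c)
    lemma₁ = solve-∀
    lemma₂ : ∀ a b → 5103 * a + 5103 * b + 1134 * (5 * b) ≡ 5103 * a + 133 * (81 * b)
    lemma₂ = solve-∀
    lemma₃ : ∀ a → 5103 * a + 133 * (16 * a) + 59 * a ≡ 729 * (10 * a)
    lemma₃ = solve-∀

  -- The peeling error, `k` stars of size `M₂` and the correction `t * M₂` together stay below a
  -- single star of size `M₁`. In units of M₁ / 630 they weigh at most 450, 126 and 35.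
  fineSum-small : ∀ m → fineSum m + (k * M₂ + t * M₂) < M₁
  fineSum-small m = *-cancelˡ-< 630 _ _ (begin-strict
    630 * (fineSum m + (k * M₂ + t * M₂))                            ≡⟨ lemma₁ (fineSum m) (k * M₂) (t * M₂) ⟩
    90 * (7 * fineSum m) + (126 * (5 * (k * M₂)) + 630 * (t * M₂))   ≤⟨ +-monoˡ-≤ _ (*-monoʳ-≤ 90 (fineSum-bound m)) ⟩
    90 * (10 * (c 1 * w 1)) + (126 * (5 * (k * M₂)) + 630 * (t * M₂))
      ≡⟨ cong₂ (λ x y → 90 * (10 * (x * y)) + (126 * (5 * (k * M₂)) + 630 * (t * M₂))) c-1 w-1 ⟩
    90 * (10 * ((t + 1) * (9 * M₂))) + (126 * (5 * (k * M₂)) + 630 * (t * M₂)) ≤⟨ m≤m+n _ (9360 * M₂) ⟩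
    90 * (10 * ((t + 1) * (9 * M₂))) + (126 * (5 * (k * M₂)) + 630 * (t * M₂)) + 9360 * M₂ ≡⟨ lemma₂ t k M₂ ⟩
    485 * (18 * (t + 2) * M₂) + 126 * (5 * k * M₂)                   ≤⟨ +-mono-≤ (*-monoʳ-≤ 485 18[t+2]M₂≤M₁) (*-monoʳ-≤ 126 (≤-trans (*-monoˡ-≤ M₂ 5k≤Q) QM₂≤M₁)) ⟩
    485 * M₁ + 126 * M₁                                              <⟨ m<m+n _ {19 * M₁} (*-monoʳ-< 19 0<M₁) ⟩
    485 * M₁ + 126 * M₁ + 19 * M₁                                    ≡⟨ lemma₃ M₁ ⟩
    630 * M₁                                                         ∎)
    where
    lemma₁ : ∀ e x y → 630 * (e + (x + y)) ≡ 90 * (7 * e) + (126 * (5 * x) + 630 * y)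
    lemma₁ = solve-∀
    lemma₂ : ∀ t k m → 90 * (10 * ((t + 1) * (9 * m))) + (126 * (5 * (k * m)) + 630 * (t * m)) + 9360 * m ≡ 485 * (18 * (t + 2) * m) + 126 * (5 * k * m)
    lemma₂ = solve-∀
    lemma₃ : ∀ m → 485 * m + 126 * m + 19 * m ≡ 630 * m
    lemma₃ = solve-∀

-- Minimal covers

card-∪ : ∀ {n} (𝓕 𝓖 𝓗 : Family n) → (∀ F → F ∈ 𝓕 → F ∈ 𝓖 ⊎ F ∈ 𝓗) → card 𝓕 ≤ card 𝓖 + card 𝓗
card-∪ 𝓕 𝓖 𝓗 cover = begin
  card 𝓕                        ≡⟨ card-split 𝓕 𝓖 ⟩
  card (𝓕 ∩ᶠ 𝓖) + card (𝓕 ∖ 𝓖)  ≤⟨ +-mono-≤ (card-mono λ F F∈ → proj₂ (∩ᶠ⁻ 𝓕 𝓖 F F∈)) (card-mono rest) ⟩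
  card 𝓖 + card 𝓗               ∎
  where
  open ≤-Reasoning
  rest : 𝓕 ∖ 𝓖 ⊆ 𝓗
  rest F F∈ with ∖⁻ 𝓕 𝓖 F F∈
  ... | F∈𝓕 , F∉𝓖 with cover F F∈𝓕
  ... | inj₁ F∈𝓖 = contradiction F∈𝓖 F∉𝓖
  ... | inj₂ F∈𝓗 = F∈𝓗

opaque

  up : ∀ {n} → Family n → Family n
  up 𝓣 F = ⌊ anySubset? (λ X → T? (𝓣 X) ×-dec (X ⊆? F)) ⌋

  up⁺ : ∀ {n} (𝓣 : Family n) F {X} → X ∈ 𝓣 → X ⊆ˢ F → F ∈ up 𝓣
  up⁺ 𝓣 F {X} X∈ X⊆F = fromWitness {a? = anySubset? (λ X → T? (𝓣 X) ×-dec (X ⊆? F))} (X , X∈ , X⊆F)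

  up⁻ : ∀ {n} (𝓣 : Family n) F → F ∈ up 𝓣 → ∃ λ X → X ∈ 𝓣 × X ⊆ˢ F
  up⁻ 𝓣 F = toWitness {a? = anySubset? (λ X → T? (𝓣 X) ×-dec (X ⊆? F))}

supersets : ∀ {n} → Subset n → Family n
supersets Y F = ⌊ Y ⊆? F ⌋

module _ {n} (𝓕 : Family n) (Y F : Subset n) where

  ∩-supersets⁺ : F ∈ 𝓕 → Y ⊆ˢ F → F ∈ 𝓕 ∩ᶠ supersets Y
  ∩-supersets⁺ F∈ Y⊆F = ∩ᶠ⁺ 𝓕 (supersets Y) F F∈ (fromWitness {a? = Y ⊆? F} Y⊆F)

  ∩-supersets⁻ : F ∈ 𝓕 ∩ᶠ supersets Y → F ∈ 𝓕 × Y ⊆ˢ F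
  ∩-supersets⁻ F∈ with ∩ᶠ⁻ 𝓕 (supersets Y) F F∈
  ... | p , q = p , toWitness {a? = Y ⊆? F} q

kup : ∀ {n} → ℕ → Family n → Family n
kup k 𝓣 = binom[ k ] ∩ᶠ up 𝓣

module _ {n} (k : ℕ) (𝓣 : Family n) (F : Subset n) where

  kup⁺ : ∀ {X} → ∣ F ∣ ≡ k → X ∈ 𝓣 → X ⊆ˢ F → F ∈ kup k 𝓣
  kup⁺ size X∈ X⊆F = ∩ᶠ⁺ binom[ k ] (up 𝓣) F (fromWitness size) (up⁺ 𝓣 F X∈ X⊆F)

  kup⁻ : F ∈ kup k 𝓣 → ∣ F ∣ ≡ k × ∃ λ X → X ∈ 𝓣 × X ⊆ˢ F
  kup⁻ F∈ with ∩ᶠ⁻ binom[ k ] (up 𝓣) F F∈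
  ... | p , q = toWitness p , up⁻ 𝓣 F q

card-kup : ∀ {n} k r (𝓣 : Family n) → (∀ X → X ∈ 𝓣 → ∣ X ∣ ≡ r) → card (kup k 𝓣) ≤ card 𝓣 * stars n k r
card-kup {n} k r 𝓣 size = card-cover (filterᵇ 𝓣 (allSubsets n)) (star k) (kup k 𝓣)
  (λ {X} i → ≤-reflexive (trans (card-star k X) (cong (stars n k) (size X (∈-filterᵇ⁻ 𝓣 (allSubsets n) i)))))
  cover
  where
  cover : ∀ F → F ∈ kup k 𝓣 → ∃ λ X → X ∈ˡ filterᵇ 𝓣 (allSubsets n) × F ∈ star k X
  cover F F∈ with kup⁻ k 𝓣 F F∈
  ... | ∣F∣≡k , X , X∈ , X⊆F = X , ∈-filterᵇ⁺ 𝓣 (∈-allSubsets X) X∈ , star⁺ k X F ∣F∣≡k X⊆F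

-- A set meeting T in at least t elements is hit by any |T| - t + 1 elements
-- of T, and also by T ─ Y whenever |Y ∩ T| < t.
hitting-set : ∀ {n} t j (Y T : Subset n) → ∣ T ∣ ≤ j + t → ∣ Y ∩ T ∣ < t →
  ∃ λ U → U ⊆ˢ T ─ Y × ∣ U ∣ ≤ suc j × (∀ X → t ≤ ∣ X ∩ T ∣ → Nonempty (X ∩ U))
hitting-set t j Y T T≤ Y∩T<t with suc j ≤? ∣ T ─ Y ∣
... | yes enough with ∃-⊆-of-size (T ─ Y) enough
... | U , U⊆ , ∣U∣≡ = U , U⊆ , ≤-reflexive ∣U∣≡ , hit
  where
  U⊆T : U ⊆ˢ T
  U⊆T x∈ = p─q⊆p T Y (U⊆ x∈)
  ∣T─U∣<t : ∣ T ─ U ∣ < t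
  ∣T─U∣<t = +-cancelʳ-≤ j _ _ (begin
    suc ∣ T ─ U ∣ + j           ≡⟨ +-suc ∣ T ─ U ∣ j ⟨
    ∣ T ─ U ∣ + suc j           ≡⟨ cong (∣ T ─ U ∣ +_) ∣U∣≡ ⟨
    ∣ T ─ U ∣ + ∣ U ∣           ≤⟨ +-monoʳ-≤ ∣ T ─ U ∣ (p⊆q⇒∣p∣≤∣q∣ (∩-glb U⊆T ⊆-refl)) ⟩
    ∣ T ─ U ∣ + ∣ T ∩ U ∣       ≡⟨ ∣p─q∣+∣p∩q∣≡∣p∣ T U ⟩
    ∣ T ∣                       ≤⟨ T≤ ⟩
    j + t                       ≡⟨ +-comm j t ⟩
    t + j                       ∎)
    where open ≤-Reasoning
  hit : ∀ X → t ≤ ∣ X ∩ T ∣ → Nonempty (X ∩ U)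
  hit X le with nonempty? (X ∩ U)
  ... | yes x = x
  ... | no empty = contradiction ∣T─U∣<t (≤⇒≯ (≤-trans le (p⊆q⇒∣p∣≤∣q∣ λ x∈ → x∈p∧x∉q⇒x∈p─q (p∩q⊆q X T x∈)
    λ x∈U → empty (_ , x∈p∩q⁺ (p∩q⊆p X T x∈ , x∈U)))))
hitting-set t j Y T T≤ Y∩T<t | no few = T ─ Y , (λ x∈ → x∈) , <⇒≤ (≰⇒> few) , hit
  where
  hit : ∀ X → t ≤ ∣ X ∩ T ∣ → Nonempty (X ∩ (T ─ Y))
  hit X le with ∣p∩q∣<∣p∣⇒∃ (X ∩ T) Y (≤-trans (s≤s (p⊆q⇒∣p∣≤∣q∣ sub)) (≤-trans Y∩T<t le))
    where
    sub : (X ∩ T) ∩ Y ⊆ˢ Y ∩ T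
    sub x∈ = x∈p∩q⁺ (p∩q⊆q (X ∩ T) Y x∈ , p∩q⊆q X T (p∩q⊆p (X ∩ T) Y x∈))
  ... | x , x∈ , x∉Y = x , x∈p∩q⁺ (p∩q⊆p X T x∈ , x∈p∧x∉q⇒x∈p─q (p∩q⊆q X T x∈) x∉Y)

module Covers {n : ℕ} (t : ℕ) where

  Covers : Family n → Subset n → Set
  Covers 𝓣 X = ∀ T → T ∈ 𝓣 → t ≤ ∣ X ∩ T ∣

  uncovered? : ∀ (𝓣 : Family n) (X : Subset n) → Dec (∃ λ T → T ∈ 𝓣 × ∣ X ∩ T ∣ < t)
  uncovered? 𝓣 X = anySubset? (λ T → T? (𝓣 T) ×-dec (∣ X ∩ T ∣ <? t))

  opaque

    cov : ℕ → Family n → Family n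
    cov r 𝓣 X = ⌊ (∣ X ∣ ≤? r) ×-dec ¬? (uncovered? 𝓣 X) ⌋

    cov⁺ : ∀ r 𝓣 X → ∣ X ∣ ≤ r → Covers 𝓣 X → X ∈ cov r 𝓣
    cov⁺ r 𝓣 X size covers = fromWitness {a? = (∣ X ∣ ≤? r) ×-dec ¬? (uncovered? 𝓣 X)}
      (size , λ (T , T∈ , lt) → <⇒≱ lt (covers T T∈))

    cov⁻ : ∀ r 𝓣 X → X ∈ cov r 𝓣 → ∣ X ∣ ≤ r × Covers 𝓣 X
    cov⁻ r 𝓣 X X∈ with toWitness {a? = (∣ X ∣ ≤? r) ×-dec ¬? (uncovered? 𝓣 X)} X∈
    ... | size , none = size , λ T T∈ → ≮⇒≥ λ lt → none (T , T∈ , lt)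

  -- These are the inclusion-minimal covers of size exactly `suc r`: a cover of size at most `r`
  -- lies in `up (cov r 𝓣)` itself.
  minimal : ℕ → Family n → Family n
  minimal r 𝓣 = cov (suc r) 𝓣 ∖ up (cov r 𝓣)

  module _ (r : ℕ) (𝓣 : Family n) where

    minimal⁻ : ∀ X → X ∈ minimal r 𝓣 → ∣ X ∣ ≡ suc r × Covers 𝓣 X
    minimal⁻ X X∈ with ∖⁻ (cov (suc r) 𝓣) (up (cov r 𝓣)) X X∈
    ... | X∈cov , X∉up with cov⁻ (suc r) 𝓣 X X∈cov
    ... | size , covers = ≤-antisym size (≰⇒> λ ∣X∣≤r → X∉up (up⁺ (cov r 𝓣) X (cov⁺ r 𝓣 X ∣X∣≤r covers) ⊆-refl)) , covers

    -- Here `d` counts the elements still to be added to `Y`. If `Y` is already a cover, no minimal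
    -- cover of size `suc r` contains it. Otherwise some `T` meets `Y` in fewer than `t` elements,
    -- and each minimal cover above `Y` contains one of at most `suc j` elements of a hitting set
    -- outside `Y`.
    minimal-branch : ∀ j → suc r ≡ j + t → (∀ T → T ∈ 𝓣 → ∣ T ∣ ≤ suc r) →
      ∀ d Y → d + ∣ Y ∣ ≡ suc r → card (minimal r 𝓣 ∩ᶠ supersets Y) ≤ suc j ^ d
    minimal-branch j level size zero Y ∣Y∣≡ = begin
      card (minimal r 𝓣 ∩ᶠ supersets Y)   ≤⟨ card-mono to-star ⟩
      card (star (suc r) Y)               ≡⟨ card-star (suc r) Y ⟩
      stars n (suc r) ∣ Y ∣               ≡⟨ cong (stars n (suc r)) ∣Y∣≡ ⟩
      stars n (suc r) (suc r)             ≤⟨ stars-self n (suc r) ⟩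
      1                                   ∎
      where
      open ≤-Reasoning
      to-star : minimal r 𝓣 ∩ᶠ supersets Y ⊆ star (suc r) Y
      to-star X X∈ with ∩-supersets⁻ (minimal r 𝓣) Y X X∈
      ... | X∈min , Y⊆X = star⁺ (suc r) Y X (proj₁ (minimal⁻ X X∈min)) Y⊆X
    minimal-branch j level size (suc d) Y ∣Y∣≡ with uncovered? 𝓣 Y
    ... | no covered = ≤-trans (≤-reflexive (card-empty none)) z≤n
      where
      Y∈cov : Y ∈ cov r 𝓣
      Y∈cov = cov⁺ r 𝓣 Y (≤-trans (m≤n+m ∣ Y ∣ d) (≤-reflexive (cong pred ∣Y∣≡)))
        λ T T∈ → ≮⇒≥ λ lt → covered (T , T∈ , lt)
      none : ∀ X → ¬ X ∈ minimal r 𝓣 ∩ᶠ supersets Y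
      none X X∈ with ∩-supersets⁻ (minimal r 𝓣) Y X X∈
      ... | X∈min , Y⊆X = proj₂ (∖⁻ (cov (suc r) 𝓣) (up (cov r 𝓣)) X X∈min) (up⁺ (cov r 𝓣) X Y∈cov Y⊆X)
    ... | yes (T , T∈ , Y∩T<t) with hitting-set t j Y T (≤-trans (size T T∈) (≤-reflexive level)) Y∩T<t
    ... | U , U⊆ , ∣U∣≤ , hit = begin
      card (minimal r 𝓣 ∩ᶠ supersets Y)   ≤⟨ card-cover (elements U) (λ u → minimal r 𝓣 ∩ᶠ supersets (Y ∪ ⁅ u ⁆)) _ small cover ⟩
      length (elements U) * suc j ^ d     ≡⟨ cong (_* suc j ^ d) (length-elements U) ⟩
      ∣ U ∣ * suc j ^ d                   ≤⟨ *-monoˡ-≤ (suc j ^ d) ∣U∣≤ ⟩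
      suc j * suc j ^ d                   ∎
      where
      open ≤-Reasoning
      small : ∀ {u} → u ∈ˡ elements U → card (minimal r 𝓣 ∩ᶠ supersets (Y ∪ ⁅ u ⁆)) ≤ suc j ^ d
      small {u} i = minimal-branch j level size d (Y ∪ ⁅ u ⁆)
        (trans (cong (d +_) (∣p∪⁅x⁆∣≡1+∣p∣ Y (x∉p─q T Y (U⊆ (∈-elements⁻ U i))))) (trans (+-suc d ∣ Y ∣) ∣Y∣≡))
      cover : ∀ X → X ∈ minimal r 𝓣 ∩ᶠ supersets Y → ∃ λ u → u ∈ˡ elements U × X ∈ minimal r 𝓣 ∩ᶠ supersets (Y ∪ ⁅ u ⁆)
      cover X X∈ with ∩-supersets⁻ (minimal r 𝓣) Y X X∈
      ... | X∈min , Y⊆X with hit X (proj₂ (minimal⁻ X X∈min) T T∈)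
      ... | u , u∈ = u , ∈-elements⁺ (p∩q⊆q X U u∈) ,
        ∩-supersets⁺ (minimal r 𝓣) (Y ∪ ⁅ u ⁆) X X∈min (∪-lub Y⊆X (singleton⊆ (p∩q⊆p X U u∈)))

    -- A minimal cover contains a `t`-subset of `T`, and branching adds the other `j` elements. `T`
    -- can be a member of `𝓣` or a smaller set meeting all the minimal covers, and the latter saves
    -- in the binomial factor.
    card-minimal : ∀ j → suc r ≡ j + t → (∀ T → T ∈ 𝓣 → ∣ T ∣ ≤ suc r) →
      ∀ T → (∀ X → X ∈ minimal r 𝓣 → t ≤ ∣ X ∩ T ∣) → card (minimal r 𝓣) ≤ (∣ T ∣ C t) * suc j ^ j
    card-minimal j level size T meets = begin
      card (minimal r 𝓣)             ≤⟨ card-cover (choose T t) (λ S → minimal r 𝓣 ∩ᶠ supersets S) (minimal r 𝓣) small cover ⟩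
      length (choose T t) * suc j ^ j ≡⟨ cong (_* suc j ^ j) (length-choose T t) ⟩
      (∣ T ∣ C t) * suc j ^ j         ∎
      where
      open ≤-Reasoning
      small : ∀ {S} → S ∈ˡ choose T t → card (minimal r 𝓣 ∩ᶠ supersets S) ≤ suc j ^ j
      small {S} i = minimal-branch j level size j S (trans (cong (j +_) (∈-choose⇒∣∣≡ T t i)) (sym level))
      cover : ∀ X → X ∈ minimal r 𝓣 → ∃ λ S → S ∈ˡ choose T t × X ∈ minimal r 𝓣 ∩ᶠ supersets S
      cover X X∈ with choose-complete T X t (meets X X∈)
      ... | S , i , S⊆X = S , i , ∩-supersets⁺ (minimal r 𝓣) S X X∈ S⊆X

    minimal-decomposition : ∀ k (𝓕 : Family n) → 𝓕 ⊆ cov (suc r) 𝓣 →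
      ∀ F → F ∈ kup k 𝓕 → F ∈ kup k (cov r 𝓣) ⊎ F ∈ kup k (minimal r 𝓣)
    minimal-decomposition k 𝓕 𝓕⊆ F F∈ with kup⁻ k 𝓕 F F∈
    ... | ∣F∣≡k , X , X∈𝓕 , X⊆F with T? (up (cov r 𝓣) X)
    ... | no X∉ = inj₂ (kup⁺ k (minimal r 𝓣) F ∣F∣≡k (∖⁺ (cov (suc r) 𝓣) (up (cov r 𝓣)) X (𝓕⊆ X X∈𝓕) X∉) X⊆F)
    ... | yes X∈ with up⁻ (cov r 𝓣) X X∈
    ... | Y , Y∈ , Y⊆X = inj₁ (kup⁺ k (cov r 𝓣) F ∣F∣≡k Y∈ (⊆-trans Y⊆X X⊆F))

C-sym : ∀ i t → (i + t) C t ≡ (t + i) C i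
C-sym i t = trans (nCk≡nC[n∸k] (m≤n+m t i)) (cong₂ _C_ (+-comm i t) (m+n∸n≡m i t))

-- Peeling

module Peeling (n k t Q : ℕ) (2≤t : 2 ≤ t) (t+2≤k : t + 2 ≤ k)
  (18[t+2]≤Q : 18 * (t + 2) ≤ Q) (5k≤Q : 5 * k ≤ Q) (large : t + (k ∸ t) * Q ≤ n) where

  open Bounds n k t Q 2≤t t+2≤k 18[t+2]≤Q 5k≤Q large
  open Covers {n} t
  open ≤-Reasoning

  opaque
    unfolding c

    level-weight : ∀ a i → ((a + t) C t) * (2 + i) ^ (1 + i) * M (1 + i + t) ≡ c a * w i
    level-weight a i = trans (*-assoc ((a + t) C t) _ _)
      (cong₂ _*_ (C-sym a t) (cong (λ x → (2 + i) ^ (1 + i) * M x) (+-comm (1 + i) t)))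

  fine≤coarse : ∀ i → fine i ≤ coarse i
  fine≤coarse i = begin
    c i * w i                                          ≡⟨ level-weight i i ⟨
    ((i + t) C t) * (2 + i) ^ (1 + i) * M (1 + i + t)
      ≤⟨ *-monoˡ-≤ (M (1 + i + t)) (*-monoˡ-≤ ((2 + i) ^ (1 + i)) (C-monoˡ t (n≤1+n (i + t)))) ⟩
    ((1 + i + t) C t) * (2 + i) ^ (1 + i) * M (1 + i + t) ≡⟨ level-weight (1 + i) i ⟩
    c (1 + i) * w i                                    ∎

  -- With `a = 2 + m`, for `T` a member of `𝓣`, the bound is `coarse (1 + m)`; with `a = 1 + m`, for
  -- `T` a surviving cover, it is `fine (1 + m)`.
  card-kup-minimal : ∀ m (𝓣 : Family n) → (∀ T → T ∈ 𝓣 → ∣ T ∣ ≤ 2 + m + t) →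
    ∀ a T → ∣ T ∣ ≤ a + t → (∀ X → X ∈ minimal (1 + m + t) 𝓣 → t ≤ ∣ X ∩ T ∣) →
    card (kup k (minimal (1 + m + t) 𝓣)) ≤ c a * w (1 + m)
  card-kup-minimal m 𝓣 size a T ∣T∣≤ meets = begin
    card (kup k (minimal (1 + m + t) 𝓣))
      ≤⟨ card-kup k (2 + m + t) (minimal (1 + m + t) 𝓣) (λ X X∈ → proj₁ (minimal⁻ (1 + m + t) 𝓣 X X∈)) ⟩
    card (minimal (1 + m + t) 𝓣) * M (2 + m + t)
      ≤⟨ *-monoˡ-≤ (M (2 + m + t)) (card-minimal (1 + m + t) 𝓣 (2 + m) refl size T meets) ⟩
    (∣ T ∣ C t) * (3 + m) ^ (2 + m) * M (2 + m + t)
      ≤⟨ *-monoˡ-≤ (M (2 + m + t)) (*-monoˡ-≤ ((3 + m) ^ (2 + m)) (C-monoˡ t ∣T∣≤)) ⟩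
    ((a + t) C t) * (3 + m) ^ (2 + m) * M (2 + m + t)   ≡⟨ level-weight a (1 + m) ⟩
    c a * w (1 + m)                                     ∎

  -- The outcome of a completed peeling, where `e` bounds the `k`-sets lost on the way. Sizes are
  -- only bounded above here; `exact-size` later rules out kernels of smaller size.
  record Kernels (e : ℕ) (𝓕 𝓖 : Family n) : Set where
    field
      𝓟 𝓠    : Family n
      𝓟-size : ∀ A → A ∈ 𝓟 → ∣ A ∣ ≤ suc t
      𝓠-size : ∀ B → B ∈ 𝓠 → ∣ B ∣ ≤ suc t
      cross  : CrossIntersecting t 𝓟 𝓠
      𝓕-rest : card (kup k 𝓕 ∖ up 𝓟) ≤ e
      𝓖-rest : card (kup k 𝓖 ∖ up 𝓠) ≤ e

  rest-decomposition : ∀ (𝓕 𝓕₁ 𝓦 𝓟 : Family n) →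
    (∀ F → F ∈ kup k 𝓕 → F ∈ kup k 𝓕₁ ⊎ F ∈ kup k 𝓦) →
    card (kup k 𝓕 ∖ up 𝓟) ≤ card (kup k 𝓕₁ ∖ up 𝓟) + card (kup k 𝓦)
  rest-decomposition 𝓕 𝓕₁ 𝓦 𝓟 dec = card-∪ _ (kup k 𝓕₁ ∖ up 𝓟) (kup k 𝓦) split
    where
    split : ∀ F → F ∈ kup k 𝓕 ∖ up 𝓟 → F ∈ kup k 𝓕₁ ∖ up 𝓟 ⊎ F ∈ kup k 𝓦
    split F F∈ with ∖⁻ (kup k 𝓕) (up 𝓟) F F∈
    ... | F∈kup , F∉ with dec F F∈kup
    ... | inj₁ p = inj₁ (∖⁺ (kup k 𝓕₁) (up 𝓟) F p F∉)
    ... | inj₂ p = inj₂ p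

  -- Replacing 𝓕 by the covers of 𝓖, and then 𝓖 by the covers of those, keeps the
  -- pair cross-intersecting; the covers of top size are discarded level by level.
  peel : ∀ m (𝓕 𝓖 : Family n) →
    (∀ X → X ∈ 𝓕 → ∣ X ∣ ≤ 1 + m + t) → (∀ X → X ∈ 𝓖 → ∣ X ∣ ≤ 1 + m + t) → CrossIntersecting t 𝓕 𝓖 →
    (card (kup k 𝓕) ≤ coarseSum m ⊎ card (kup k 𝓖) ≤ coarseSum m) ⊎ Kernels (fineSum m) 𝓕 𝓖
  peel zero 𝓕 𝓖 𝓕-size 𝓖-size cross = inj₂ record
    { 𝓟 = 𝓕 ; 𝓠 = 𝓖 ; 𝓟-size = 𝓕-size ; 𝓠-size = 𝓖-size ; cross = cross
    ; 𝓕-rest = ≤-reflexive (none 𝓕) ; 𝓖-rest = ≤-reflexive (none 𝓖) }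
    where
    none : ∀ 𝓣 → card (kup k 𝓣 ∖ up 𝓣) ≡ 0
    none 𝓣 = card-empty λ F F∈ → let p , q = ∖⁻ (kup k 𝓣) (up 𝓣) F F∈ in
      q (proj₂ (∩ᶠ⁻ binom[ k ] (up 𝓣) F p))
  peel (suc m) 𝓕 𝓖 𝓕-size 𝓖-size cross = result
    where
    r : ℕ
    r = 1 + m + t
    𝓕′ 𝓖′ 𝓕₁ 𝓖₁ : Family n
    𝓕′ = cov (suc r) 𝓖
    𝓖′ = cov (suc r) 𝓕′
    𝓕₁ = cov r 𝓖
    𝓖₁ = cov r 𝓕′
    𝓕⊆𝓕′ : 𝓕 ⊆ 𝓕′
    𝓕⊆𝓕′ F F∈ = cov⁺ (suc r) 𝓖 F (𝓕-size F F∈) (λ G G∈ → cross F G F∈ G∈)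
    𝓖⊆𝓖′ : 𝓖 ⊆ 𝓖′
    𝓖⊆𝓖′ G G∈ = cov⁺ (suc r) 𝓕′ G (𝓖-size G G∈) λ X X∈ →
      subst (t ≤_) (∣p∩q∣≡∣q∩p∣ X G) (proj₂ (cov⁻ (suc r) 𝓖 X X∈) G G∈)
    𝓕₁⊆𝓕′ : 𝓕₁ ⊆ 𝓕′
    𝓕₁⊆𝓕′ X X∈ with cov⁻ r 𝓖 X X∈
    ... | size , covers = cov⁺ (suc r) 𝓖 X (m≤n⇒m≤1+n size) covers
    𝓕′-size : ∀ X → X ∈ 𝓕′ → ∣ X ∣ ≤ suc r
    𝓕′-size X X∈ = proj₁ (cov⁻ (suc r) 𝓖 X X∈)
    cross₁ : CrossIntersecting t 𝓕₁ 𝓖₁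
    cross₁ X Y X∈ Y∈ = subst (t ≤_) (∣p∩q∣≡∣q∩p∣ Y X) (proj₂ (cov⁻ r 𝓕′ Y Y∈) X (𝓕₁⊆𝓕′ X X∈))
    minimal-𝓖⊆𝓕′ : minimal r 𝓖 ⊆ 𝓕′
    minimal-𝓖⊆𝓕′ X X∈ = proj₁ (∖⁻ (cov (suc r) 𝓖) (up (cov r 𝓖)) X X∈)
    𝓕-split : ∀ F → F ∈ kup k 𝓕 → F ∈ kup k 𝓕₁ ⊎ F ∈ kup k (minimal r 𝓖)
    𝓕-split = minimal-decomposition r 𝓖 k 𝓕 𝓕⊆𝓕′
    𝓖-split : ∀ F → F ∈ kup k 𝓖 → F ∈ kup k 𝓖₁ ⊎ F ∈ kup k (minimal r 𝓕′)
    𝓖-split = minimal-decomposition r 𝓕′ k 𝓖 𝓖⊆𝓖′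
    -- If no cover of size at most `r` exists, everything lies above minimal covers, and the only
    -- set at hand to meet them is a member of `𝓣`, of size up to `suc r`. There is such a member,
    -- since otherwise `∅` would be a cover.
    coarse-case : ∀ (𝓣 𝓗 : Family n) → (∀ T → T ∈ 𝓣 → ∣ T ∣ ≤ suc r) →
      (∀ F → F ∈ kup k 𝓗 → F ∈ kup k (cov r 𝓣) ⊎ F ∈ kup k (minimal r 𝓣)) →
      (∀ X → ¬ X ∈ cov r 𝓣) → card (kup k 𝓗) ≤ coarseSum (suc m)
    coarse-case 𝓣 𝓗 size split none with uncovered? 𝓣 ∅
    ... | no covered = ⊥-elim (none ∅ (cov⁺ r 𝓣 ∅ (subst (_≤ r) (sym (∣⊥∣≡0 n)) z≤n)
      λ T T∈ → ≮⇒≥ λ lt → covered (T , T∈ , lt)))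
    ... | yes (T , T∈ , _) = ≤-trans (card-mono only-minimal) (≤-trans
      (card-kup-minimal m 𝓣 size (2 + m) T (size T T∈) (λ X X∈ → proj₂ (minimal⁻ r 𝓣 X X∈) T T∈))
      (m≤n+m (coarse (suc m)) (coarseSum m)))
      where
      only-minimal : kup k 𝓗 ⊆ kup k (minimal r 𝓣)
      only-minimal F F∈ with split F F∈
      ... | inj₂ p = p
      ... | inj₁ p with kup⁻ k (cov r 𝓣) F p
      ... | _ , X , X∈ , _ = ⊥-elim (none X X∈)
    -- Surviving covers on both sides have size at most `r` and meet the minimal covers of the
    -- opposite side: `B₀` covers all of `𝓕′`, and `A₀` belongs to `𝓕′`. This yields `fine` in place
    -- of `coarse`.
    module Both A₀ B₀ (A₀∈ : A₀ ∈ 𝓕₁) (B₀∈ : B₀ ∈ 𝓖₁) where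
      𝓕-minimal : card (kup k (minimal r 𝓖)) ≤ fine (suc m)
      𝓕-minimal = card-kup-minimal m 𝓖 𝓖-size (1 + m) B₀ (proj₁ (cov⁻ r 𝓕′ B₀ B₀∈)) λ X X∈ →
        subst (t ≤_) (∣p∩q∣≡∣q∩p∣ B₀ X) (proj₂ (cov⁻ r 𝓕′ B₀ B₀∈) X (minimal-𝓖⊆𝓕′ X X∈))
      𝓖-minimal : card (kup k (minimal r 𝓕′)) ≤ fine (suc m)
      𝓖-minimal = card-kup-minimal m 𝓕′ 𝓕′-size (1 + m) A₀ (proj₁ (cov⁻ r 𝓖 A₀ A₀∈)) λ X X∈ →
        proj₂ (minimal⁻ r 𝓕′ X X∈) A₀ (𝓕₁⊆𝓕′ A₀ A₀∈)
      both : (card (kup k 𝓕) ≤ coarseSum (suc m) ⊎ card (kup k 𝓖) ≤ coarseSum (suc m)) ⊎ Kernels (fineSum (suc m)) 𝓕 𝓖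
      both with peel m 𝓕₁ 𝓖₁ (λ X X∈ → proj₁ (cov⁻ r 𝓖 X X∈)) (λ X X∈ → proj₁ (cov⁻ r 𝓕′ X X∈)) cross₁
      ... | inj₁ (inj₁ small) = inj₁ (inj₁ (≤-trans (card-∪ _ (kup k 𝓕₁) (kup k (minimal r 𝓖)) 𝓕-split)
        (+-mono-≤ small (≤-trans 𝓕-minimal (fine≤coarse (suc m))))))
      ... | inj₁ (inj₂ small) = inj₁ (inj₂ (≤-trans (card-∪ _ (kup k 𝓖₁) (kup k (minimal r 𝓕′)) 𝓖-split)
        (+-mono-≤ small (≤-trans 𝓖-minimal (fine≤coarse (suc m))))))
      ... | inj₂ K = inj₂ record
        { 𝓟 = 𝓟 ; 𝓠 = 𝓠 ; 𝓟-size = 𝓟-size ; 𝓠-size = 𝓠-size ; cross = cross′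
        ; 𝓕-rest = ≤-trans (rest-decomposition 𝓕 𝓕₁ (minimal r 𝓖) 𝓟 𝓕-split) (+-mono-≤ 𝓕-rest 𝓕-minimal)
        ; 𝓖-rest = ≤-trans (rest-decomposition 𝓖 𝓖₁ (minimal r 𝓕′) 𝓠 𝓖-split) (+-mono-≤ 𝓖-rest 𝓖-minimal) }
        where open Kernels K renaming (cross to cross′)
    result : (card (kup k 𝓕) ≤ coarseSum (suc m) ⊎ card (kup k 𝓖) ≤ coarseSum (suc m)) ⊎ Kernels (fineSum (suc m)) 𝓕 𝓖
    result with anySubset? (λ X → T? (𝓕₁ X)) | anySubset? (λ X → T? (𝓖₁ X))
    ... | no none | _ = inj₁ (inj₁ (coarse-case 𝓖 𝓕 𝓖-size 𝓕-split λ X X∈ → none (X , X∈)))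
    ... | yes _ | no none = inj₁ (inj₂ (coarse-case 𝓕′ 𝓖 𝓕′-size 𝓖-split λ X X∈ → none (X , X∈)))
    ... | yes (A₀ , A₀∈) | yes (B₀ , B₀∈) = Both.both A₀ B₀ A₀∈ B₀∈

-- Cross-intersecting families of (t + 1)-sets

-- `A ∩ B` lies in `B - u`, which has only `t` elements, so the two coincide.
almost-⊆ : ∀ {n t} {A B : Subset n} {u v} → t ≤ ∣ A ∩ B ∣ → ∣ B ∣ ≡ suc t → u ∈ˢ B → u ∉ˢ A → v ∈ˢ B → v ≢ u → v ∈ˢ A
almost-⊆ {t = t} {A} {B} {u} {v} t≤ ∣B∣≡ u∈B u∉A v∈B v≢u =
  p∩q⊆p A B (⊆∧∣≥∣⇒⊇ sub (≤-trans (≤-reflexive (cong pred (trans (1+∣p-x∣≡∣p∣ B u∈B) ∣B∣≡))) t≤) (x∈p∧x≢y⇒x∈p-y v∈B v≢u))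
  where
  sub : A ∩ B ⊆ˢ B - u
  sub x∈ = x∈p∧x≢y⇒x∈p-y (p∩q⊆q A B x∈) λ { refl → u∉A (p∩q⊆p A B x∈) }

-- Inclusion-exclusion for the traces of `X` and `Y` on `B`.
∣B∩X∣+∣B∩Y∣≤ : ∀ {n} (B X Y : Subset n) → ∣ B ∩ X ∣ + ∣ B ∩ Y ∣ ≤ ∣ B ∩ (X ∪ Y) ∣ + ∣ B ∩ (X ∩ Y) ∣
∣B∩X∣+∣B∩Y∣≤ B X Y = begin
  ∣ B ∩ X ∣ + ∣ B ∩ Y ∣                               ≡⟨ ∣p∪q∣+∣p∩q∣≡∣p∣+∣q∣ (B ∩ X) (B ∩ Y) ⟨
  ∣ (B ∩ X) ∪ (B ∩ Y) ∣ + ∣ (B ∩ X) ∩ (B ∩ Y) ∣       ≤⟨ +-mono-≤ (p⊆q⇒∣p∣≤∣q∣ join) (p⊆q⇒∣p∣≤∣q∣ meet) ⟩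
  ∣ B ∩ (X ∪ Y) ∣ + ∣ B ∩ (X ∩ Y) ∣                   ∎
  where
  open ≤-Reasoning
  join : (B ∩ X) ∪ (B ∩ Y) ⊆ˢ B ∩ (X ∪ Y)
  join = ∪-lub (∩-mono {p = B} {X} ⊆-refl (p⊆p∪q Y)) (∩-mono {p = B} {Y} ⊆-refl (q⊆p∪q X Y))
  meet : (B ∩ X) ∩ (B ∩ Y) ⊆ˢ B ∩ (X ∩ Y)
  meet x∈ with x∈p∩q⁻ (B ∩ X) (B ∩ Y) x∈
  ... | x∈₁ , x∈₂ = x∈p∩q⁺ (p∩q⊆p B X x∈₁ , x∈p∩q⁺ (p∩q⊆q B X x∈₁ , p∩q⊆q B Y x∈₂))

∣p∣≡2⇒∃ : ∀ {n} (p : Subset n) → ∣ p ∣ ≡ 2 →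
  ∃₂ λ a b → a ≢ b × a ∈ˢ p × b ∈ˢ p × (∀ {x} → x ∈ˢ p → x ≡ a ⊎ x ≡ b)
∣p∣≡2⇒∃ p ∣p∣≡2 with 0<∣p∣⇒Nonempty p (subst (0 <_) (sym ∣p∣≡2) (s≤s z≤n))
... | a , a∈p with cong pred (trans (1+∣p-x∣≡∣p∣ p a∈p) ∣p∣≡2)
... | ∣p-a∣≡1 with 0<∣p∣⇒Nonempty (p - a) (subst (0 <_) (sym ∣p-a∣≡1) (s≤s z≤n))
... | b , b∈p-a = a , b , (λ { refl → x∉p-x p a b∈p-a }) , a∈p , p─q⊆p p ⁅ a ⁆ b∈p-a , only
  where
  only : ∀ {x} → x ∈ˢ p → x ≡ a ⊎ x ≡ b
  only {x} x∈p with x Fin.≟ a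
  ... | yes x≡a = inj₁ x≡a
  ... | no x≢a = inj₂ (x∈⁅y⁆⇒x≡y b (⊆∧∣≥∣⇒⊇ (singleton⊆ b∈p-a)
    (≤-reflexive (trans ∣p-a∣≡1 (sym (∣⁅x⁆∣≡1 b)))) (x∈p∧x≢y⇒x∈p-y x∈p x≢a)))

module Structure {n} (t : ℕ) (t<n : t < n) where

  -- No t-set S is contained in all members of 𝓟 but those above one (t+1)-set X.
  Spread : Family n → Set
  Spread 𝓟 = ∀ S X → ∣ S ∣ ≡ t → ∣ X ∣ ≡ suc t → ¬ (∀ A → A ∈ 𝓟 → ¬ S ⊆ˢ A → X ⊆ˢ A)

  t-set : ∃ λ (S : Subset n) → ∣ S ∣ ≡ t
  t-set with ∃-⊆-of-size ⊤ (subst (t ≤_) (sym (∣⊤∣≡n n)) (<⇒≤ t<n))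
  ... | S , _ , ∣S∣≡t = S , ∣S∣≡t

  avoiding : ∀ {𝓟 : Family n} → Spread 𝓟 → ∀ S → ∣ S ∣ ≡ t → ∃ λ A → A ∈ 𝓟 × ¬ S ⊆ˢ A
  avoiding {𝓟} spread S ∣S∣≡t with anySubset? (λ A → T? (𝓟 A) ×-dec ¬? (S ⊆? A))
  ... | yes found = found
  ... | no none with ∃-⊆-of-size ⊤ (subst (suc t ≤_) (sym (∣⊤∣≡n n)) t<n)
  -- If every member contains `S`, the condition on `X` in `Spread` holds vacuously, so any
  -- `(t + 1)`-set serves; `t < n` provides one.
  ... | X , _ , ∣X∣≡ = ⊥-elim (spread S X ∣S∣≡t ∣X∣≡ λ A A∈ S⊈A → ⊥-elim (none (A , A∈ , S⊈A)))

  module _ (X Y : Subset n) (X∩Y<t : ∣ X ∩ Y ∣ < t) where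

    -- The traces of `X` and `Y` on the `(t + 1)`-set `B` have at least `t` elements each, so they
    -- share at least `t - 1`. As `X ∩ Y` has at most `t - 1` elements, this forces `X ∩ Y` into `B`
    -- and fixes its size.
    ∩⊆-aux : ∀ B → ∣ B ∣ ≡ suc t → t ≤ ∣ B ∩ X ∣ → t ≤ ∣ B ∩ Y ∣ → t ≤ suc ∣ B ∩ (X ∩ Y) ∣
    ∩⊆-aux B ∣B∣≡ t≤X t≤Y = +-cancelˡ-≤ t _ _ (begin
      t + t                                  ≤⟨ +-mono-≤ t≤X t≤Y ⟩
      ∣ B ∩ X ∣ + ∣ B ∩ Y ∣                  ≤⟨ ∣B∩X∣+∣B∩Y∣≤ B X Y ⟩
      ∣ B ∩ (X ∪ Y) ∣ + ∣ B ∩ (X ∩ Y) ∣      ≤⟨ +-monoˡ-≤ _ (≤-trans (∣p∩q∣≤∣p∣ B (X ∪ Y)) (≤-reflexive ∣B∣≡)) ⟩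
      suc t + ∣ B ∩ (X ∩ Y) ∣                ≡⟨ +-suc t _ ⟨
      t + suc ∣ B ∩ (X ∩ Y) ∣                ∎)
      where open ≤-Reasoning

    ∩⊆ : ∀ {B} → ∣ B ∣ ≡ suc t → t ≤ ∣ B ∩ X ∣ → t ≤ ∣ B ∩ Y ∣ → X ∩ Y ⊆ˢ B
    ∩⊆ {B} ∣B∣≡ t≤X t≤Y x∈ = p∩q⊆p B (X ∩ Y) (⊆∧∣≥∣⇒⊇ (p∩q⊆q B (X ∩ Y))
      (≤-pred (≤-trans X∩Y<t (∩⊆-aux B ∣B∣≡ t≤X t≤Y))) x∈)

    ∣∩∣≡t-1 : ∀ B → ∣ B ∣ ≡ suc t → t ≤ ∣ B ∩ X ∣ → t ≤ ∣ B ∩ Y ∣ → suc ∣ X ∩ Y ∣ ≡ t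
    ∣∩∣≡t-1 B ∣B∣≡ t≤X t≤Y = ≤-antisym X∩Y<t
      (≤-trans (∩⊆-aux B ∣B∣≡ t≤X t≤Y) (s≤s (∣p∩q∣≤∣q∣ B (X ∩ Y))))

    meets-difference : ∀ B → t ≤ ∣ B ∩ X ∣ → ∃ λ x → x ∈ˢ X ─ Y × x ∈ˢ B
    meets-difference B t≤X with ∣p∩q∣<∣p∣⇒∃ (B ∩ X) Y (≤-trans (s≤s (p⊆q⇒∣p∣≤∣q∣ sub)) (≤-trans X∩Y<t t≤X))
      where
      sub : (B ∩ X) ∩ Y ⊆ˢ X ∩ Y
      sub = ∩-mono {p = B ∩ X} {Y} (p∩q⊆q B X) ⊆-refl
    ... | x , x∈ , x∉Y = x , x∈p∧x∉q⇒x∈p─q (p∩q⊆q B X x∈) x∉Y , p∩q⊆p B X x∈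

    ∣─∣≡2 : ∣ X ∣ ≡ suc t → suc ∣ X ∩ Y ∣ ≡ t → ∣ X ─ Y ∣ ≡ 2
    ∣─∣≡2 ∣X∣≡ ∣∩∣≡ = +-cancelʳ-≡ ∣ X ∩ Y ∣ _ _
      (trans (∣p─q∣+∣p∩q∣≡∣p∣ X Y) (trans ∣X∣≡ (cong suc (sym ∣∩∣≡))))

    difference-pair : ∣ X ∣ ≡ suc t → suc ∣ X ∩ Y ∣ ≡ t → ∃₂ λ a b → a ≢ b ×
      (a ∈ˢ X × a ∉ˢ Y) × (b ∈ˢ X × b ∉ˢ Y) × (∀ B → t ≤ ∣ B ∩ X ∣ → a ∈ˢ B ⊎ b ∈ˢ B)
    difference-pair ∣X∣≡ ∣∩∣≡ = build (∣p∣≡2⇒∃ (X ─ Y) (∣─∣≡2 ∣X∣≡ ∣∩∣≡))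
      where
      either : ∀ {a b x B} → x ≡ a ⊎ x ≡ b → x ∈ˢ B → a ∈ˢ B ⊎ b ∈ˢ B
      either (inj₁ refl) x∈B = inj₁ x∈B
      either (inj₂ refl) x∈B = inj₂ x∈B
      build : (∃₂ λ a b → a ≢ b × a ∈ˢ X ─ Y × b ∈ˢ X ─ Y × (∀ {x} → x ∈ˢ X ─ Y → x ≡ a ⊎ x ≡ b)) →
        ∃₂ λ a b → a ≢ b × (a ∈ˢ X × a ∉ˢ Y) × (b ∈ˢ X × b ∉ˢ Y) × (∀ B → t ≤ ∣ B ∩ X ∣ → a ∈ˢ B ⊎ b ∈ˢ B)
      build (a , b , a≢b , a∈ , b∈ , only) = a , b , a≢b ,
        (p─q⊆p X Y a∈ , x∉p─q X Y a∈) , (p─q⊆p X Y b∈ , x∉p─q X Y b∈) ,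
        λ B t≤ → let x , x∈ , x∈B = meets-difference B t≤ in either (only x∈) x∈B

  module Pair {𝓟 𝓠 : Family n} (𝓟-size : ∀ A → A ∈ 𝓟 → ∣ A ∣ ≡ suc t) (𝓠-size : ∀ B → B ∈ 𝓠 → ∣ B ∣ ≡ suc t)
    (cross : CrossIntersecting t 𝓟 𝓠) (𝓟-spread : Spread 𝓟) (𝓠-spread : Spread 𝓠) where

    cross′ : ∀ B A → B ∈ 𝓠 → A ∈ 𝓟 → t ≤ ∣ B ∩ A ∣
    cross′ B A B∈ A∈ = subst (t ≤_) (∣p∩q∣≡∣q∩p∣ A B) (cross A B A∈ B∈)

    -- If A₁ = J ∪ {a, b} and A₂ = J ∪ {c, d}, then every member of 𝓠 is J
    -- together with an edge of the 4-cycle a c b d.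
    module FourCycle {A₁ A₂} (A₁∈ : A₁ ∈ 𝓟) (A₂∈ : A₂ ∈ 𝓟) (A₁∩A₂<t : ∣ A₁ ∩ A₂ ∣ < t) where

      J : Subset n
      J = A₁ ∩ A₂

      A₂∩A₁<t : ∣ A₂ ∩ A₁ ∣ < t
      A₂∩A₁<t = subst (_< t) (∣p∩q∣≡∣q∩p∣ A₁ A₂) A₁∩A₂<t

      1+∣J∣≡t : suc ∣ J ∣ ≡ t
      1+∣J∣≡t with avoiding 𝓠-spread (proj₁ t-set) (proj₂ t-set)
      ... | B , B∈ , _ = ∣∩∣≡t-1 A₁ A₂ A₁∩A₂<t B (𝓠-size B B∈) (cross′ B A₁ B∈ A₁∈) (cross′ B A₂ B∈ A₂∈)

      J⊆ : ∀ B → B ∈ 𝓠 → J ⊆ˢ B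
      J⊆ B B∈ = ∩⊆ A₁ A₂ A₁∩A₂<t (𝓠-size B B∈) (cross′ B A₁ B∈ A₁∈) (cross′ B A₂ B∈ A₂∈)

      -- The pair `x`, `x′` makes up `A₁ ─ A₂` and the pair `y`, `y′` makes up `A₂ ─ A₁`. Keeping
      -- the four points as parameters lets the symmetries `flip-x` and `flip-y` carry a fact about
      -- one edge of the cycle to the others.
      record Corners (x x′ y y′ : Fin n) : Set where
        field
          x∈A₁  : x ∈ˢ A₁
          x∉A₂  : x ∉ˢ A₂
          x′∈A₁ : x′ ∈ˢ A₁
          x′∉A₂ : x′ ∉ˢ A₂
          y∈A₂  : y ∈ˢ A₂
          y∉A₁  : y ∉ˢ A₁
          y′∈A₂ : y′ ∈ˢ A₂
          y′∉A₁ : y′ ∉ˢ A₁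
          x≢x′  : x ≢ x′
          y≢y′  : y ≢ y′
          x⊎x′  : ∀ B → B ∈ 𝓠 → x ∈ˢ B ⊎ x′ ∈ˢ B
          y⊎y′  : ∀ B → B ∈ 𝓠 → y ∈ˢ B ⊎ y′ ∈ˢ B

      corners : ∃₂ λ a b → ∃₂ λ c d → Corners a b c d
      corners =
        let a , b , a≢b , (a∈A₁ , a∉A₂) , (b∈A₁ , b∉A₂) , a⊎b =
              difference-pair A₁ A₂ A₁∩A₂<t (𝓟-size A₁ A₁∈) 1+∣J∣≡t
            c , d , c≢d , (c∈A₂ , c∉A₁) , (d∈A₂ , d∉A₁) , c⊎d =
              difference-pair A₂ A₁ A₂∩A₁<t (𝓟-size A₂ A₂∈) (trans (cong suc (∣p∩q∣≡∣q∩p∣ A₂ A₁)) 1+∣J∣≡t)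
        in a , b , c , d , record
        { x∈A₁ = a∈A₁ ; x∉A₂ = a∉A₂ ; x′∈A₁ = b∈A₁ ; x′∉A₂ = b∉A₂
        ; y∈A₂ = c∈A₂ ; y∉A₁ = c∉A₁ ; y′∈A₂ = d∈A₂ ; y′∉A₁ = d∉A₁
        ; x≢x′ = a≢b ; y≢y′ = c≢d
        ; x⊎x′ = λ B B∈ → a⊎b B (cross′ B A₁ B∈ A₁∈)
        ; y⊎y′ = λ B B∈ → c⊎d B (cross′ B A₂ B∈ A₂∈) }

      flip-x : ∀ {x x′ y y′} → Corners x x′ y y′ → Corners x′ x y y′
      flip-x K = record { x∈A₁ = x′∈A₁ ; x∉A₂ = x′∉A₂ ; x′∈A₁ = x∈A₁ ; x′∉A₂ = x∉A₂ ; y∈A₂ = y∈A₂ ; y∉A₁ = y∉A₁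
        ; y′∈A₂ = y′∈A₂ ; y′∉A₁ = y′∉A₁ ; x≢x′ = x≢x′ ∘ sym ; y≢y′ = y≢y′
        ; x⊎x′ = λ B B∈ → swap (x⊎x′ B B∈) ; y⊎y′ = y⊎y′ }
        where open Corners K

      flip-y : ∀ {x x′ y y′} → Corners x x′ y y′ → Corners x x′ y′ y
      flip-y K = record { x∈A₁ = x∈A₁ ; x∉A₂ = x∉A₂ ; x′∈A₁ = x′∈A₁ ; x′∉A₂ = x′∉A₂ ; y∈A₂ = y′∈A₂ ; y∉A₁ = y′∉A₁
        ; y′∈A₂ = y∈A₂ ; y′∉A₁ = y∉A₁ ; x≢x′ = x≢x′ ; y≢y′ = y≢y′ ∘ sym
        ; x⊎x′ = x⊎x′ ; y⊎y′ = λ B B∈ → swap (y⊎y′ B B∈) }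
        where open Corners K

      module _ {x x′ y y′} (K : Corners x x′ y y′) where
        open Corners K

        ∣J∪x∣≡t : ∣ J ∪ ⁅ x ⁆ ∣ ≡ t
        ∣J∪x∣≡t = trans (∣p∪⁅x⁆∣≡1+∣p∣ J (x∉A₂ ∘ p∩q⊆q A₁ A₂)) 1+∣J∣≡t

        ∣J∪y∣≡t : ∣ J ∪ ⁅ y ⁆ ∣ ≡ t
        ∣J∪y∣≡t = trans (∣p∪⁅x⁆∣≡1+∣p∣ J (y∉A₁ ∘ p∩q⊆p A₁ A₂)) 1+∣J∣≡t

        ∣J∪x∪y∣≡1+t : ∣ (J ∪ ⁅ x ⁆) ∪ ⁅ y ⁆ ∣ ≡ suc t
        ∣J∪x∪y∣≡1+t = trans (∣p∪⁅x⁆∣≡1+∣p∣ (J ∪ ⁅ x ⁆) (y∉A₁ ∘ ∪-lub (p∩q⊆p A₁ A₂) (singleton⊆ x∈A₁))) (cong suc ∣J∪x∣≡t)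

        ∣J∪y∪y′∣≡1+t : ∣ (J ∪ ⁅ y ⁆) ∪ ⁅ y′ ⁆ ∣ ≡ suc t
        ∣J∪y∪y′∣≡1+t = trans (∣p∪⁅x⁆∣≡1+∣p∣ (J ∪ ⁅ y ⁆) outside-J∪y) (cong suc ∣J∪y∣≡t)
          where
          outside-J∪y : y′ ∉ˢ J ∪ ⁅ y ⁆
          outside-J∪y i with x∈p∪q⁻ J ⁅ y ⁆ i
          ... | inj₁ y′∈J = y′∉A₁ (p∩q⊆p A₁ A₂ y′∈J)
          ... | inj₂ y′∈y = y≢y′ (sym (x∈⁅y⁆⇒x≡y y y′∈y))

      -- Without a member through `x` and `y`, a member of `𝓠` that omits `x′` contains `x` and
      -- hence `y′`. All members but those above `J ∪ ⁅ x ⁆ ∪ ⁅ y′ ⁆` would then contain the `t`-set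
      -- `J ∪ ⁅ x′ ⁆`, contrary to `Spread`.
      edge : ∀ {x x′ y y′} → Corners x x′ y y′ → ∃ λ B → B ∈ 𝓠 × x ∈ˢ B × y ∈ˢ B
      edge {x} {x′} {y} {y′} K with anySubset? (λ B → T? (𝓠 B) ×-dec ((x ∈? B) ×-dec (y ∈? B)))
      ... | yes found = found
      ... | no none = ⊥-elim (𝓠-spread (J ∪ ⁅ x′ ⁆) ((J ∪ ⁅ x ⁆) ∪ ⁅ y′ ⁆)
        (∣J∪x∣≡t (flip-x K)) (∣J∪x∪y∣≡1+t (flip-y K)) above)
        where
        open Corners K
        above : ∀ B → B ∈ 𝓠 → ¬ J ∪ ⁅ x′ ⁆ ⊆ˢ B → (J ∪ ⁅ x ⁆) ∪ ⁅ y′ ⁆ ⊆ˢ B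
        above B B∈ ⊈ with x⊎x′ B B∈ | y⊎y′ B B∈
        ... | inj₂ x′∈B | _ = ⊥-elim (⊈ (∪-lub (J⊆ B B∈) (singleton⊆ x′∈B)))
        ... | inj₁ x∈B | inj₁ y∈B = ⊥-elim (none (B , B∈ , x∈B , y∈B))
        ... | inj₁ x∈B | inj₂ y′∈B = ∪-lub (∪-lub (J⊆ B B∈) (singleton⊆ x∈B)) (singleton⊆ y′∈B)

      edge-elements : ∀ {x x′ y y′} → Corners x x′ y y′ → ∀ {B} → B ∈ 𝓠 → x ∈ˢ B → y ∈ˢ B →
        ∀ {z} → z ∈ˢ B → z ∈ˢ J ⊎ z ≡ x ⊎ z ≡ y
      edge-elements {x} {y = y} K {B} B∈ x∈B y∈B z∈B
        with x∈p∪q⁻ (J ∪ ⁅ x ⁆) ⁅ y ⁆ (⊆∧∣≥∣⇒⊇ (∪-lub (∪-lub (J⊆ B B∈) (singleton⊆ x∈B)) (singleton⊆ y∈B))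
          (≤-reflexive (trans (𝓠-size B B∈) (sym (∣J∪x∪y∣≡1+t K)))) z∈B)
      ... | inj₂ z∈y = inj₂ (inj₂ (x∈⁅y⁆⇒x≡y y z∈y))
      ... | inj₁ z∈ with x∈p∪q⁻ J ⁅ x ⁆ z∈
      ... | inj₁ z∈J = inj₁ z∈J
      ... | inj₂ z∈x = inj₂ (inj₁ (x∈⁅y⁆⇒x≡y x z∈x))

      -- The edges `ac` and `bd` share no corner, so `Bac ∩ Bbd` lies in `J` and every member of `𝓟`
      -- contains `J` by `∩⊆`. A member omitting `a` must contain `c` because of `Bac` and `d`
      -- because of `Bad`. Thus all members but those above `J ∪ ⁅ c ⁆ ∪ ⁅ d ⁆` contain `J ∪ ⁅ a ⁆`,
      -- contrary to `Spread`.
      covering-cycle-impossible : ∀ {a b c d} → Corners a b c d →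
        (∃ λ B → B ∈ 𝓠 × a ∈ˢ B × c ∈ˢ B) → (∃ λ B → B ∈ 𝓠 × a ∈ˢ B × d ∈ˢ B) → (∃ λ B → B ∈ 𝓠 × b ∈ˢ B × d ∈ˢ B) → ⊥
      covering-cycle-impossible {a} {b} {c} {d} K (Bac , ac∈ , a∈ac , c∈ac) (Bad , ad∈ , a∈ad , d∈ad) (Bbd , bd∈ , b∈bd , d∈bd) =
        𝓟-spread (J ∪ ⁅ a ⁆) ((J ∪ ⁅ c ⁆) ∪ ⁅ d ⁆) (∣J∪x∣≡t K) (∣J∪y∪y′∣≡1+t K) above
        where
        open Corners K renaming (x∈A₁ to a∈A₁; x∉A₂ to a∉A₂; y∉A₁ to c∉A₁; x′∈A₁ to b∈A₁; y′∉A₁ to d∉A₁; x≢x′ to a≢b; y≢y′ to c≢d)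
        common : ∀ {z} → z ∈ˢ J ⊎ z ≡ a ⊎ z ≡ c → z ∈ˢ J ⊎ z ≡ b ⊎ z ≡ d → z ∈ˢ J
        common (inj₁ z∈J) _ = z∈J
        common (inj₂ _) (inj₁ z∈J) = z∈J
        common (inj₂ (inj₁ refl)) (inj₂ (inj₁ a≡b)) = ⊥-elim (a≢b a≡b)
        common (inj₂ (inj₁ refl)) (inj₂ (inj₂ refl)) = ⊥-elim (d∉A₁ a∈A₁)
        common (inj₂ (inj₂ refl)) (inj₂ (inj₁ refl)) = ⊥-elim (c∉A₁ b∈A₁)
        common (inj₂ (inj₂ refl)) (inj₂ (inj₂ c≡d)) = ⊥-elim (c≢d c≡d)
        ac∩bd⊆J : Bac ∩ Bbd ⊆ˢ J
        ac∩bd⊆J z∈ = common (edge-elements K ac∈ a∈ac c∈ac (p∩q⊆p Bac Bbd z∈))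
          (edge-elements (flip-x (flip-y K)) bd∈ b∈bd d∈bd (p∩q⊆q Bac Bbd z∈))
        J⊆A : ∀ A → A ∈ 𝓟 → J ⊆ˢ A
        J⊆A A A∈ z∈J = ∩⊆ Bac Bbd (≤-trans (s≤s (p⊆q⇒∣p∣≤∣q∣ ac∩bd⊆J)) A₁∩A₂<t)
          (𝓟-size A A∈) (cross A Bac A∈ ac∈) (cross A Bbd A∈ bd∈) (x∈p∩q⁺ (J⊆ Bac ac∈ z∈J , J⊆ Bbd bd∈ z∈J))
        above : ∀ A → A ∈ 𝓟 → ¬ J ∪ ⁅ a ⁆ ⊆ˢ A → (J ∪ ⁅ c ⁆) ∪ ⁅ d ⁆ ⊆ˢ A
        above A A∈ ⊈ = ∪-lub (∪-lub (J⊆A A A∈)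
          (singleton⊆ (almost-⊆ (cross A Bac A∈ ac∈) (𝓠-size Bac ac∈) a∈ac a∉A c∈ac λ { refl → c∉A₁ a∈A₁ })))
          (singleton⊆ (almost-⊆ (cross A Bad A∈ ad∈) (𝓠-size Bad ad∈) a∈ad a∉A d∈ad λ { refl → d∉A₁ a∈A₁ }))
          where
          a∉A : a ∉ˢ A
          a∉A a∈A = ⊈ (∪-lub (J⊆A A A∈) (singleton⊆ a∈A))

      impossible : ⊥
      impossible = let _ , _ , _ , _ , K = corners in
        covering-cycle-impossible K (edge K) (edge (flip-y K)) (edge (flip-x (flip-y K)))

    𝓟-intersecting : ∀ A₁ A₂ → A₁ ∈ 𝓟 → A₂ ∈ 𝓟 → t ≤ ∣ A₁ ∩ A₂ ∣
    𝓟-intersecting A₁ A₂ A₁∈ A₂∈ = ≮⇒≥ λ lt → FourCycle.impossible A₁∈ A₂∈ lt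

  module _ (𝓗 : Subset n → Set) (size : ∀ H → 𝓗 H → ∣ H ∣ ≡ suc t)
    (intersecting : ∀ H H′ → 𝓗 H → 𝓗 H′ → t ≤ ∣ H ∩ H′ ∣)
    (nontrivial : ∀ S → ∣ S ∣ ≡ t → ∃ λ H → 𝓗 H × ¬ S ⊆ˢ H) where

    -- Choosing `H₂` to avoid a `t`-subset of `H₁` makes the two differ, so `S = H₁ ∩ H₂` has `t`
    -- elements and `Z = H₁ ∪ H₂` has `t + 2`. A member not above `S` lies in `Z` by counting. A
    -- member above `S` shares with such a member `H₃` a point `v` outside `S`, so it equals
    -- `S ∪ ⁅ v ⁆` and lies in `Z` too.
    inside-t+2-set : ∃ λ Z → ∣ Z ∣ ≡ 2 + t × (∀ H → 𝓗 H → H ⊆ˢ Z)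
    inside-t+2-set with nontrivial (proj₁ t-set) (proj₂ t-set)
    ... | H₁ , H₁∈ , _ with ∃-⊆-of-size H₁ (≤-trans (n≤1+n t) (≤-reflexive (sym (size H₁ H₁∈))))
    ... | S₁ , S₁⊆H₁ , ∣S₁∣≡t with nontrivial S₁ ∣S₁∣≡t
    ... | H₂ , H₂∈ , S₁⊈H₂ = result
      where
      S Z : Subset n
      S = H₁ ∩ H₂
      Z = H₁ ∪ H₂
      ∣S∣≡t : ∣ S ∣ ≡ t
      ∣S∣≡t = ≤-antisym (≤-pred (≰⇒> too-big)) (intersecting H₁ H₂ H₁∈ H₂∈)
        where
        too-big : ¬ suc t ≤ ∣ S ∣
        too-big le = S₁⊈H₂ λ x∈ → p∩q⊆q H₁ H₂ (⊆∧∣≥∣⇒⊇ (p∩q⊆p H₁ H₂)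
          (≤-trans (≤-reflexive (size H₁ H₁∈)) le) (S₁⊆H₁ x∈))
      ∣Z∣≡2+t : ∣ Z ∣ ≡ 2 + t
      ∣Z∣≡2+t = +-cancelʳ-≡ t _ _ (trans (cong (∣ Z ∣ +_) (sym ∣S∣≡t)) (trans (∣p∪q∣+∣p∩q∣≡∣p∣+∣q∣ H₁ H₂)
        (trans (cong₂ _+_ (size H₁ H₁∈) (size H₂ H₂∈)) (cong suc (+-suc t t)))))
      S∩<t : ∀ H → ¬ S ⊆ˢ H → ∣ H ∩ S ∣ < t
      S∩<t H S⊈H = ≰⇒> λ le → S⊈H λ x∈ → p∩q⊆p H S (⊆∧∣≥∣⇒⊇ (p∩q⊆q H S) (≤-trans (≤-reflexive ∣S∣≡t) le) x∈)
      inside₁ : ∀ H → 𝓗 H → ¬ S ⊆ˢ H → H ⊆ˢ Z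
      inside₁ H H∈ S⊈H x∈ = p∩q⊆q H Z (⊆∧∣≥∣⇒⊇ (p∩q⊆p H Z) enough x∈)
        where
        open ≤-Reasoning
        enough : ∣ H ∣ ≤ ∣ H ∩ Z ∣
        enough = subst (_≤ ∣ H ∩ Z ∣) (sym (size H H∈)) (+-cancelʳ-≤ ∣ H ∩ S ∣ _ _ (begin
          suc t + ∣ H ∩ S ∣          ≡⟨ +-suc t ∣ H ∩ S ∣ ⟨
          t + suc ∣ H ∩ S ∣          ≤⟨ +-monoʳ-≤ t (S∩<t H S⊈H) ⟩
          t + t                      ≤⟨ +-mono-≤ (intersecting H H₁ H∈ H₁∈) (intersecting H H₂ H∈ H₂∈) ⟩
          ∣ H ∩ H₁ ∣ + ∣ H ∩ H₂ ∣    ≤⟨ ∣B∩X∣+∣B∩Y∣≤ H H₁ H₂ ⟩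
          ∣ H ∩ Z ∣ + ∣ H ∩ S ∣      ∎))
      result : ∃ λ Z → ∣ Z ∣ ≡ 2 + t × (∀ H → 𝓗 H → H ⊆ˢ Z)
      result with nontrivial S ∣S∣≡t
      ... | H₃ , H₃∈ , S⊈H₃ = Z , ∣Z∣≡2+t , inside₂
        where
        inside₂ : ∀ H → 𝓗 H → H ⊆ˢ Z
        inside₂ H H∈ with S ⊆? H
        ... | no S⊈H = inside₁ H H∈ S⊈H
        ... | yes S⊆H with ∣p∩q∣<∣p∣⇒∃ (H ∩ H₃) S (≤-trans (s≤s (p⊆q⇒∣p∣≤∣q∣ (∩-mono {p = H ∩ H₃} {S} (p∩q⊆q H H₃) ⊆-refl)))
              (≤-trans (S∩<t H₃ S⊈H₃) (intersecting H H₃ H∈ H₃∈)))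
        ... | v , v∈ , v∉S = ⊆-trans
          (⊆∧∣≥∣⇒⊇ (∪-lub S⊆H (singleton⊆ (p∩q⊆p H H₃ v∈)))
            (≤-reflexive (trans (size H H∈) (sym (trans (∣p∪⁅x⁆∣≡1+∣p∣ S v∉S) (cong suc ∣S∣≡t))))))
          (∪-lub (p⊆p∪q H₂ ∘ p∩q⊆p H₁ H₂) (singleton⊆ (inside₁ H₃ H₃∈ S⊈H₃ (p∩q⊆q H H₃ v∈))))

-- The threshold

toℚᵘ-fromℕ : ∀ a → toℚᵘ (fromℕ a) ℚᵘ.≃ mkℚᵘ (ℤ.+ a) 0
toℚᵘ-fromℕ a = ℚ.toℚᵘ-fromℚᵘ (mkℚᵘ (ℤ.+ a) 0)

fromℕ-+ : ∀ a b → fromℕ a ℚ.+ fromℕ b ≡ fromℕ (a + b)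
fromℕ-+ a b = ℚ.toℚᵘ-injective (begin
  toℚᵘ (fromℕ a ℚ.+ fromℕ b)             ≈⟨ ℚ.toℚᵘ-homo-+ (fromℕ a) (fromℕ b) ⟩
  toℚᵘ (fromℕ a) ℚᵘ.+ toℚᵘ (fromℕ b)     ≈⟨ ℚᵘ.+-cong (toℚᵘ-fromℕ a) (toℚᵘ-fromℕ b) ⟩
  mkℚᵘ (ℤ.+ a) 0 ℚᵘ.+ mkℚᵘ (ℤ.+ b) 0         ≈⟨ *≡* (cong₂ (λ x y → (x ℤ.+ y) ℤ.* ℤ.+ 1) (ℤ.*-identityʳ (ℤ.+ a)) (ℤ.*-identityʳ (ℤ.+ b))) ⟩
  mkℚᵘ (ℤ.+ (a + b)) 0                     ≈⟨ toℚᵘ-fromℕ (a + b) ⟨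
  toℚᵘ (fromℕ (a + b))                   ∎)
  where open ℚᵘ.≃-Reasoning

fromℕ-* : ∀ a b → fromℕ a ℚ.* fromℕ b ≡ fromℕ (a * b)
fromℕ-* a b = ℚ.toℚᵘ-injective (begin
  toℚᵘ (fromℕ a ℚ.* fromℕ b)             ≈⟨ ℚ.toℚᵘ-homo-* (fromℕ a) (fromℕ b) ⟩
  toℚᵘ (fromℕ a) ℚᵘ.* toℚᵘ (fromℕ b)     ≈⟨ ℚᵘ.*-cong (toℚᵘ-fromℕ a) (toℚᵘ-fromℕ b) ⟩
  mkℚᵘ (ℤ.+ a) 0 ℚᵘ.* mkℚᵘ (ℤ.+ b) 0         ≈⟨ *≡* (cong (ℤ._* ℤ.+ 1) (sym (ℤ.pos-* a b))) ⟩
  mkℚᵘ (ℤ.+ (a * b)) 0                     ≈⟨ toℚᵘ-fromℕ (a * b) ⟨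
  toℚᵘ (fromℕ (a * b))                   ∎)
  where open ℚᵘ.≃-Reasoning

fromℕ-cancel-≤ : ∀ {a b} → fromℕ a ℚ.≤ fromℕ b → a ≤ b
fromℕ-cancel-≤ {a} {b} a≤b with ℚᵘ.≤-respʳ-≃ (toℚᵘ-fromℕ b) (ℚᵘ.≤-respˡ-≃ (toℚᵘ-fromℕ a) (ℚ.toℚᵘ-mono-≤ a≤b))
... | *≤* le = ℤ.drop‿+≤+ (ℤ.*-cancelʳ-≤-pos (ℤ.+ a) (ℤ.+ b) (ℤ.+ 1) le)

fromℕ-nonNegative : ∀ a → ℚ.NonNegative (fromℕ a)
fromℕ-nonNegative a = ℚ.normalize-nonNeg a 1

-- 2 e ≥ 5, since e ≥ 1 + 1 + 1/2.
threshold⇒≤ : ∀ n k t → AtLeastThreshold n k t → t + (k ∸ t) * (18 * (t + 2) ⊔ 5 * k) ≤ n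
threshold⇒≤ n k t large = [ bound {18 * (t + 2)} (ℚ.p≤p⊔q first second) , bound {5 * k} (ℚ.≤-trans (ℚ.≤-reflexive 5k) (ℚ.p≤q⊔p first second)) ]′
  (⊔-sel (18 * (t + 2)) (5 * k))
  where
  first second : ℚ
  first = fromℕ (18 * (t + 2))
  second = fromℕ 2 ℚ.* e-sum 2 ℚ.* fromℕ k
  5k : fromℕ (5 * k) ≡ second
  -- `fromℕ 2 ℚ.* e-sum 2` evaluates to 5.
  5k = sym (fromℕ-* 5 k)
  bound : ∀ {b} → fromℕ b ℚ.≤ first ℚ.⊔ second → ∀ {a} → a ≡ b → t + (k ∸ t) * a ≤ n
  bound {b} b≤ refl = fromℕ-cancel-≤ (begin
    fromℕ (t + (k ∸ t) * b)                          ≡⟨ fromℕ-+ t ((k ∸ t) * b) ⟨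
    fromℕ t ℚ.+ fromℕ ((k ∸ t) * b)                  ≡⟨ cong (fromℕ t ℚ.+_) (fromℕ-* (k ∸ t) b) ⟨
    fromℕ t ℚ.+ fromℕ (k ∸ t) ℚ.* fromℕ b
      ≤⟨ ℚ.+-monoʳ-≤ (fromℕ t) (ℚ.*-monoˡ-≤-nonNeg (fromℕ (k ∸ t)) {{fromℕ-nonNegative (k ∸ t)}} b≤) ⟩
    threshold k t (e-sum 2)                          ≤⟨ large 2 ⟩
    fromℕ n                                          ∎)
    where open ℚ.≤-Reasoning

-- Diversity of 𝓐 (Z)

module _ {n} (t : ℕ) (𝓕 : Family n) where

  γ-≤ : ∀ S → ∣ S ∣ ≡ t → γ t 𝓕 ≤ card (𝓕 ∖ supersets S)
  γ-≤ S ∣S∣≡t = begin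
    card 𝓕 ∸ Δ t 𝓕                                         ≤⟨ ∸-monoʳ-≤ (card 𝓕) degree≤Δ ⟩
    card 𝓕 ∸ card (𝓕 ∩ᶠ supersets S)                       ≡⟨ cong (_∸ card (𝓕 ∩ᶠ supersets S)) (card-split 𝓕 (supersets S)) ⟩
    card (𝓕 ∩ᶠ supersets S) + card (𝓕 ∖ supersets S) ∸ card (𝓕 ∩ᶠ supersets S) ≡⟨ m+n∸m≡n (card (𝓕 ∩ᶠ supersets S)) _ ⟩
    card (𝓕 ∖ supersets S)                                 ∎
    where
    open ≤-Reasoning
    degree≤Δ : card (containing S 𝓕) ≤ Δ t 𝓕
    degree≤Δ = Extrema.v≤max⁺ 0 _ (inj₂ (Any.map ≤-reflexive
      (∈-map⁺ (λ S → card (containing S 𝓕)) (∈-filterᵇ⁺ binom[ t ] (∈-allSubsets S) (fromWitness ∣S∣≡t)))))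

  -- The set `S₀` shows that `t`-sets exist: it yields `b ≤ card 𝓕`, which makes the subtraction
  -- exact. Without a `t`-set the assumption on `b` would be vacuous.
  ≤-γ : ∀ {b} S₀ → ∣ S₀ ∣ ≡ t → (∀ S → ∣ S ∣ ≡ t → b ≤ card (𝓕 ∖ supersets S)) → b ≤ γ t 𝓕
  ≤-γ {b} S₀ ∣S₀∣≡t large = m+n≤o⇒m≤o∸n b (begin
    b + Δ t 𝓕            ≤⟨ +-monoʳ-≤ b Δ≤ ⟩
    b + (card 𝓕 ∸ b)     ≡⟨ m+[n∸m]≡n (≤-trans (m≤n+m b _) (degree+b≤ S₀ ∣S₀∣≡t)) ⟩
    card 𝓕               ∎)
    where
    open ≤-Reasoning
    degree+b≤ : ∀ S → ∣ S ∣ ≡ t → card (containing S 𝓕) + b ≤ card 𝓕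
    degree+b≤ S ∣S∣≡t = ≤-trans (+-monoʳ-≤ (card (containing S 𝓕)) (large S ∣S∣≡t)) (≤-reflexive (sym (card-split 𝓕 (supersets S))))
    Δ≤ : Δ t 𝓕 ≤ card 𝓕 ∸ b
    Δ≤ = Extrema.max≤v⁺ z≤n (All.tabulate each)
      where
      each : ∀ {x} → x ∈ˡ map (λ S → card (containing S 𝓕)) (filterᵇ binom[ t ] (allSubsets n)) → x ≤ card 𝓕 ∸ b
      each i with ∈-map⁻ (λ S → card (containing S 𝓕)) i
      ... | S , j , refl = m+n≤o⇒m≤o∸n _ (degree+b≤ S (toWitness (∈-filterᵇ⁻ binom[ t ] (allSubsets n) j)))

module _ {n} (k t : ℕ) (Z F : Subset n) where

  𝓐⁺ : ∣ F ∣ ≡ k → t + 1 ≤ ∣ F ∩ Z ∣ → F ∈ 𝓐 k t Z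
  𝓐⁺ p q = fromWitness {a? = (∣ F ∣ ≟ k) ×-dec (t + 1 ≤? ∣ F ∩ Z ∣)} (p , q)

  𝓐⁻ : F ∈ 𝓐 k t Z → ∣ F ∣ ≡ k × t + 1 ≤ ∣ F ∩ Z ∣
  𝓐⁻ = toWitness {a? = (∣ F ∣ ≟ k) ×-dec (t + 1 ≤? ∣ F ∩ Z ∣)}

module _ {n} (𝓕 : Family n) (x : Fin n) (F : Subset n) where

  ∖-point⁺ : F ∈ 𝓕 → x ∉ˢ F → F ∈ 𝓕 ∖ supersets ⁅ x ⁆
  ∖-point⁺ F∈ x∉F = ∖⁺ 𝓕 (supersets ⁅ x ⁆) F F∈ λ F∈sup → x∉F (toWitness {a? = ⁅ x ⁆ ⊆? F} F∈sup (x∈⁅x⁆ x))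

  ∖-point⁻ : F ∈ 𝓕 ∖ supersets ⁅ x ⁆ → F ∈ 𝓕 × x ∉ˢ F
  ∖-point⁻ F∈ with ∖⁻ 𝓕 (supersets ⁅ x ⁆) F F∈
  ... | F∈𝓕 , F∉ = F∈𝓕 , λ x∈F → F∉ (fromWitness {a? = ⁅ x ⁆ ⊆? F} (singleton⊆ x∈F))

module _ {n} (𝓕 : Family n) (S F : Subset n) where

  ∖-supersets⁺ : F ∈ 𝓕 → ¬ S ⊆ˢ F → F ∈ 𝓕 ∖ supersets S
  ∖-supersets⁺ F∈ S⊈F = ∖⁺ 𝓕 (supersets S) F F∈ λ F∈sup → S⊈F (toWitness {a? = S ⊆? F} F∈sup)

  ∖-supersets⁻ : F ∈ 𝓕 ∖ supersets S → F ∈ 𝓕 × ¬ S ⊆ˢ F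
  ∖-supersets⁻ F∈ with ∖⁻ 𝓕 (supersets S) F F∈
  ... | F∈𝓕 , F∉ = F∈𝓕 , λ S⊆F → F∉ (fromWitness {a? = S ⊆? F} S⊆F)

p⊆[p-x]∪⁅x⁆ : ∀ {n} (p : Subset n) x → p ⊆ˢ (p - x) ∪ ⁅ x ⁆
p⊆[p-x]∪⁅x⁆ p x {y} y∈p with y Fin.≟ x
... | yes refl = q⊆p∪q (p - x) ⁅ x ⁆ (x∈⁅x⁆ x)
... | no y≢x = p⊆p∪q ⁅ x ⁆ (x∈p∧x≢y⇒x∈p-y y∈p y≢x)

module Diversity (n k t Q : ℕ) (2≤t : 2 ≤ t) (t+2≤k : t + 2 ≤ k)
  (18[t+2]≤Q : 18 * (t + 2) ≤ Q) (5k≤Q : 5 * k ≤ Q) (large : t + (k ∸ t) * Q ≤ n) where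

  open Bounds n k t Q 2≤t t+2≤k 18[t+2]≤Q 5k≤Q large
  open ≤-Reasoning

  -- By Pascal's rule this is C(n - t - 2, k - t - 1), the number of `k`-sets that meet a
  -- `(t + 2)`-set in a prescribed `(t + 1)`-subset.
  D : ℕ
  D = M₁ ∸ M₂

  -- With `D = M₁ ∸ M₂` this is a rearrangement of `tD≤[2+t][D∸M₂]`.
  [t+4]M₂≤2M₁ : (t + 4) * M₂ ≤ 2 * M₁
  [t+4]M₂≤2M₁ = begin
    (t + 4) * M₂            ≤⟨ m≤m+n _ ((35 * t + 68) * M₂) ⟩
    (t + 4) * M₂ + (35 * t + 68) * M₂ ≡⟨ lemma t M₂ ⟩
    2 * (18 * (t + 2) * M₂) ≤⟨ *-monoʳ-≤ 2 18[t+2]M₂≤M₁ ⟩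
    2 * M₁                  ∎
    where
    lemma : ∀ t m → (t + 4) * m + (35 * t + 68) * m ≡ 2 * (18 * (t + 2) * m)
    lemma = solve-∀

  2M₂≤M₁ : 2 * M₂ ≤ M₁
  2M₂≤M₁ = *-cancelˡ-≤ 2 (≤-trans (≤-trans (≤-reflexive (sym (*-assoc 2 2 M₂))) (*-monoˡ-≤ M₂ (m≤n+m 4 t))) [t+4]M₂≤2M₁)

  M₂≤M₁ : M₂ ≤ M₁
  M₂≤M₁ = ≤-trans (m≤m+n M₂ _) 2M₂≤M₁

  D+M₂≡M₁ : D + M₂ ≡ M₁
  D+M₂≡M₁ = m∸n+n≡m M₂≤M₁

  tD+tM₂≡tM₁ : t * D + t * M₂ ≡ t * M₁
  tD+tM₂≡tM₁ = trans (sym (*-distribˡ-+ t D M₂)) (cong (t *_) D+M₂≡M₁)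

  card-star₁ : ∀ X → ∣ X ∣ ≡ suc t → card (star k X) ≡ M₁
  card-star₁ X ∣X∣≡ = trans (card-star k X) (cong M (trans ∣X∣≡ (+-comm 1 t)))

  card-star₂ : ∀ X → ∣ X ∣ ≡ 2 + t → card (star k X) ≡ M₂
  card-star₂ X ∣X∣≡ = trans (card-star k X) (cong M (trans ∣X∣≡ (+-comm 2 t)))

  module _ (Z : Subset n) (∣Z∣≡ : ∣ Z ∣ ≡ 2 + t) where

    -- For `w` in `Z`, these are the `k`-sets whose trace on `Z` is `Z - w`.
    missing : Fin n → Family n
    missing w = star k (Z - w) ∖ supersets ⁅ w ⁆

    missing⁻ : ∀ w F → F ∈ missing w → ∣ F ∣ ≡ k × Z - w ⊆ˢ F × w ∉ˢ F
    missing⁻ w F F∈ with ∖-point⁻ (star k (Z - w)) w F F∈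
    ... | F∈star , w∉F with star⁻ k (Z - w) F F∈star
    ... | ∣F∣≡k , Z-w⊆F = ∣F∣≡k , Z-w⊆F , w∉F

    ∣Z-w∣≡ : ∀ {w} → w ∈ˢ Z → ∣ Z - w ∣ ≡ suc t
    ∣Z-w∣≡ w∈Z = cong pred (trans (1+∣p-x∣≡∣p∣ Z w∈Z) ∣Z∣≡)

    card-missing : ∀ {w} → w ∈ˢ Z → card (missing w) ≡ D
    card-missing {w} w∈Z = begin-equality
      card (missing w)                                ≡⟨ m+n∸m≡n (card (star k (Z - w) ∩ᶠ supersets ⁅ w ⁆)) _ ⟨
      card (star k (Z - w) ∩ᶠ supersets ⁅ w ⁆) + card (missing w) ∸ card (star k (Z - w) ∩ᶠ supersets ⁅ w ⁆)
        ≡⟨ cong₂ _∸_ (trans (sym (card-split (star k (Z - w)) (supersets ⁅ w ⁆))) (card-star₁ (Z - w) (∣Z-w∣≡ w∈Z)))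
                     (trans (card-cong to from) (card-star₂ Z ∣Z∣≡)) ⟩
      D                                               ∎
      where
      to : star k (Z - w) ∩ᶠ supersets ⁅ w ⁆ ⊆ star k Z
      to F F∈ with ∩-supersets⁻ (star k (Z - w)) ⁅ w ⁆ F F∈
      ... | F∈star , w⊆F with star⁻ k (Z - w) F F∈star
      ... | ∣F∣≡k , Z-w⊆F = star⁺ k Z F ∣F∣≡k (⊆-trans (p⊆[p-x]∪⁅x⁆ Z w) (∪-lub Z-w⊆F w⊆F))
      from : star k Z ⊆ star k (Z - w) ∩ᶠ supersets ⁅ w ⁆
      from F F∈ with star⁻ k Z F F∈
      ... | ∣F∣≡k , Z⊆F = ∩-supersets⁺ (star k (Z - w)) ⁅ w ⁆ F
        (star⁺ k (Z - w) F ∣F∣≡k (⊆-trans (p─q⊆p Z ⁅ w ⁆) Z⊆F)) (singleton⊆ (Z⊆F w∈Z))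

    card-missing-two : ∀ {w s} → w ∈ˢ Z → s ∉ˢ Z → D ∸ M₂ ≤ card (missing w ∖ supersets ⁅ s ⁆)
    card-missing-two {w} {s} w∈Z s∉Z = m≤n+o⇒m∸n≤o D M₂ (begin
      D                                                     ≡⟨ card-missing w∈Z ⟨
      card (missing w)                                      ≡⟨ card-split (missing w) (supersets ⁅ s ⁆) ⟩
      card (missing w ∩ᶠ supersets ⁅ s ⁆) + card (missing w ∖ supersets ⁅ s ⁆)
        ≤⟨ +-monoˡ-≤ _ (≤-trans (card-mono to) (≤-reflexive (card-star₂ ((Z - w) ∪ ⁅ s ⁆) size))) ⟩
      M₂ + card (missing w ∖ supersets ⁅ s ⁆)               ∎)
      where
      size : ∣ (Z - w) ∪ ⁅ s ⁆ ∣ ≡ 2 + t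
      size = trans (∣p∪⁅x⁆∣≡1+∣p∣ (Z - w) (s∉Z ∘ p─q⊆p Z ⁅ w ⁆)) (cong suc (∣Z-w∣≡ w∈Z))
      to : missing w ∩ᶠ supersets ⁅ s ⁆ ⊆ star k ((Z - w) ∪ ⁅ s ⁆)
      to F F∈ with ∩-supersets⁻ (missing w) ⁅ s ⁆ F F∈
      ... | F∈m , s⊆F with missing⁻ w F F∈m
      ... | ∣F∣≡k , Z-w⊆F , _ = star⁺ k ((Z - w) ∪ ⁅ s ⁆) F ∣F∣≡k (∪-lub Z-w⊆F s⊆F)

    missing⊆𝓐 : ∀ {w} → w ∈ˢ Z → missing w ⊆ 𝓐 k t Z
    missing⊆𝓐 {w} w∈Z F F∈ with missing⁻ w F F∈
    ... | ∣F∣≡k , Z-w⊆F , _ = 𝓐⁺ k t Z F ∣F∣≡k (begin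
      t + 1         ≡⟨ +-comm t 1 ⟩
      suc t         ≡⟨ ∣Z-w∣≡ w∈Z ⟨
      ∣ Z - w ∣     ≤⟨ p⊆q⇒∣p∣≤∣q∣ (∩-glb {p = F} {Z} Z-w⊆F (p─q⊆p Z ⁅ w ⁆)) ⟩
      ∣ F ∩ Z ∣     ∎)

    missing-disjoint : ∀ {w w′} F → w ∈ˢ Z → F ∈ missing w → F ∈ missing w′ → w ≡ w′
    missing-disjoint {w} {w′} F w∈Z F∈ F∈′ with w Fin.≟ w′
    ... | yes eq = eq
    ... | no w≢w′ = ⊥-elim (proj₂ (proj₂ (missing⁻ w F F∈)) (proj₁ (proj₂ (missing⁻ w′ F F∈′)) (x∈p∧x≢y⇒x∈p-y w∈Z w≢w′)))

    tD≤[2+t][D∸M₂] : t * D ≤ (2 + t) * (D ∸ M₂)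
    tD≤[2+t][D∸M₂] = begin
      t * D                ≡⟨ cong (t *_) E+M₂≡D ⟨
      t * (E + M₂)         ≡⟨ *-distribˡ-+ t E M₂ ⟩
      t * E + t * M₂       ≤⟨ +-monoʳ-≤ (t * E) tM₂≤2E ⟩
      t * E + 2 * E        ≡⟨ lemma₁ t E ⟩
      (2 + t) * E          ∎
      where
      E : ℕ
      E = D ∸ M₂
      E+M₂≡D : E + M₂ ≡ D
      E+M₂≡D = m∸n+n≡m (m+n≤o⇒m≤o∸n M₂ (≤-trans (≤-reflexive (cong (_+_ M₂) (sym (+-identityʳ M₂)))) 2M₂≤M₁))
      lemma₁ : ∀ t e → t * e + 2 * e ≡ (2 + t) * e
      lemma₁ = solve-∀
      lemma₂ : ∀ t m → t * m + 4 * m ≡ (t + 4) * m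
      lemma₂ = solve-∀
      lemma₃ : ∀ e m → 2 * (e + m + m) ≡ 2 * e + 4 * m
      lemma₃ = solve-∀
      tM₂≤2E : t * M₂ ≤ 2 * E
      tM₂≤2E = +-cancelʳ-≤ (4 * M₂) _ _ (begin
        t * M₂ + 4 * M₂      ≡⟨ lemma₂ t M₂ ⟩
        (t + 4) * M₂         ≤⟨ [t+4]M₂≤2M₁ ⟩
        2 * M₁               ≡⟨ cong (2 *_) (trans (cong (_+ M₂) E+M₂≡D) D+M₂≡M₁) ⟨
        2 * (E + M₂ + M₂)    ≡⟨ lemma₃ E M₂ ⟩
        2 * E + 4 * M₂       ∎)

    -- If `S ⊆ Z`, the disjoint classes `missing w` for the `t` elements `w` of `S` avoid `S`.
    -- Otherwise some `s ∈ S` lies outside `Z`, and each of the `t + 2` classes keeps at least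
    -- `D ∸ M₂` sets without `s`.
    tD≤card-𝓐∖ : ∀ S → ∣ S ∣ ≡ t → t * D ≤ card (𝓐 k t Z ∖ supersets S)
    tD≤card-𝓐∖ S ∣S∣≡t with S ⊆? Z
    ... | yes S⊆Z = subst (λ l → l * D ≤ card (𝓐 k t Z ∖ supersets S)) (trans (length-elements S) ∣S∣≡t)
      (card-disjoint missing (𝓐 k t Z ∖ supersets S) (elements-unique S)
        (λ i → ≤-reflexive (sym (card-missing (S⊆Z (∈-elements⁻ S i)))))
        (λ {w} i F F∈ → ∖-supersets⁺ (𝓐 k t Z) S F (missing⊆𝓐 (S⊆Z (∈-elements⁻ S i)) F F∈)
          λ S⊆F → proj₂ (proj₂ (missing⁻ w F F∈)) (S⊆F (∈-elements⁻ S i)))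
        (λ F i _ → missing-disjoint F (S⊆Z (∈-elements⁻ S i))))
    ... | no S⊈Z with ⊈⇒∃ S Z S⊈Z
    ... | s , s∈S , s∉Z = ≤-trans tD≤[2+t][D∸M₂]
      (subst (λ l → l * (D ∸ M₂) ≤ card (𝓐 k t Z ∖ supersets S)) (trans (length-elements Z) ∣Z∣≡)
        (card-disjoint (λ w → missing w ∖ supersets ⁅ s ⁆) (𝓐 k t Z ∖ supersets S) (elements-unique Z)
          (λ i → card-missing-two (∈-elements⁻ Z i) s∉Z)
          (λ {w} i F F∈ → let F∈m , s∉F = ∖-point⁻ (missing w) s F F∈ in
            ∖-supersets⁺ (𝓐 k t Z) S F (missing⊆𝓐 (∈-elements⁻ Z i) F F∈m) λ S⊆F → s∉F (S⊆F s∈S))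
          (λ {w} {w′} F i _ F∈ F∈′ → missing-disjoint F (∈-elements⁻ Z i)
            (proj₁ (∖-point⁻ (missing w) s F F∈)) (proj₁ (∖-point⁻ (missing w′) s F F∈′)))))

    t-subset : ∃ λ S → S ⊆ˢ Z × ∣ S ∣ ≡ t
    t-subset = ∃-⊆-of-size Z (≤-trans (m≤n+m t 2) (≤-reflexive (sym ∣Z∣≡)))

    tD≤γ-𝓐 : t * D ≤ γ t (𝓐 k t Z)
    tD≤γ-𝓐 = let S , _ , ∣S∣≡t = t-subset in ≤-γ t (𝓐 k t Z) S ∣S∣≡t tD≤card-𝓐∖

    -- For `S ⊆ Z`, a member not above `S` misses some `w ∈ S`; having at least `t + 1` elements in
    -- `Z`, it contains all of `Z - w`.
    γ≤tD : ∀ {𝓕} → 𝓕 ⊆ 𝓐 k t Z → γ t 𝓕 ≤ t * D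
    γ≤tD {𝓕} 𝓕⊆𝓐 with t-subset
    ... | S , S⊆Z , ∣S∣≡t = ≤-trans (γ-≤ t 𝓕 S ∣S∣≡t)
      (subst (λ l → card (𝓕 ∖ supersets S) ≤ l * D) (trans (length-elements S) ∣S∣≡t)
        (card-cover (elements S) missing (𝓕 ∖ supersets S)
          (λ i → ≤-reflexive (card-missing (S⊆Z (∈-elements⁻ S i)))) cover))
      where
      cover : ∀ F → F ∈ 𝓕 ∖ supersets S → ∃ λ w → w ∈ˡ elements S × F ∈ missing w
      cover F F∈ with ∖-supersets⁻ 𝓕 S F F∈
      ... | F∈𝓕 , S⊈F with ⊈⇒∃ S F S⊈F | 𝓐⁻ k t Z F (𝓕⊆𝓐 F F∈𝓕)
      ... | w , w∈S , w∉F | ∣F∣≡k , t<∣F∩Z∣ = w , ∈-elements⁺ w∈S ,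
        ∖-point⁺ (star k (Z - w)) w F (star⁺ k (Z - w) F ∣F∣≡k (λ x∈ → p∩q⊆p F Z (Z-w⊆F∩Z x∈))) w∉F
        where
        F∩Z⊆Z-w : F ∩ Z ⊆ˢ Z - w
        F∩Z⊆Z-w x∈ = x∈p∧x≢y⇒x∈p-y (p∩q⊆q F Z x∈) λ { refl → w∉F (p∩q⊆p F Z x∈) }
        Z-w⊆F∩Z : Z - w ⊆ˢ F ∩ Z
        Z-w⊆F∩Z = ⊆∧∣≥∣⇒⊇ F∩Z⊆Z-w (≤-trans (≤-reflexive (trans (∣Z-w∣≡ (S⊆Z w∈S)) (+-comm 1 t))) t<∣F∩Z∣)

∣initial∣ : ∀ n m → m ≤ n → ∣ initial n m ∣ ≡ m
∣initial∣ zero    zero    _ = refl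
∣initial∣ (suc n) zero    _ = ∣initial∣ n zero z≤n
∣initial∣ (suc n) (suc m) (s≤s m≤n) = cong suc (∣initial∣ n m m≤n)

-- The main argument

∪ᶠ : ∀ {n} → ℕ → List (Subset n) → Family n
∪ᶠ k Xs F = any (λ X → star k X F) Xs

card-∪ᶠ : ∀ {n k b} (Xs : List (Subset n)) → (∀ {X} → X ∈ˡ Xs → card (star k X) ≤ b) → card (∪ᶠ k Xs) ≤ length Xs * b
card-∪ᶠ {k = k} Xs small = card-cover Xs (star k) (∪ᶠ k Xs) small λ F F∈ →
  find (any⁻ (λ X → star k X F) Xs F∈)

∪ᶠ⁺ : ∀ {n k} {Xs : List (Subset n)} {X} F → X ∈ˡ Xs → ∣ F ∣ ≡ k → X ⊆ˢ F → F ∈ ∪ᶠ k Xs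
∪ᶠ⁺ {k = k} {X = X} F i ∣F∣≡k X⊆F = any⁺ (λ X → star k X F) (lose i (star⁺ k X F ∣F∣≡k X⊆F))

module Main (n k t Q : ℕ) (2≤t : 2 ≤ t) (t+2≤k : t + 2 ≤ k)
  (18[t+2]≤Q : 18 * (t + 2) ≤ Q) (5k≤Q : 5 * k ≤ Q) (large : t + (k ∸ t) * Q ≤ n) where

  open Bounds n k t Q 2≤t t+2≤k 18[t+2]≤Q 5k≤Q large
  open Peeling n k t Q 2≤t t+2≤k 18[t+2]≤Q 5k≤Q large
  open Diversity n k t Q 2≤t t+2≤k 18[t+2]≤Q 5k≤Q large public
  open ≤-Reasoning

  t<n : t < n
  t<n = ≤-trans (≤-trans (≤-trans (≤-reflexive (+-comm 1 t)) (+-monoʳ-≤ t (s≤s z≤n))) t+2≤k) k≤n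

  open Structure {n} t t<n

  1+pred[t]≡t : suc (pred t) ≡ t
  1+pred[t]≡t = suc-pred t {{>-nonZero (≤-trans (s≤s z≤n) 2≤t)}}

  -- For every t-set S, the members of 𝓕 that lie above a member of 𝓟 but not
  -- above S are too many for the error terms to be absorbed.
  Heavy : Family n → Family n → Set
  Heavy 𝓕 𝓟 = ∀ S → ∣ S ∣ ≡ t → ∀ (𝓡 : Family n) →
    (∀ F A → F ∈ 𝓕 → A ∈ 𝓟 → A ⊆ˢ F → ¬ S ⊆ˢ F → F ∈ 𝓡) → ¬ card 𝓡 ≤ pred t * M₁ + k * M₂

  ⊆binom⇒∣∣≡ : ∀ {𝓕 : Family n} → 𝓕 ⊆ binom[ k ] → ∀ F → F ∈ 𝓕 → ∣ F ∣ ≡ k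
  ⊆binom⇒∣∣≡ 𝓕⊆ F F∈ = toWitness (𝓕⊆ F F∈)

  𝓕⊆kup : ∀ {𝓕 : Family n} → 𝓕 ⊆ binom[ k ] → 𝓕 ⊆ kup k 𝓕
  𝓕⊆kup {𝓕} 𝓕⊆ F F∈ = kup⁺ k 𝓕 F (⊆binom⇒∣∣≡ 𝓕⊆ F F∈) F∈ ⊆-refl

  -- If `𝓡` were that small, adding `t * M₂` and the peeling error to its size would give less than
  -- `t * M₁ = t * D + t * M₂` by `fineSum-small`, although the members of `𝓕` not above `S` number
  -- at least `t * D`.
  heavy : ∀ m {𝓕 𝓟 : Family n} → 𝓕 ⊆ binom[ k ] → t * D ≤ γ t 𝓕 → card (kup k 𝓕 ∖ up 𝓟) ≤ fineSum m → Heavy 𝓕 𝓟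
  heavy m {𝓕} {𝓟} 𝓕⊆ tD≤γ rest S ∣S∣≡t 𝓡 cover small = <-irrefl refl (begin-strict
    t * M₁                                          ≡⟨ tD+tM₂≡tM₁ ⟨
    t * D + t * M₂                                  ≤⟨ +-monoˡ-≤ (t * M₂) (≤-trans tD≤γ (≤-trans (γ-≤ t 𝓕 S ∣S∣≡t) count)) ⟩
    fineSum m + (pred t * M₁ + k * M₂) + t * M₂     ≡⟨ lemma (fineSum m) (pred t * M₁) (k * M₂) (t * M₂) ⟩
    fineSum m + (k * M₂ + t * M₂) + pred t * M₁     <⟨ +-monoˡ-< (pred t * M₁) (fineSum-small m) ⟩
    M₁ + pred t * M₁                                ≡⟨ cong (_* M₁) 1+pred[t]≡t ⟩
    t * M₁                                          ∎)
    where
    lemma : ∀ e a b c → e + (a + b) + c ≡ e + (b + c) + a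
    lemma = solve-∀
    split : ∀ F → F ∈ 𝓕 ∖ supersets S → F ∈ kup k 𝓕 ∖ up 𝓟 ⊎ F ∈ 𝓡
    split F F∈ with ∖-supersets⁻ 𝓕 S F F∈ | T? (up 𝓟 F)
    ... | F∈𝓕 , S⊈F | no F∉ = inj₁ (∖⁺ (kup k 𝓕) (up 𝓟) F (𝓕⊆kup 𝓕⊆ F F∈𝓕) F∉)
    ... | F∈𝓕 , S⊈F | yes F∈up = let A , A∈ , A⊆F = up⁻ 𝓟 F F∈up in inj₂ (cover F A F∈𝓕 A∈ A⊆F S⊈F)
    count : card (𝓕 ∖ supersets S) ≤ fineSum m + (pred t * M₁ + k * M₂)
    count = ≤-trans (card-∪ _ (kup k 𝓕 ∖ up 𝓟) 𝓡 split) (+-mono-≤ rest small)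

  -- A violation of `Spread` would put all the sets counted by `Heavy` into the single star above
  -- `X`, whose size `M₁` is at most `pred t * M₁` since `2 ≤ t`.
  heavy⇒spread : ∀ {𝓕 𝓟} → 𝓕 ⊆ binom[ k ] → Heavy 𝓕 𝓟 → Spread 𝓟
  heavy⇒spread {𝓕} {𝓟} 𝓕⊆ heavy S X ∣S∣≡t ∣X∣≡1+t above = heavy S ∣S∣≡t (star k X)
    (λ F A F∈ A∈ A⊆F S⊈F → star⁺ k X F (⊆binom⇒∣∣≡ 𝓕⊆ F F∈)
      (⊆-trans (above A A∈ λ S⊆A → S⊈F (⊆-trans S⊆A A⊆F)) A⊆F))
    (begin
      card (star k X)           ≡⟨ card-star₁ X ∣X∣≡1+t ⟩
      M₁                        ≡⟨ *-identityˡ M₁ ⟨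
      1 * M₁                    ≤⟨ *-monoˡ-≤ M₁ (≤-pred (≤-trans 2≤t (≤-reflexive (sym 1+pred[t]≡t)))) ⟩
      pred t * M₁               ≤⟨ m≤m+n _ (k * M₂) ⟩
      pred t * M₁ + k * M₂      ∎)

  -- A member of `𝓟` with at most `t` elements would be contained in every member of `𝓠`, but by
  -- `Spread` some member of `𝓠` does not contain it.
  exact-size : ∀ {𝓟 𝓠 : Family n} → CrossIntersecting t 𝓟 𝓠 → Spread 𝓠 →
    (∀ A → A ∈ 𝓟 → ∣ A ∣ ≤ suc t) → ∀ A → A ∈ 𝓟 → ∣ A ∣ ≡ suc t
  exact-size cross spread size A A∈ = ≤-antisym (size A A∈) (≰⇒> too-small)
    where
    too-small : ¬ ∣ A ∣ ≤ t
    too-small ∣A∣≤t with avoiding spread (proj₁ t-set) (proj₂ t-set)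
    ... | B , B∈ , _ with avoiding spread A (≤-antisym ∣A∣≤t (≤-trans (cross A B A∈ B∈) (∣p∩q∣≤∣p∣ A B)))
    ... | B′ , B′∈ , A⊈B′ = A⊈B′ λ x∈ →
      p∩q⊆q A B′ (⊆∧∣≥∣⇒⊇ (p∩q⊆p A B′) (≤-trans ∣A∣≤t (cross A B′ A∈ B′∈)) x∈)

  swap-cross : ∀ {𝓟 𝓠 : Family n} → CrossIntersecting t 𝓟 𝓠 → CrossIntersecting t 𝓠 𝓟
  swap-cross cross B A B∈ A∈ = subst (t ≤_) (∣p∩q∣≡∣q∩p∣ A B) (cross A B A∈ B∈)

  kernel-core : ∀ {𝓟 𝓠 : Family n} → (∀ A → A ∈ 𝓟 → ∣ A ∣ ≡ suc t) → (∀ B → B ∈ 𝓠 → ∣ B ∣ ≡ suc t) →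
    CrossIntersecting t 𝓟 𝓠 → Spread 𝓟 → Spread 𝓠 →
    ∃ λ Z → ∣ Z ∣ ≡ 2 + t × (∀ H → H ∈ 𝓟 ⊎ H ∈ 𝓠 → H ⊆ˢ Z)
  kernel-core {𝓟} {𝓠} 𝓟-size 𝓠-size cross 𝓟-spread 𝓠-spread =
    inside-t+2-set (λ H → H ∈ 𝓟 ⊎ H ∈ 𝓠) (λ H → [ 𝓟-size H , 𝓠-size H ]′) intersecting
      λ S ∣S∣≡t → let H , H∈ , S⊈H = avoiding 𝓟-spread S ∣S∣≡t in H , inj₁ H∈ , S⊈H
    where
    intersecting : ∀ H H′ → H ∈ 𝓟 ⊎ H ∈ 𝓠 → H′ ∈ 𝓟 ⊎ H′ ∈ 𝓠 → t ≤ ∣ H ∩ H′ ∣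
    intersecting H H′ (inj₁ H∈) (inj₁ H′∈) = Pair.𝓟-intersecting 𝓟-size 𝓠-size cross 𝓟-spread 𝓠-spread H H′ H∈ H′∈
    intersecting H H′ (inj₁ H∈) (inj₂ H′∈) = cross H H′ H∈ H′∈
    intersecting H H′ (inj₂ H∈) (inj₁ H′∈) = swap-cross cross H H′ H∈ H′∈
    intersecting H H′ (inj₂ H∈) (inj₂ H′∈) =
      Pair.𝓟-intersecting 𝓠-size 𝓟-size (swap-cross cross) 𝓠-spread 𝓟-spread H H′ H∈ H′∈

  module _ {𝓕 𝓖 𝓠 : Family n} (𝓕⊆ : 𝓕 ⊆ binom[ k ]) (𝓖⊆ : 𝓖 ⊆ binom[ k ])
    (cross : CrossIntersecting t 𝓕 𝓖) (𝓖-heavy : Heavy 𝓖 𝓠) (𝓠-size : ∀ B → B ∈ 𝓠 → ∣ B ∣ ≡ suc t)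
    (Z : Subset n) (∣Z∣≡ : ∣ Z ∣ ≡ 2 + t) (𝓠⊆Z : ∀ B → B ∈ 𝓠 → B ⊆ˢ Z) where

    -- The test set for `Heavy` consists of `z` and `t - 1` further points of `Z`. A set `G` above a
    -- member of `𝓠` but not above `S` misses some `w ∈ S` and so contains `Z - w`. Only the case
    -- `w = z` uses `F`, which then saves one full star.
    module Exceptional (F : Subset n) (F∈ : F ∈ 𝓕) (z : Fin n) (z∈Z : z ∈ˢ Z) (F∩[Z-z]<t : ∣ F ∩ (Z - z) ∣ < t) where

      S′-spec : ∃ λ S → S ⊆ˢ Z - z × ∣ S ∣ ≡ pred t
      S′-spec = ∃-⊆-of-size (Z - z) (≤-trans (≤-trans pred[n]≤n (n≤1+n t)) (≤-reflexive (sym (∣Z-w∣≡ Z ∣Z∣≡ z∈Z))))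

      S′ S : Subset n
      S′ = proj₁ S′-spec
      S = S′ ∪ ⁅ z ⁆

      ∣S′∣≡ : ∣ S′ ∣ ≡ pred t
      ∣S′∣≡ = proj₂ (proj₂ S′-spec)

      S′⊆ : S′ ⊆ˢ Z - z
      S′⊆ = proj₁ (proj₂ S′-spec)

      ∣S∣≡t : ∣ S ∣ ≡ t
      ∣S∣≡t = trans (∣p∪⁅x⁆∣≡1+∣p∣ S′ (x∉p-x Z z ∘ S′⊆)) (trans (cong suc ∣S′∣≡) 1+pred[t]≡t)

      -- Facets handle `w ∈ S′`, at cost `M₁` each. For `w = z`, cross-intersection with `F` forces
      -- into `G` a point of `F` outside `Z - z`; this gives at most `k` cones of cost `M₂`.
      facets cones : List (Subset n)
      facets = map (λ w → Z - w) (elements S′)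
      cones = map (λ v → (Z - z) ∪ ⁅ v ⁆) (elements (F ─ (Z - z)))

      card-facets : card (∪ᶠ k facets) ≤ pred t * M₁
      card-facets = subst (λ l → card (∪ᶠ k facets) ≤ l * M₁)
        (trans (length-map _ (elements S′)) (trans (length-elements S′) ∣S′∣≡))
        (card-∪ᶠ facets each)
        where
        each : ∀ {X} → X ∈ˡ facets → card (star k X) ≤ M₁
        each i with ∈-map⁻ (λ w → Z - w) i
        ... | w , j , refl = ≤-reflexive (card-star₁ (Z - w) (∣Z-w∣≡ Z ∣Z∣≡ (p─q⊆p Z ⁅ z ⁆ (S′⊆ (∈-elements⁻ S′ j)))))

      card-cones : card (∪ᶠ k cones) ≤ k * M₂
      card-cones = ≤-trans (card-∪ᶠ cones each) (*-monoˡ-≤ M₂ (begin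
        length cones                         ≡⟨ length-map _ (elements (F ─ (Z - z))) ⟩
        length (elements (F ─ (Z - z)))      ≡⟨ length-elements (F ─ (Z - z)) ⟩
        ∣ F ─ (Z - z) ∣                      ≤⟨ p⊆q⇒∣p∣≤∣q∣ (p─q⊆p F (Z - z)) ⟩
        ∣ F ∣                                ≡⟨ ⊆binom⇒∣∣≡ 𝓕⊆ F F∈ ⟩
        k                                    ∎))
        where
        each : ∀ {X} → X ∈ˡ cones → card (star k X) ≤ M₂
        each i with ∈-map⁻ (λ v → (Z - z) ∪ ⁅ v ⁆) i
        ... | v , j , refl = ≤-reflexive (card-star₂ ((Z - z) ∪ ⁅ v ⁆)
          (trans (∣p∪⁅x⁆∣≡1+∣p∣ (Z - z) (x∉p─q F (Z - z) (∈-elements⁻ (F ─ (Z - z)) j))) (cong suc (∣Z-w∣≡ Z ∣Z∣≡ z∈Z))))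

      𝓡 : Family n
      𝓡 G = ∪ᶠ k facets G ∨ ∪ᶠ k cones G

      𝓡-small : card 𝓡 ≤ pred t * M₁ + k * M₂
      𝓡-small = ≤-trans (card-∪ 𝓡 (∪ᶠ k facets) (∪ᶠ k cones) (λ G → Equivalence.to T-∨)) (+-mono-≤ card-facets card-cones)

      -- `B` has `t + 1` elements, lies in `Z` and omits `w`, so it is `Z - w`.
      facet⊆ : ∀ {B G w} → B ∈ 𝓠 → B ⊆ˢ G → w ∈ˢ Z → w ∉ˢ G → Z - w ⊆ˢ G
      facet⊆ {B} {G} {w} B∈ B⊆G w∈Z w∉G = ⊆-trans (⊆∧∣≥∣⇒⊇ B⊆Z-w (≤-reflexive (trans (∣Z-w∣≡ Z ∣Z∣≡ w∈Z) (sym (𝓠-size B B∈))))) B⊆G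
        where
        B⊆Z-w : B ⊆ˢ Z - w
        B⊆Z-w x∈ = x∈p∧x≢y⇒x∈p-y (𝓠⊆Z B B∈ x∈) λ { refl → w∉G (B⊆G x∈) }

      in-facets : ∀ {B G w} → G ∈ 𝓖 → B ∈ 𝓠 → B ⊆ˢ G → w ∈ˢ S′ → w ∉ˢ G → G ∈ ∪ᶠ k facets
      in-facets {G = G} G∈ B∈ B⊆G w∈S′ w∉G = ∪ᶠ⁺ G (∈-map⁺ _ (∈-elements⁺ w∈S′)) (⊆binom⇒∣∣≡ 𝓖⊆ G G∈)
        (facet⊆ B∈ B⊆G (p─q⊆p Z ⁅ z ⁆ (S′⊆ w∈S′)) w∉G)

      in-cones : ∀ {B G} → G ∈ 𝓖 → B ∈ 𝓠 → B ⊆ˢ G → z ∉ˢ G → G ∈ ∪ᶠ k cones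
      in-cones {B} {G} G∈ B∈ B⊆G z∉G = outside-point (∣p∩q∣<∣p∣⇒∃ (F ∩ G) (Z - z) (begin-strict
        ∣ (F ∩ G) ∩ (Z - z) ∣    ≤⟨ p⊆q⇒∣p∣≤∣q∣ (∩-mono {p = F ∩ G} {Z - z} (p∩q⊆p F G) ⊆-refl) ⟩
        ∣ F ∩ (Z - z) ∣          <⟨ F∩[Z-z]<t ⟩
        t                        ≤⟨ cross F G F∈ G∈ ⟩
        ∣ F ∩ G ∣                ∎))
        where
        outside-point : (∃ λ v → v ∈ˢ F ∩ G × v ∉ˢ Z - z) → G ∈ ∪ᶠ k cones
        outside-point (v , v∈ , v∉) = ∪ᶠ⁺ G (∈-map⁺ _ (∈-elements⁺ (x∈p∧x∉q⇒x∈p─q (p∩q⊆p F G v∈) v∉)))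
          (⊆binom⇒∣∣≡ 𝓖⊆ G G∈) (∪-lub (facet⊆ B∈ B⊆G z∈Z z∉G) (singleton⊆ (p∩q⊆q F G v∈)))

      cover : ∀ G B → G ∈ 𝓖 → B ∈ 𝓠 → B ⊆ˢ G → ¬ S ⊆ˢ G → G ∈ 𝓡
      cover G B G∈ B∈ B⊆G S⊈G = Equivalence.from T-∨ (by-point (⊈⇒∃ S G S⊈G))
        where
        by-point : (∃ λ w → w ∈ˢ S × w ∉ˢ G) → G ∈ ∪ᶠ k facets ⊎ G ∈ ∪ᶠ k cones
        by-point (w , w∈S , w∉G) with x∈p∪q⁻ S′ ⁅ z ⁆ w∈S
        ... | inj₁ w∈S′ = inj₁ (in-facets G∈ B∈ B⊆G w∈S′ w∉G)
        ... | inj₂ w∈z = inj₂ (in-cones G∈ B∈ B⊆G (subst (_∉ˢ G) (x∈⁅y⁆⇒x≡y z w∈z) w∉G))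

      impossible : ⊥
      impossible = 𝓖-heavy S ∣S∣≡t 𝓡 cover 𝓡-small

    𝓕⊆𝓐 : 𝓕 ⊆ 𝓐 k t Z
    𝓕⊆𝓐 F F∈ = 𝓐⁺ k t Z F (⊆binom⇒∣∣≡ 𝓕⊆ F F∈) (≮⇒≥ λ few →
      let z , z∈Z , lt = point (≤-pred (≤-trans few (≤-reflexive (+-comm t 1)))) in Exceptional.impossible F F∈ z z∈Z lt)
      where
      -- Removing a point of `F ∩ Z` brings the trace below `t`; if the trace is empty, any point of
      -- `Z` will do because `t` is positive.
      point : ∣ F ∩ Z ∣ ≤ t → ∃ λ z → z ∈ˢ Z × ∣ F ∩ (Z - z) ∣ < t
      point le with nonempty? (F ∩ Z)
      ... | yes (z , z∈) = z , p∩q⊆q F Z z∈ , ≤-trans (s≤s (p⊆q⇒∣p∣≤∣q∣ sub)) (≤-trans (≤-reflexive (1+∣p-x∣≡∣p∣ (F ∩ Z) z∈)) le)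
        where
        sub : F ∩ (Z - z) ⊆ˢ (F ∩ Z) - z
        sub x∈ = x∈p∧x∉q⇒x∈p─q (x∈p∩q⁺ (p∩q⊆p F (Z - z) x∈ , p─q⊆p Z ⁅ z ⁆ (p∩q⊆q F (Z - z) x∈)))
          (x∉p─q Z ⁅ z ⁆ (p∩q⊆q F (Z - z) x∈))
      ... | no empty = let z , z∈Z = 0<∣p∣⇒Nonempty Z (subst (0 <_) (sym ∣Z∣≡) (s≤s z≤n)) in
        z , z∈Z , ≰⇒> λ t≤ → let x , x∈ = 0<∣p∣⇒Nonempty (F ∩ (Z - z)) (≤-trans (≤-trans (s≤s z≤n) 2≤t) t≤) in
          empty (x , ∩-mono {p = F} {Z - z} ⊆-refl (p─q⊆p Z ⁅ z ⁆) x∈)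

  coarse-impossible : ∀ m {𝓕 : Family n} → 𝓕 ⊆ binom[ k ] → t * D ≤ γ t 𝓕 → ¬ card (kup k 𝓕) ≤ coarseSum m
  coarse-impossible m {𝓕} 𝓕⊆ tD≤γ small = <-irrefl refl (begin-strict
    t * M₁                     ≡⟨ tD+tM₂≡tM₁ ⟨
    t * D + t * M₂             ≤⟨ +-monoˡ-≤ (t * M₂) (≤-trans tD≤γ (≤-trans (m∸n≤m (card 𝓕) (Δ t 𝓕)) (≤-trans (card-mono (𝓕⊆kup 𝓕⊆)) small))) ⟩
    coarseSum m + t * M₂       <⟨ coarseSum-small m ⟩
    t * M₁                     ∎)

  -- Assuming only lower bounds on the diversities lets this serve both the inequality and the case
  -- of equality.
  stability : ∀ (𝓕 𝓖 : Family n) → 𝓕 ⊆ binom[ k ] → 𝓖 ⊆ binom[ k ] → CrossIntersecting t 𝓕 𝓖 →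
    t * D ≤ γ t 𝓕 → t * D ≤ γ t 𝓖 → ∃ λ Z → ∣ Z ∣ ≡ 2 + t × 𝓕 ⊆ 𝓐 k t Z × 𝓖 ⊆ 𝓐 k t Z
  -- The peeling bounds hold for every number of levels, so it is safe to start from `1 + k + t`,
  -- which exceeds the actual size `k`.
  stability 𝓕 𝓖 𝓕⊆ 𝓖⊆ cross tD≤γ𝓕 tD≤γ𝓖 with peel k 𝓕 𝓖 (size 𝓕⊆) (size 𝓖⊆) cross
    where
    size : ∀ {𝓕 : Family n} → 𝓕 ⊆ binom[ k ] → ∀ X → X ∈ 𝓕 → ∣ X ∣ ≤ 1 + k + t
    size 𝓕⊆ X X∈ = ≤-trans (≤-reflexive (⊆binom⇒∣∣≡ 𝓕⊆ X X∈)) (≤-trans (n≤1+n k) (m≤m+n (suc k) t))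
  ... | inj₁ (inj₁ small) = ⊥-elim (coarse-impossible k 𝓕⊆ tD≤γ𝓕 small)
  ... | inj₁ (inj₂ small) = ⊥-elim (coarse-impossible k 𝓖⊆ tD≤γ𝓖 small)
  ... | inj₂ K = conclude (kernel-core 𝓟-size′ 𝓠-size′ cross′ 𝓟-spread 𝓠-spread)
    where
    open Kernels K renaming (cross to cross′)
    𝓟-heavy : Heavy 𝓕 𝓟
    𝓟-heavy = heavy k 𝓕⊆ tD≤γ𝓕 𝓕-rest
    𝓠-heavy : Heavy 𝓖 𝓠
    𝓠-heavy = heavy k 𝓖⊆ tD≤γ𝓖 𝓖-rest
    𝓟-spread : Spread 𝓟
    𝓟-spread = heavy⇒spread 𝓕⊆ 𝓟-heavy
    𝓠-spread : Spread 𝓠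
    𝓠-spread = heavy⇒spread 𝓖⊆ 𝓠-heavy
    𝓟-size′ : ∀ A → A ∈ 𝓟 → ∣ A ∣ ≡ suc t
    𝓟-size′ = exact-size cross′ 𝓠-spread 𝓟-size
    𝓠-size′ : ∀ B → B ∈ 𝓠 → ∣ B ∣ ≡ suc t
    𝓠-size′ = exact-size (swap-cross cross′) 𝓟-spread 𝓠-size
    conclude : (∃ λ Z → ∣ Z ∣ ≡ 2 + t × (∀ H → H ∈ 𝓟 ⊎ H ∈ 𝓠 → H ⊆ˢ Z)) →
      ∃ λ Z → ∣ Z ∣ ≡ 2 + t × 𝓕 ⊆ 𝓐 k t Z × 𝓖 ⊆ 𝓐 k t Z
    conclude (Z , ∣Z∣≡ , ⊆Z) = Z , ∣Z∣≡ ,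
      𝓕⊆𝓐 𝓕⊆ 𝓖⊆ cross 𝓠-heavy 𝓠-size′ Z ∣Z∣≡ (λ B B∈ → ⊆Z B (inj₂ B∈)) ,
      𝓕⊆𝓐 𝓖⊆ 𝓕⊆ (swap-cross cross) 𝓟-heavy 𝓟-size′ Z ∣Z∣≡ (λ A A∈ → ⊆Z A (inj₁ A∈))

  tD≤γ-𝓐₀ : t * D ≤ γ t (𝓐₀ n k t)
  tD≤γ-𝓐₀ = tD≤γ-𝓐 (initial n (t + 2)) (trans (∣initial∣ n (t + 2) (≤-trans t+2≤k k≤n)) (+-comm t 2))

theorem1p10 : ∀ (n k t : ℕ) → t + 2 ≤ k → 4 ≤ t + 2 → AtLeastThreshold n k t →
    ∀ (𝓕 𝓖 : Family n) → 𝓕 ⊆ binom[ k ] → 𝓖 ⊆ binom[ k ] → CrossIntersecting t 𝓕 𝓖 →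
    (γ t 𝓕 ⊓ γ t 𝓖 ≤ γ t (𝓐₀ n k t)) ×
    (γ t 𝓕 ⊓ γ t 𝓖 ≡ γ t (𝓐₀ n k t) → ∃[ Z ] Z ∈ binom[ t + 2 ] × 𝓕 ⊆ 𝓐 k t Z × 𝓖 ⊆ 𝓐 k t Z)
theorem1p10 n k t t+2≤k 4≤t+2 large 𝓕 𝓖 𝓕⊆ 𝓖⊆ cross = upper , equality
  where
  open Main n k t (18 * (t + 2) ⊔ 5 * k) (+-cancelʳ-≤ 2 2 t 4≤t+2) t+2≤k
    (m≤m⊔n (18 * (t + 2)) (5 * k)) (m≤n⊔m (18 * (t + 2)) (5 * k)) (threshold⇒≤ n k t large)
  stable : t * D ≤ γ t 𝓕 ⊓ γ t 𝓖 → ∃ λ Z → ∣ Z ∣ ≡ 2 + t × 𝓕 ⊆ 𝓐 k t Z × 𝓖 ⊆ 𝓐 k t Z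
  stable le = stability 𝓕 𝓖 𝓕⊆ 𝓖⊆ cross (m≤n⊓o⇒m≤n (γ t 𝓕) (γ t 𝓖) le) (m≤n⊓o⇒m≤o (γ t 𝓕) (γ t 𝓖) le)
  upper : γ t 𝓕 ⊓ γ t 𝓖 ≤ γ t (𝓐₀ n k t)
  upper with γ t 𝓕 ⊓ γ t 𝓖 ≤? γ t (𝓐₀ n k t)
  ... | yes le = le
  -- If the minimum exceeded the claimed bound, `𝓕` would lie in some `𝓐 k t Z`, and `γ≤tD` gives
  -- the bound after all.
  ... | no ≰ = let Z , ∣Z∣≡ , 𝓕⊆𝓐 , _ = stable (≤-trans tD≤γ-𝓐₀ (<⇒≤ (≰⇒> ≰))) in
    ≤-trans (m⊓n≤m (γ t 𝓕) (γ t 𝓖)) (≤-trans (γ≤tD Z ∣Z∣≡ 𝓕⊆𝓐) tD≤γ-𝓐₀)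
  equality : γ t 𝓕 ⊓ γ t 𝓖 ≡ γ t (𝓐₀ n k t) → ∃[ Z ] Z ∈ binom[ t + 2 ] × 𝓕 ⊆ 𝓐 k t Z × 𝓖 ⊆ 𝓐 k t Z
  equality eq = let Z , ∣Z∣≡ , 𝓕⊆𝓐 , 𝓖⊆𝓐 = stable (≤-trans tD≤γ-𝓐₀ (≤-reflexive (sym eq))) in
    Z , fromWitness (trans ∣Z∣≡ (+-comm 2 t)) , 𝓕⊆𝓐 , 𝓖⊆𝓐
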